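{- Let $T$ be a consistent primitive recursively axiomatized $\mathcal{L}_A$-theory containing $\mathsf{PA}$. Then there exists a $\Sigma_1$ provability predicate $\mathrm{Pr}_T(x)$ of $T$ such that (1) for any modal formula $A$ and any arithmetical interpretation $f$ based on $\mathrm{Pr}_T(x)$, if $\mathbf{K}\vdash A$, then $\mathsf{PA}\vdash f(A)$; and (2) there exists an arithmetical interpretation $f$ based on $\mathrm{Pr}_T(x)$ such that for any modal formula $A$, $\mathbf{K}\vdash A$ if and only if $T\vdash f(A)$.
   Context: $\mathcal{L}_A$ is the language of first-order arithmetic. An $\mathcal{L}_A$-formula $\mathrm{Pr}_T(x)$ is a provability predicate of $T$ if for every $\mathcal{L}_A$-formula $\varphi$, $T\vdash\varphi$ iff $\mathsf{PA}\vdash\mathrm{Pr}_T(\ulcorner\varphi\urcorner)$. Modal formulas are built from propositional variables and $\bot$ using $\neg,\land,\lor,\to$ and $\Box$. An arithmetical interpretation based on $\mathrm{Pr}_T(x)$ is a map $f$ from modal formulas to $\mathcal{L}_A$-sentences with $f(p)$ arbitrary for variables, $f(\bot)$ being $0=1$, $f$ commuting with Boolean connectives, and $f(\Box A)$ being $\mathrm{Pr}_T(\ulcorner f(A)\urcorner)$. $\mathbf{K}$ is the standard minimal normal modal logic (tautologies, $\Box(A\to B)\to(\Box A\to\Box B)$, Modus Ponens, Necessitation). -}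

module Defs where

open import Data.Nat using (ℕ; zero; suc; _+_; _*_)
open import Data.Fin using (Fin; toℕ) renaming (zero to fz; suc to fs)
open import Data.Vec using (Vec; []; _∷_)
open import Data.Bool using (Bool; true; false; not; _∧_; _∨_)
open import Data.Product using (Σ; _×_; _,_)
open import Relation.Binary.PropositionalEquality using (_≡_)
open import Relation.Nullary using (¬_)

infix 2 _⟺_
_⟺_ : Set → Set → Set
A ⟺ B = (A → B) × (B → A)

infixl 7 _`*_
infixl 6 _`+_
data Term (n : ℕ) : Set where
  var  : Fin n → Term n
  `0   : Term n
  `S   : Term n → Term n
  _`+_ : Term n → Term n → Term n
  _`*_ : Term n → Term n → Term n

infix  5 _≐_
infixr 3 _⇒_
data Formula (n : ℕ) : Set where
  ⊥'  : Formula n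
  _≐_ : Term n → Term n → Formula n
  _⇒_ : Formula n → Formula n → Formula n
  ∀'  : Formula (suc n) → Formula n

infixr 4 _∧'_
infixr 4 _∨'_
infix 8 _[_]
infix 5 _≤'_

¬' : ∀ {n} → Formula n → Formula n
¬' φ = φ ⇒ ⊥'

_∨'_ : ∀ {n} → Formula n → Formula n → Formula n
φ ∨' ψ = ¬' φ ⇒ ψ

_∧'_ : ∀ {n} → Formula n → Formula n → Formula n
φ ∧' ψ = ¬' (φ ⇒ ¬' ψ)

∃' : ∀ {n} → Formula (suc n) → Formula n
∃' φ = ¬' (∀' (¬' φ))

tren : ∀ {m n} → (Fin m → Fin n) → Term m → Term n
tren ρ (var i) = var (ρ i)
tren ρ `0 = `0
tren ρ (`S t) = `S (tren ρ t)
tren ρ (s `+ t) = tren ρ s `+ tren ρ t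
tren ρ (s `* t) = tren ρ s `* tren ρ t

tsub : ∀ {m n} → (Fin m → Term n) → Term m → Term n
tsub σ (var i) = σ i
tsub σ `0 = `0
tsub σ (`S t) = `S (tsub σ t)
tsub σ (s `+ t) = tsub σ s `+ tsub σ t
tsub σ (s `* t) = tsub σ s `* tsub σ t

lift : ∀ {m n} → (Fin m → Term n) → Fin (suc m) → Term (suc n)
lift σ fz = var fz
lift σ (fs i) = tren fs (σ i)

fsub : ∀ {m n} → (Fin m → Term n) → Formula m → Formula n
fsub σ ⊥' = ⊥'
fsub σ (s ≐ t) = tsub σ s ≐ tsub σ t
fsub σ (φ ⇒ ψ) = fsub σ φ ⇒ fsub σ ψ
fsub σ (∀' φ) = ∀' (fsub (lift σ) φ)

wkT : ∀ {n} → Term n → Term (suc n)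
wkT = tren fs

wk : ∀ {n} → Formula n → Formula (suc n)
wk = fsub (λ i → var (fs i))

_[_] : ∀ {n} → Formula (suc n) → Term n → Formula n
φ [ t ] = fsub σ φ
  where
  σ : Fin (suc _) → Term _
  σ fz = t
  σ (fs i) = var i

close↑ : ∀ {n} → Formula 0 → Formula n
close↑ = fsub (λ ())

closeAll : ∀ {n} → Formula n → Formula 0
closeAll {zero} φ = φ
closeAll {suc n} φ = closeAll (∀' φ)

num : ∀ {n} → ℕ → Term n
num zero = `0
num (suc k) = `S (num k)

Theory : Set₁
Theory = Formula 0 → Set

infix 1 _⊢_
data _⊢_ (T : Theory) : ∀ {n} → Formula n → Set where
  ax    : ∀ {n} {ψ} → T ψ → T ⊢ close↑ {n} ψ
  axK   : ∀ {n} {φ ψ : Formula n} → T ⊢ φ ⇒ ψ ⇒ φ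
  axS   : ∀ {n} {φ ψ χ : Formula n} →
          T ⊢ (φ ⇒ ψ ⇒ χ) ⇒ (φ ⇒ ψ) ⇒ φ ⇒ χ
  axDN  : ∀ {n} {φ : Formula n} → T ⊢ ¬' (¬' φ) ⇒ φ
  mp    : ∀ {n} {φ ψ : Formula n} → T ⊢ φ ⇒ ψ → T ⊢ φ → T ⊢ ψ
  axInst : ∀ {n} {φ : Formula (suc n)} {t : Term n} → T ⊢ ∀' φ ⇒ φ [ t ]
  axDist : ∀ {n} {ψ : Formula n} {φ : Formula (suc n)} →
           T ⊢ ∀' (wk ψ ⇒ φ) ⇒ ψ ⇒ ∀' φ
  gen   : ∀ {n} {φ : Formula (suc n)} → T ⊢ φ → T ⊢ ∀' φ
  axRefl : ∀ {n} {t : Term n} → T ⊢ t ≐ t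
  axLeib : ∀ {n} {s t : Term n} {φ : Formula (suc n)} →
           T ⊢ s ≐ t ⇒ φ [ s ] ⇒ φ [ t ]

Consistent : Theory → Set
Consistent T = ¬ (T ⊢ ⊥' {0})

private
  x₁ : Term 1
  x₁ = var fz
  x₂ y₂ : Term 2
  x₂ = var (fs fz)
  y₂ = var fz

stepS : ∀ {n} → Formula (suc n) → Formula (suc n)
stepS φ = fsub σ φ
  where
  σ : Fin (suc _) → Term (suc _)
  σ fz = `S (var fz)
  σ (fs i) = var (fs i)

indInst : ∀ {n} → Formula (suc n) → Formula n
indInst φ = (φ [ `0 ] ∧' ∀' (φ ⇒ stepS φ)) ⇒ ∀' φ

data PA : Theory where
  pa1 : PA (∀' (¬' (`S x₁ ≐ `0)))
  pa2 : PA (∀' (∀' (`S x₂ ≐ `S y₂ ⇒ x₂ ≐ y₂)))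
  pa3 : PA (∀' (x₁ `+ `0 ≐ x₁))
  pa4 : PA (∀' (∀' (x₂ `+ `S y₂ ≐ `S (x₂ `+ y₂))))
  pa5 : PA (∀' (x₁ `* `0 ≐ `0))
  pa6 : PA (∀' (∀' (x₂ `* `S y₂ ≐ x₂ `* y₂ `+ x₂)))
  paInd : ∀ {n} (φ : Formula (suc n)) → PA (closeAll (indInst φ))

tri : ℕ → ℕ
tri zero = zero
tri (suc k) = suc k + tri k

pair : ℕ → ℕ → ℕ
pair a b = tri (a + b) + b

⌜_⌝ₜ : ∀ {n} → Term n → ℕ
⌜ var i ⌝ₜ = pair 0 (toℕ i)
⌜ `0 ⌝ₜ = pair 1 0
⌜ `S t ⌝ₜ = pair 2 ⌜ t ⌝ₜ
⌜ s `+ t ⌝ₜ = pair 3 (pair ⌜ s ⌝ₜ ⌜ t ⌝ₜ)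
⌜ s `* t ⌝ₜ = pair 4 (pair ⌜ s ⌝ₜ ⌜ t ⌝ₜ)

⌜_⌝ : ∀ {n} → Formula n → ℕ
⌜ ⊥' ⌝ = pair 0 0
⌜ s ≐ t ⌝ = pair 1 (pair ⌜ s ⌝ₜ ⌜ t ⌝ₜ)
⌜ φ ⇒ ψ ⌝ = pair 2 (pair ⌜ φ ⌝ ⌜ ψ ⌝)
⌜ ∀' φ ⌝ = pair 3 ⌜ φ ⌝

_≤'_ : ∀ {n} → Term n → Term n → Formula n
t ≤' s = ∃' (wkT t `+ var fz ≐ wkT s)

data Δ₀ : ∀ {n} → Formula n → Set where
  d-⊥  : ∀ {n} → Δ₀ (⊥' {n})
  d-≐  : ∀ {n} (s t : Term n) → Δ₀ (s ≐ t)
  d-≤  : ∀ {n} (s t : Term n) → Δ₀ (s ≤' t)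
  d-⇒  : ∀ {n} {φ ψ : Formula n} → Δ₀ φ → Δ₀ ψ → Δ₀ (φ ⇒ ψ)
  d-∀≤ : ∀ {n} (t : Term n) {φ : Formula (suc n)} → Δ₀ φ →
         Δ₀ (∀' (var fz ≤' wkT t ⇒ φ))

data Σ₁ : ∀ {n} → Formula n → Set where
  s-Δ₀ : ∀ {n} {φ : Formula n} → Δ₀ φ → Σ₁ φ
  s-∃  : ∀ {n} {φ : Formula (suc n)} → Σ₁ φ → Σ₁ (∃' φ)

data PR : ℕ → Set where
  zeroF : PR 0
  succF : PR 1
  proj  : ∀ {n} → Fin n → PR n
  comp  : ∀ {k n} → PR k → Vec (PR n) k → PR n
  rec   : ∀ {n} → PR n → PR (suc (suc n)) → PR (suc n)

mutual
  evalPR : ∀ {n} → PR n → Vec ℕ n → ℕ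
  evalPR zeroF [] = 0
  evalPR succF (x ∷ []) = suc x
  evalPR (proj i) xs = Data.Vec.lookup xs i
  evalPR (comp f gs) xs = evalPR f (evalPRs gs xs)
  evalPR (rec f g) (k ∷ xs) = evalRec f g k xs

  evalPRs : ∀ {k n} → Vec (PR n) k → Vec ℕ n → Vec ℕ k
  evalPRs [] xs = []
  evalPRs (g ∷ gs) xs = evalPR g xs ∷ evalPRs gs xs

  evalRec : ∀ {n} → PR n → PR (suc (suc n)) → ℕ → Vec ℕ n → ℕ
  evalRec f g zero xs = evalPR f xs
  evalRec f g (suc k) xs = evalPR g (evalRec f g k xs ∷ k ∷ xs)

PRAxiomatized : Theory → Set
PRAxiomatized T =
  Σ (PR 1) λ χ → ∀ m →
    (evalPR χ (m ∷ []) ≡ 0) ⟺ (Σ (Formula 0) λ φ → T φ × ⌜ φ ⌝ ≡ m)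

ExtendsPA : Theory → Set
ExtendsPA T = ∀ {φ} → PA φ → T ⊢ φ

ProvabilityPredicate : Theory → Formula 1 → Set
ProvabilityPredicate T Pr =
  ∀ {n} (φ : Formula n) → (T ⊢ φ) ⟺ (PA ⊢ Pr [ num ⌜ φ ⌝ ])

infixr 3 _`→_
data MF : Set where
  `p   : ℕ → MF
  `⊥   : MF
  `¬   : MF → MF
  _`∧_ : MF → MF → MF
  _`∨_ : MF → MF → MF
  _`→_ : MF → MF → MF
  □    : MF → MF

-- Boolean valuation treating variables and boxed formulas as atoms
evalB : (MF → Bool) → MF → Bool
evalB v (`p i) = v (`p i)
evalB v `⊥ = false
evalB v (`¬ A) = not (evalB v A)
evalB v (A `∧ B) = evalB v A ∧ evalB v B
evalB v (A `∨ B) = evalB v A ∨ evalB v B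
evalB v (A `→ B) = not (evalB v A) ∨ evalB v B
evalB v (□ A) = v (□ A)

Tautology : MF → Set
Tautology A = ∀ (v : MF → Bool) → evalB v A ≡ true

data K⊢ : MF → Set where
  taut : ∀ {A} → Tautology A → K⊢ A
  axK  : ∀ {A B} → K⊢ (□ (A `→ B) `→ (□ A `→ □ B))
  mp   : ∀ {A B} → K⊢ (A `→ B) → K⊢ A → K⊢ B
  nec  : ∀ {A} → K⊢ A → K⊢ (□ A)

interp : Formula 1 → (ℕ → Formula 0) → MF → Formula 0
interp Pr f (`p i) = f i
interp Pr f `⊥ = `0 ≐ `S `0
interp Pr f (`¬ A) = ¬' (interp Pr f A)
interp Pr f (A `∧ B) = interp Pr f A ∧' interp Pr f B
interp Pr f (A `∨ B) = interp Pr f A ∨' interp Pr f B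
interp Pr f (A `→ B) = interp Pr f A ⇒ interp Pr f B
interp Pr f (□ A) = Pr [ num ⌜ interp Pr f A ⌝ ]

{-# OPTIONS --safe #-}

-- Let P(j, x, y) say that x lies in every set of codes that is closed under modus ponens and contains all
-- theorems of T, and Λᵢ if j = i + 1, that are listed before stage y; only codes in an interval [0, μ]
-- all of whose subsets have codes below y count. This is bounded, provably monotone in y and provably
-- closed under modus ponens at every fixed stage, since restricting a closed set to a smaller interval keeps
-- it closed. Λᵢ says that i is the first world refuted, i.e. with P(i + 1, ⊥, y) at the first stage y where
-- this happens for some i (a diagonal definition, as P mentions the code of Λᵢ). Were some stage really a
-- trigger, Λᵢ would be a true Σ₁ sentence, hence provable as well as refutable in T; so no standard stage is
-- one, and PA knows this of each of them.
--
-- Pr(x) holds if x is derived from T before the first trigger, or if that trigger is the world i and x is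
-- derived from Λⱼ just before it for every successor j of i. With the finite trees as worlds and f(p)
-- saying "the first trigger forces p", PA proves Λᵢ → f(A) or Λᵢ → ¬f(A) according to whether i forces A:
-- for □A because the stage before the trigger is nonstandard, so everything T proves from Λⱼ is derived
-- there, and not ⊥. A non-theorem of K fails at some tree i, and T does not refute Λᵢ.

module Submission where

open import Defs
open import Data.Bool using (Bool; true; false; not; _∧_; _∨_; if_then_else_)
open import Data.Bool.ListAction using (all)
import Data.Bool.Properties as 𝔹
open import Data.Empty using (⊥; ⊥-elim)
open import Data.Fin using (Fin; toℕ; fromℕ<; inject≤; splitAt; #_; _↑ˡ_; _↑ʳ_) renaming (zero to fz; suc to fs)
open import Data.Fin.Patterns using (1F; 2F; 3F; 4F; 5F; 6F)
open import Data.Fin.Properties using (toℕ-injective; toℕ-fromℕ<; toℕ<n; toℕ-↑ˡ; toℕ-inject≤; splitAt-↑ˡ)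
open import Data.List using (List; []; _∷_; filter; upTo; length) renaming (map to mapL; _++_ to _++ᴸ_; lookup to lookupL)
open import Data.List.Membership.Propositional using (_∈_; find)
open import Data.List.Membership.Propositional.Properties using (∈-map⁺; ∈-map⁻; ∈-++⁺ˡ; ∈-++⁺ʳ; ∈-++⁻; ∈-filter⁺; ∈-filter⁻; ∈-upTo⁺; ∈-upTo⁻; ∈-lookup)
open import Data.List.Properties using (map-∘; map-cong)
open import Data.List.Relation.Unary.All as All using (All; []; _∷_)
open import Data.List.Relation.Unary.All.Properties using (++⁺; ++⁻ˡ; ++⁻ʳ; map⁺; map⁻)
open import Data.List.Relation.Unary.Any as Any using (Any; here; there; any?)
open import Data.Maybe using (Maybe; just; nothing)
open import Data.Nat using (ℕ; zero; suc; _+_; _*_; _≤_; _<_; _⊔_; z≤n; s≤s; s≤s⁻¹)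
open import Data.Nat.Divisibility using (_∣_; divides; ∣m+n∣m⇒∣n; m∣m*n; n∣m*n; ∣m⇒∣m*n; ∣n⇒∣m*n; ∣1⇒≡1; ∣-refl)
open import Data.Nat.Properties as ℕₚ using (≤-refl; ≤-trans; ≤-reflexive; +-assoc; +-comm; +-identityʳ; +-suc; *-suc; *-zeroʳ; +-mono-≤; +-monoʳ-≤; <-cmp; m≤m+n; m≤n+m; m≤m*n; m≤m⊔n; m≤n⊔m; m≤n⇒m≤1+n; m≤n⇒m<n∨m≡n)
open import Data.List.Membership.DecPropositional ℕₚ._≟_ using (_∈?_)
open import Data.Nat.Tactic.RingSolver using (solve-∀)
open import Data.Product using (Σ; ∃; ∃₂; _×_; _,_; proj₁; proj₂)
open import Data.Sum using (_⊎_; inj₁; inj₂; [_,_]′)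
open import Data.Unit using (⊤)
open import Data.Vec using (Vec; []; _∷_; lookup; map; _++_)
open import Data.Vec.Properties using (lookup-map; lookup-++ˡ; lookup-++ʳ)
open import Function using (_∘_; id; const)
open import Relation.Binary using (tri<; tri≈; tri>)
open import Relation.Binary.PropositionalEquality using (_≡_; refl; sym; trans; cong; cong₂; subst; subst₂)
open import Relation.Nullary using (¬_; Dec; yes; no; does)
open import Relation.Nullary.Decidable using (_⊎-dec_; dec-true; dec-false)

-- Substitution calculus

-- PA must prove distribution for nonstandard stages too, and a box is read at one fixed stage, the
-- one before the trigger. Joining two proofs into a longer one that appears later is therefore no
-- answer. Membership in every closed set gives modus ponens at the same stage; the price is that a
-- set closed up to a larger bound must be cut down to one with a small code. The existence of such
-- codes is made a clause of derivability at a stage: it is true at suitable standard stages, and a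
-- derivation at a nonstandard stage carries it along. So PA reasons about unspecified numbers only
-- through order, restriction of sets and modus ponens; all syntax is seen on numerals, where
-- bounded formulas are decided.
--
-- The stage before the trigger is the right one because nothing is refuted there: if it derives ¬A
-- from Λⱼ, it cannot derive A as well. A box consults only the sentences of the chosen successors,
-- so neither transitivity nor a Löb principle is imposed on `Pr`.
--
-- The metatheory is constructive, so every case distinction needs a decision: bounded truth is
-- decidable, and the tableau returns a proof or a tree.

tsub-cong : ∀ {m n} {σ τ : Fin m → Term n} → (∀ i → σ i ≡ τ i) → ∀ t → tsub σ t ≡ tsub τ t
tsub-cong h (var i) = h i
tsub-cong h `0 = refl
tsub-cong h (`S t) = cong `S (tsub-cong h t)
tsub-cong h (s `+ t) = cong₂ _`+_ (tsub-cong h s) (tsub-cong h t)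
tsub-cong h (s `* t) = cong₂ _`*_ (tsub-cong h s) (tsub-cong h t)

lift-cong : ∀ {m n} {σ τ : Fin m → Term n} → (∀ i → σ i ≡ τ i) → ∀ i → lift σ i ≡ lift τ i
lift-cong h fz = refl
lift-cong h (fs i) = cong wkT (h i)

fsub-cong : ∀ {m n} {σ τ : Fin m → Term n} → (∀ i → σ i ≡ τ i) → ∀ φ → fsub σ φ ≡ fsub τ φ
fsub-cong h ⊥' = refl
fsub-cong h (s ≐ t) = cong₂ _≐_ (tsub-cong h s) (tsub-cong h t)
fsub-cong h (φ ⇒ ψ) = cong₂ _⇒_ (fsub-cong h φ) (fsub-cong h ψ)
fsub-cong h (∀' φ) = cong ∀' (fsub-cong (lift-cong h) φ)

tsub-tren : ∀ {l m n} (σ : Fin m → Term n) (ρ : Fin l → Fin m) t → tsub σ (tren ρ t) ≡ tsub (σ ∘ ρ) t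
tsub-tren σ ρ (var i) = refl
tsub-tren σ ρ `0 = refl
tsub-tren σ ρ (`S t) = cong `S (tsub-tren σ ρ t)
tsub-tren σ ρ (s `+ t) = cong₂ _`+_ (tsub-tren σ ρ s) (tsub-tren σ ρ t)
tsub-tren σ ρ (s `* t) = cong₂ _`*_ (tsub-tren σ ρ s) (tsub-tren σ ρ t)

tren-tsub : ∀ {l m n} (ρ : Fin m → Fin n) (σ : Fin l → Term m) t → tren ρ (tsub σ t) ≡ tsub (tren ρ ∘ σ) t
tren-tsub ρ σ (var i) = refl
tren-tsub ρ σ `0 = refl
tren-tsub ρ σ (`S t) = cong `S (tren-tsub ρ σ t)
tren-tsub ρ σ (s `+ t) = cong₂ _`+_ (tren-tsub ρ σ s) (tren-tsub ρ σ t)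
tren-tsub ρ σ (s `* t) = cong₂ _`*_ (tren-tsub ρ σ s) (tren-tsub ρ σ t)

tsub-tsub : ∀ {l m n} (τ : Fin m → Term n) (σ : Fin l → Term m) t → tsub τ (tsub σ t) ≡ tsub (tsub τ ∘ σ) t
tsub-tsub τ σ (var i) = refl
tsub-tsub τ σ `0 = refl
tsub-tsub τ σ (`S t) = cong `S (tsub-tsub τ σ t)
tsub-tsub τ σ (s `+ t) = cong₂ _`+_ (tsub-tsub τ σ s) (tsub-tsub τ σ t)
tsub-tsub τ σ (s `* t) = cong₂ _`*_ (tsub-tsub τ σ s) (tsub-tsub τ σ t)

tsub-wkT : ∀ {m n} (σ : Fin m → Term n) t → tsub (lift σ) (wkT t) ≡ wkT (tsub σ t)
tsub-wkT σ t = trans (tsub-tren (lift σ) fs t) (sym (tren-tsub fs σ t))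

lift-comp : ∀ {l m n} (τ : Fin m → Term n) (σ : Fin l → Term m) i →
            tsub (lift τ) (lift σ i) ≡ lift (tsub τ ∘ σ) i
lift-comp τ σ fz = refl
lift-comp τ σ (fs i) = tsub-wkT τ (σ i)

fsub-fsub : ∀ {l m n} (τ : Fin m → Term n) (σ : Fin l → Term m) φ → fsub τ (fsub σ φ) ≡ fsub (tsub τ ∘ σ) φ
fsub-fsub τ σ ⊥' = refl
fsub-fsub τ σ (s ≐ t) = cong₂ _≐_ (tsub-tsub τ σ s) (tsub-tsub τ σ t)
fsub-fsub τ σ (φ ⇒ ψ) = cong₂ _⇒_ (fsub-fsub τ σ φ) (fsub-fsub τ σ ψ)
fsub-fsub τ σ (∀' φ) = cong ∀' (trans (fsub-fsub (lift τ) (lift σ) φ) (fsub-cong (lift-comp τ σ) φ))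

tsub-id : ∀ {n} {σ : Fin n → Term n} → (∀ i → σ i ≡ var i) → ∀ t → tsub σ t ≡ t
tsub-id h (var i) = h i
tsub-id h `0 = refl
tsub-id h (`S t) = cong `S (tsub-id h t)
tsub-id h (s `+ t) = cong₂ _`+_ (tsub-id h s) (tsub-id h t)
tsub-id h (s `* t) = cong₂ _`*_ (tsub-id h s) (tsub-id h t)

lift-id : ∀ {n} {σ : Fin n → Term n} → (∀ i → σ i ≡ var i) → ∀ i → lift σ i ≡ var i
lift-id h fz = refl
lift-id h (fs i) = cong wkT (h i)

fsub-id : ∀ {n} {σ : Fin n → Term n} → (∀ i → σ i ≡ var i) → ∀ φ → fsub σ φ ≡ φ
fsub-id h ⊥' = refl
fsub-id h (s ≐ t) = cong₂ _≐_ (tsub-id h s) (tsub-id h t)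
fsub-id h (φ ⇒ ψ) = cong₂ _⇒_ (fsub-id h φ) (fsub-id h ψ)
fsub-id h (∀' φ) = cong ∀' (fsub-id (lift-id h) φ)

instS : ∀ {n} → Term n → Fin (suc n) → Term n
instS t fz = t
instS t (fs i) = var i

[]-instS : ∀ {n} (φ : Formula (suc n)) t → φ [ t ] ≡ fsub (instS t) φ
[]-instS φ t = fsub-cong (λ { fz → refl ; (fs i) → refl }) φ

wkT-tsub : ∀ {n} (t : Term n) → wkT t ≡ tsub (var ∘ fs) t
wkT-tsub (var i) = refl
wkT-tsub `0 = refl
wkT-tsub (`S t) = cong `S (wkT-tsub t)
wkT-tsub (s `+ t) = cong₂ _`+_ (wkT-tsub s) (wkT-tsub t)
wkT-tsub (s `* t) = cong₂ _`*_ (wkT-tsub s) (wkT-tsub t)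

tsub-instS-wkT : ∀ {n} (t u : Term n) → tsub (instS t) (wkT u) ≡ u
tsub-instS-wkT t u = trans (tsub-tren (instS t) fs u) (tsub-id (λ _ → refl) u)

fsub-lift-[] : ∀ {m n} (σ : Fin m → Term n) φ t → fsub (lift σ) φ [ tsub σ t ] ≡ fsub σ (φ [ t ])
fsub-lift-[] σ φ t =
  trans ([]-instS (fsub (lift σ) φ) _) (trans (fsub-fsub _ _ φ)
  (trans (fsub-cong h φ) (sym (trans (cong (fsub σ) ([]-instS φ t)) (fsub-fsub σ (instS t) φ)))))
  where
  h : ∀ i → tsub (instS (tsub σ t)) (lift σ i) ≡ tsub σ (instS t i)
  h fz = refl
  h (fs i) = tsub-instS-wkT _ (σ i)

fsub-lift-wk : ∀ {m n} (σ : Fin m → Term n) φ → fsub (lift σ) (wk φ) ≡ wk (fsub σ φ)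
fsub-lift-wk σ φ =
  trans (fsub-fsub (lift σ) _ φ) (trans (fsub-cong (λ i → wkT-tsub (σ i)) φ) (sym (fsub-fsub _ σ φ)))

⊢-sub : ∀ {S : Theory} {m n} {φ : Formula m} → S ⊢ φ → (σ : Fin m → Term n) → S ⊢ fsub σ φ
⊢-sub {S} (ax {ψ = ψ} p) σ =
  subst (S ⊢_) (sym (trans (fsub-fsub σ _ ψ) (fsub-cong (λ ()) ψ))) (ax p)
⊢-sub axK σ = axK
⊢-sub axS σ = axS
⊢-sub axDN σ = axDN
⊢-sub (mp d e) σ = mp (⊢-sub d σ) (⊢-sub e σ)
⊢-sub {S} (axInst {φ = φ} {t = t}) σ =
  subst (λ ψ → S ⊢ ∀' (fsub (lift σ) φ) ⇒ ψ) (fsub-lift-[] σ φ t) axInst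
⊢-sub {S} (axDist {ψ = ψ} {φ = φ}) σ =
  subst (λ χ → S ⊢ ∀' (χ ⇒ fsub (lift σ) φ) ⇒ fsub σ ψ ⇒ ∀' (fsub (lift σ) φ)) (sym (fsub-lift-wk σ ψ)) axDist
⊢-sub (gen d) σ = gen (⊢-sub d (lift σ))
⊢-sub axRefl σ = axRefl
⊢-sub {S} (axLeib {s = s} {t = t} {φ = φ}) σ =
  subst₂ (λ ψ χ → S ⊢ tsub σ s ≐ tsub σ t ⇒ ψ ⇒ χ) (fsub-lift-[] σ φ s) (fsub-lift-[] σ φ t) axLeib

⊢-mono : ∀ {S S' : Theory} → (∀ {φ} → S φ → S' ⊢ φ) → ∀ {n} {φ : Formula n} → S ⊢ φ → S' ⊢ φ
⊢-mono h (ax p) = ⊢-sub (h p) _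
⊢-mono h axK = axK
⊢-mono h axS = axS
⊢-mono h axDN = axDN
⊢-mono h (mp d e) = mp (⊢-mono h d) (⊢-mono h e)
⊢-mono h axInst = axInst
⊢-mono h axDist = axDist
⊢-mono h (gen d) = gen (⊢-mono h d)
⊢-mono h axRefl = axRefl
⊢-mono h axLeib = axLeib

-- Deduction under hypotheses

infixr 2 _⟹_
-- The head of the list becomes the innermost antecedent, so discharging the latest hypothesis does
-- not change the formula: `lam` is the identity on derivations.
_⟹_ : ∀ {n} → List (Formula n) → Formula n → Formula n
[] ⟹ φ = φ
(γ ∷ Γ) ⟹ φ = Γ ⟹ (γ ⇒ φ)

module _ {S : Theory} where

  ⟹-thm : ∀ {n} (Γ : List (Formula n)) {φ} → S ⊢ φ → S ⊢ Γ ⟹ φ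
  ⟹-thm [] d = d
  ⟹-thm (γ ∷ Γ) d = ⟹-thm Γ (mp axK d)

  ⟹-mp : ∀ {n} (Γ : List (Formula n)) {φ ψ} → S ⊢ Γ ⟹ φ ⇒ ψ → S ⊢ Γ ⟹ φ → S ⊢ Γ ⟹ ψ
  ⟹-mp [] d e = mp d e
  ⟹-mp (γ ∷ Γ) d e = ⟹-mp Γ (⟹-mp Γ (⟹-thm Γ axS) d) e

  ⟹-hyp : ∀ {n} {Γ : List (Formula n)} {φ} → φ ∈ Γ → S ⊢ Γ ⟹ φ
  ⟹-hyp {Γ = _ ∷ Γ} {φ} (here refl) = ⟹-thm Γ (mp (mp axS axK) (axK {ψ = φ}))
  ⟹-hyp {Γ = _ ∷ Γ} (there p) = ⟹-mp Γ (⟹-thm Γ axK) (⟹-hyp p)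

  ⟹-gen : ∀ {n} (Γ : List (Formula n)) {φ} → S ⊢ mapL wk Γ ⟹ φ → S ⊢ Γ ⟹ ∀' φ
  ⟹-gen [] d = gen d
  ⟹-gen (γ ∷ Γ) d = ⟹-mp Γ (⟹-thm Γ axDist) (⟹-gen Γ d)

closeAll-inst : ∀ {S : Theory} {m n} (φ : Formula m) (σ : Fin m → Term n) → S ⊢ close↑ {n} (closeAll φ) → S ⊢ fsub σ φ
closeAll-inst {S} {zero} φ σ d = subst (S ⊢_) (fsub-cong (λ ()) φ) d
closeAll-inst {S} {suc m} φ σ d =
  subst (S ⊢_) eq (mp axInst (closeAll-inst (∀' φ) (σ ∘ fs) d))
  where
  h : ∀ i → tsub (instS (σ fz)) (lift (σ ∘ fs) i) ≡ σ i
  h fz = refl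
  h (fs i) = tsub-instS-wkT _ (σ (fs i))
  eq : fsub (lift (σ ∘ fs)) φ [ σ fz ] ≡ fsub σ φ
  eq = trans ([]-instS (fsub (lift (σ ∘ fs)) φ) _) (trans (fsub-fsub _ _ φ) (fsub-cong h φ))

-- Bounded formulas

-- `call` keeps a substitution as a node. Formulas built from named parts stay small, and truth
-- passes through a `call` by evaluating its argument terms.
data Fm : ℕ → Set where
  bot : ∀ {m} → Fm m
  eq le : ∀ {m} → Term m → Term m → Fm m
  imp and or : ∀ {m} → Fm m → Fm m → Fm m
  allB exB : ∀ {m} → Term m → Fm (suc m) → Fm m
  call : ∀ {k m} → Fm k → Vec (Term m) k → Fm m

infixr 3 _⊃_
_⊃_ : ∀ {m} → Fm m → Fm m → Fm m
_⊃_ = imp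

neg : ∀ {m} → Fm m → Fm m
neg φ = imp φ bot

-- Bounded existence is written with `∀'` because, apart from `_≤'_`, `Δ₀` has bounded universal
-- quantifiers only; `∃'` of a conjunction would not match it.
⌊_⌋ : ∀ {m} → Fm m → Formula m
⌊ bot ⌋ = ⊥'
⌊ eq s t ⌋ = s ≐ t
⌊ le s t ⌋ = s ≤' t
⌊ imp φ ψ ⌋ = ⌊ φ ⌋ ⇒ ⌊ ψ ⌋
⌊ and φ ψ ⌋ = ⌊ φ ⌋ ∧' ⌊ ψ ⌋
⌊ or φ ψ ⌋ = ⌊ φ ⌋ ∨' ⌊ ψ ⌋
⌊ allB t φ ⌋ = ∀' (var fz ≤' wkT t ⇒ ⌊ φ ⌋)
⌊ exB t φ ⌋ = ¬' (∀' (var fz ≤' wkT t ⇒ ¬' ⌊ φ ⌋))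
⌊ call φ τ ⌋ = fsub (lookup τ) ⌊ φ ⌋

fsub-≤' : ∀ {m n} (σ : Fin m → Term n) s t → fsub σ (s ≤' t) ≡ (tsub σ s ≤' tsub σ t)
fsub-≤' σ s t = cong₂ (λ a b → ∃' (a `+ var fz ≐ b)) (tsub-wkT σ s) (tsub-wkT σ t)

Δ₀-sub : ∀ {m n} {φ : Formula m} (σ : Fin m → Term n) → Δ₀ φ → Δ₀ (fsub σ φ)
Δ₀-sub σ d-⊥ = d-⊥
Δ₀-sub σ (d-≐ s t) = d-≐ _ _
Δ₀-sub σ (d-≤ s t) = subst Δ₀ (sym (fsub-≤' σ s t)) (d-≤ _ _)
Δ₀-sub σ (d-⇒ d e) = d-⇒ (Δ₀-sub σ d) (Δ₀-sub σ e)
Δ₀-sub σ (d-∀≤ t {φ} d) =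
  subst (λ ψ → Δ₀ (∀' (ψ ⇒ fsub (lift σ) φ)))
    (sym (trans (fsub-≤' (lift σ) (var fz) (wkT t)) (cong (var fz ≤'_) (tsub-wkT σ t))))
    (d-∀≤ (tsub σ t) (Δ₀-sub (lift σ) d))

Δ₀-⌊⌋ : ∀ {m} (φ : Fm m) → Δ₀ ⌊ φ ⌋
Δ₀-⌊⌋ bot = d-⊥
Δ₀-⌊⌋ (eq s t) = d-≐ s t
Δ₀-⌊⌋ (le s t) = d-≤ s t
Δ₀-⌊⌋ (imp φ ψ) = d-⇒ (Δ₀-⌊⌋ φ) (Δ₀-⌊⌋ ψ)
Δ₀-⌊⌋ (and φ ψ) = d-⇒ (d-⇒ (Δ₀-⌊⌋ φ) (d-⇒ (Δ₀-⌊⌋ ψ) d-⊥)) d-⊥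
Δ₀-⌊⌋ (or φ ψ) = d-⇒ (d-⇒ (Δ₀-⌊⌋ φ) d-⊥) (Δ₀-⌊⌋ ψ)
Δ₀-⌊⌋ (allB t φ) = d-∀≤ t (Δ₀-⌊⌋ φ)
Δ₀-⌊⌋ (exB t φ) = d-⇒ (d-∀≤ t (d-⇒ (Δ₀-⌊⌋ φ) d-⊥)) d-⊥
Δ₀-⌊⌋ (call φ τ) = Δ₀-sub (lookup τ) (Δ₀-⌊⌋ φ)

-- Formulas paired with an environment: substitutions are only ever composed as vectors of terms.

infix 8 _⟨_⟩
data CF (n : ℕ) : Set where
  _⟨_⟩ : ∀ {m} → Fm m → Vec (Term n) m → CF n
  raw : Formula n → CF n
  exC : ∀ {m} → Fm (suc m) → Vec (Term n) m → CF n

⌊_⌋ᶜ : ∀ {n} → CF n → Formula n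
⌊ φ ⟨ σ ⟩ ⌋ᶜ = fsub (lookup σ) ⌊ φ ⌋
⌊ raw φ ⌋ᶜ = φ
⌊ exC φ σ ⌋ᶜ = fsub (lookup σ) (∃' ⌊ φ ⌋)

wkC : ∀ {n} → CF n → CF (suc n)
wkC (φ ⟨ σ ⟩) = φ ⟨ map wkT σ ⟩
wkC (raw φ) = raw (wk φ)
wkC (exC φ σ) = exC φ (map wkT σ)

wk-lookup : ∀ {m n} (φ : Formula m) (σ : Vec (Term n) m) → wk (fsub (lookup σ) φ) ≡ fsub (lookup (map wkT σ)) φ
wk-lookup φ σ = trans (fsub-fsub _ _ φ)
  (fsub-cong (λ i → trans (sym (wkT-tsub (lookup σ i))) (sym (lookup-map i wkT σ))) φ)

⌊wkC⌋ : ∀ {n} (c : CF n) → wk ⌊ c ⌋ᶜ ≡ ⌊ wkC c ⌋ᶜ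
⌊wkC⌋ (φ ⟨ σ ⟩) = wk-lookup ⌊ φ ⌋ σ
⌊wkC⌋ (raw φ) = refl
⌊wkC⌋ (exC φ σ) = wk-lookup (∃' ⌊ φ ⌋) σ

Cxt : ℕ → Set
Cxt n = List (CF n)

wkΓ : ∀ {n} → Cxt n → Cxt (suc n)
wkΓ = mapL wkC

infix 1 _⊩'_ _⊩_
-- A record, so that Γ and φ can be read off the type: `_⟹_` is not injective. Neither is `⌊_⌋ᶜ`,
-- hence the second relation, indexed by the formula together with its environment.
record _⊩'_ {n} (Γ : Cxt n) (φ : Formula n) : Set where
  constructor drv
  field get : PA ⊢ mapL ⌊_⌋ᶜ Γ ⟹ φ
open _⊩'_ public

record _⊩_ {n} (Γ : Cxt n) (c : CF n) : Set where
  constructor der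
  field und : Γ ⊩' ⌊ c ⌋ᶜ
open _⊩_ public

module _ {n : ℕ} {Γ : Cxt n} where

  thm : ∀ {φ} → PA ⊢ φ → Γ ⊩' φ
  thm d = drv (⟹-thm (mapL ⌊_⌋ᶜ Γ) d)

  app : ∀ {φ ψ} → Γ ⊩' φ ⇒ ψ → Γ ⊩' φ → Γ ⊩' ψ
  app (drv d) (drv e) = drv (⟹-mp (mapL ⌊_⌋ᶜ Γ) d e)

  lam : ∀ {c φ} → c ∷ Γ ⊩' φ → Γ ⊩' ⌊ c ⌋ᶜ ⇒ φ
  lam (drv d) = drv d

  lamr : ∀ {ψ φ} → raw ψ ∷ Γ ⊩' φ → Γ ⊩' ψ ⇒ φ
  lamr (drv d) = drv d

  weaken : ∀ {c φ} → Γ ⊩' φ → c ∷ Γ ⊩' φ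
  weaken {c} {φ} d with app (thm axK) d
  ... | drv e = drv e

  conv : ∀ {φ ψ} → φ ≡ ψ → Γ ⊩' φ → Γ ⊩' ψ
  conv refl d = d

  hyp' : ∀ {c} → c ∈ Γ → Γ ⊩' ⌊ c ⌋ᶜ
  hyp' p = drv (⟹-hyp (∈-map⁺ ⌊_⌋ᶜ p))

  hypr : ∀ {φ} → raw φ ∈ Γ → Γ ⊩' φ
  hypr = hyp'

pattern here₀ = here refl
pattern here₁ = there here₀
pattern here₂ = there here₁
pattern here₃ = there here₂
pattern here₄ = there here₃
pattern here₅ = there here₄
pattern here₆ = there here₅
pattern here₇ = there here₆
pattern here₈ = there here₇
pattern here₉ = there here₈

module _ {n : ℕ} {Γ : Cxt n} where

  efq' : ∀ {φ} → Γ ⊩' ⊥' → Γ ⊩' φ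
  efq' d = app (thm axDN) (app (thm axK) d)

  dne' : ∀ {φ} → raw (¬' φ) ∷ Γ ⊩' ⊥' → Γ ⊩' φ
  dne' d = app (thm axDN) (lamr d)

  ∧I' : ∀ {φ ψ} → Γ ⊩' φ → Γ ⊩' ψ → Γ ⊩' φ ∧' ψ
  ∧I' d e = lamr (app (app (hypr here₀) (weaken d)) (weaken e))

  ∨E' : ∀ {φ ψ χ} → Γ ⊩' φ ∨' ψ → Γ ⊩' φ ⇒ χ → Γ ⊩' ψ ⇒ χ → Γ ⊩' χ
  ∨E' d e f = dne' (app (hypr here₀) (app (weaken f) (app (weaken d)
    (lamr (app (hypr here₁) (app (weaken (weaken e)) (hypr here₀)))))))

module _ {n : ℕ} {Γ : Cxt n} where

  ∧E₁' : ∀ {φ ψ} → Γ ⊩' φ ∧' ψ → Γ ⊩' φ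
  ∧E₁' d = dne' (app (weaken d) (lamr (efq' (app (hypr here₁) (hypr here₀)))))

  ∧E₂' : ∀ {φ ψ} → Γ ⊩' φ ∧' ψ → Γ ⊩' ψ
  ∧E₂' d = dne' (app (weaken d) (app (thm axK) (hypr here₀)))

wkΓ-eq : ∀ {n} (Γ : Cxt n) → mapL wk (mapL ⌊_⌋ᶜ Γ) ≡ mapL ⌊_⌋ᶜ (wkΓ Γ)
wkΓ-eq Γ = trans (sym (map-∘ Γ)) (trans (map-cong ⌊wkC⌋ Γ) (map-∘ Γ))

lift-lookup : ∀ {m n} (σ : Vec (Term n) m) φ → fsub (lift (lookup σ)) φ ≡ fsub (lookup (var fz ∷ map wkT σ)) φ
lift-lookup σ = fsub-cong λ { fz → refl ; (fs i) → sym (lookup-map i wkT σ) }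

inst-lookup : ∀ {m n} (σ : Vec (Term n) m) φ t → fsub (lift (lookup σ)) φ [ t ] ≡ fsub (lookup (t ∷ σ)) φ
inst-lookup σ φ t = trans ([]-instS (fsub (lift (lookup σ)) φ) t) (trans (fsub-fsub _ _ φ)
  (fsub-cong (λ { fz → refl ; (fs i) → tsub-instS-wkT t (lookup σ i) }) φ))

module _ {n : ℕ} {Γ : Cxt n} {m : ℕ} {σ : Vec (Term n) m} where

  ∀I' : ∀ {φ} → wkΓ Γ ⊩' fsub (lookup (var fz ∷ map wkT σ)) φ → Γ ⊩' fsub (lookup σ) (∀' φ)
  ∀I' {φ} (drv d) = drv (⟹-gen (mapL ⌊_⌋ᶜ Γ)
    (subst₂ (λ Δ ψ → PA ⊢ Δ ⟹ ψ) (sym (wkΓ-eq Γ)) (sym (lift-lookup σ φ)) d))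

  ∀E' : ∀ φ → Γ ⊩' fsub (lookup σ) (∀' φ) → (t : Term n) → Γ ⊩' fsub (lookup (t ∷ σ)) φ
  ∀E' φ d t = conv (inst-lookup σ φ t) (app (thm axInst) d)

  leib' : ∀ {a b} φ → Γ ⊩' a ≐ b → Γ ⊩' fsub (lookup (a ∷ σ)) φ → Γ ⊩' fsub (lookup (b ∷ σ)) φ
  leib' {a} {b} φ d e =
    conv (inst-lookup σ φ b) (app (app (thm axLeib) d) (conv (sym (inst-lookup σ φ a)) e))

module _ {n : ℕ} {Γ : Cxt n} {m : ℕ} {σ : Vec (Term n) m} where

  ∃I' : ∀ φ (t : Term n) → Γ ⊩' fsub (lookup (t ∷ σ)) φ → Γ ⊩' fsub (lookup σ) (∃' φ)
  ∃I' φ t d = lamr (app (∀E' (¬' φ) (hypr here₀) t) (weaken d))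

  ∃E' : ∀ φ (c : CF n) → Γ ⊩' fsub (lookup σ) (∃' φ) →
        wkΓ Γ ⊩' fsub (lookup (var fz ∷ map wkT σ)) φ ⇒ ⌊ wkC c ⌋ᶜ → Γ ⊩' ⌊ c ⌋ᶜ
  ∃E' φ c d e = dne' (app (weaken d) (∀I' {φ = ¬' φ} (lamr
    (app (conv (cong ¬' (⌊wkC⌋ c)) (hypr here₁)) (app (weaken (weaken e)) (hypr here₀))))))

-- Natural deduction for environment-paired formulas

infixl 30 _⟦_⟧ₜ
_⟦_⟧ₜ : ∀ {m n} → Term m → Vec (Term n) m → Term n
t ⟦ σ ⟧ₜ = tsub (lookup σ) t

v0 : ∀ {n} → Term (suc n)
v0 = var fz
v1 : ∀ {n} → Term (2 + n)
v1 = var 1F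
v2 : ∀ {n} → Term (3 + n)
v2 = var 2F
v3 : ∀ {n} → Term (4 + n)
v3 = var 3F
v4 : ∀ {n} → Term (5 + n)
v4 = var 4F
v5 : ∀ {n} → Term (6 + n)
v5 = var 5F
v6 : ∀ {n} → Term (7 + n)
v6 = var 6F

Eq Le : ∀ {n} → Term n → Term n → CF n
Eq a b = eq v0 v1 ⟨ a ∷ b ∷ [] ⟩
Le a b = le v0 v1 ⟨ a ∷ b ∷ [] ⟩

Bot : ∀ {n} → CF n
Bot = bot ⟨ [] ⟩

le-Le : ∀ {m n} (σ : Vec (Term n) m) s t → ⌊ le s t ⟨ σ ⟩ ⌋ᶜ ≡ ⌊ Le (s ⟦ σ ⟧ₜ) (t ⟦ σ ⟧ₜ) ⌋ᶜ
le-Le σ s t = trans (fsub-≤' (lookup σ) s t) (sym (fsub-≤' (lookup (s ⟦ σ ⟧ₜ ∷ t ⟦ σ ⟧ₜ ∷ [])) v0 v1))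

call-eq : ∀ {m n} (σ : Vec (Term n) m) {k} (φ : Fm k) τ → ⌊ call φ τ ⟨ σ ⟩ ⌋ᶜ ≡ ⌊ φ ⟨ map (_⟦ σ ⟧ₜ) τ ⟩ ⌋ᶜ
call-eq σ φ τ = trans (fsub-fsub _ _ ⌊ φ ⌋) (fsub-cong (λ i → sym (lookup-map i (_⟦ σ ⟧ₜ) τ)) ⌊ φ ⌋)

bound-eq : ∀ {m n} (σ : Vec (Term n) m) u t → fsub (lookup (u ∷ σ)) (var fz ≤' wkT t) ≡ ⌊ Le u (t ⟦ σ ⟧ₜ) ⌋ᶜ
bound-eq σ u t = trans (fsub-≤' (lookup (u ∷ σ)) (var fz) (wkT t))
  (trans (cong (u ≤'_) (tsub-tren (lookup (u ∷ σ)) fs t)) (sym (fsub-≤' (lookup (u ∷ t ⟦ σ ⟧ₜ ∷ [])) v0 v1)))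

tsub-map-wkT : ∀ {m n} (σ : Vec (Term n) m) t → t ⟦ map wkT σ ⟧ₜ ≡ wkT (t ⟦ σ ⟧ₜ)
tsub-map-wkT σ t = trans (tsub-cong (λ i → lookup-map i wkT σ) t) (sym (tren-tsub fs (lookup σ) t))

bound-wk-eq : ∀ {m n} (σ : Vec (Term n) m) t →
              fsub (lookup (v0 ∷ map wkT σ)) (var fz ≤' wkT t) ≡ ⌊ Le v0 (wkT (t ⟦ σ ⟧ₜ)) ⌋ᶜ
bound-wk-eq σ t = trans (bound-eq (map wkT σ) v0 t) (cong (λ u → ⌊ Le v0 u ⌋ᶜ) (tsub-map-wkT σ t))

module _ {n : ℕ} {Γ : Cxt n} where

  h0 : ∀ {c} → c ∷ Γ ⊩ c
  h0 = der (hyp' here₀)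
  h1 : ∀ {a c} → a ∷ c ∷ Γ ⊩ c
  h1 = der (hyp' here₁)
  h2 : ∀ {a b c} → a ∷ b ∷ c ∷ Γ ⊩ c
  h2 = der (hyp' here₂)
  h3 : ∀ {a b d c} → a ∷ b ∷ d ∷ c ∷ Γ ⊩ c
  h3 = der (hyp' here₃)
  h4 : ∀ {a b d e c} → a ∷ b ∷ d ∷ e ∷ c ∷ Γ ⊩ c
  h4 = der (hyp' here₄)

  h5 : ∀ {a b d e f c} → a ∷ b ∷ d ∷ e ∷ f ∷ c ∷ Γ ⊩ c
  h5 = der (hyp' here₅)
  h6 : ∀ {a b d e f g c} → a ∷ b ∷ d ∷ e ∷ f ∷ g ∷ c ∷ Γ ⊩ c
  h6 = der (hyp' here₆)
  h7 : ∀ {a b d e f g h c} → a ∷ b ∷ d ∷ e ∷ f ∷ g ∷ h ∷ c ∷ Γ ⊩ c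
  h7 = der (hyp' here₇)
  h8 : ∀ {a b d e f g h i c} → a ∷ b ∷ d ∷ e ∷ f ∷ g ∷ h ∷ i ∷ c ∷ Γ ⊩ c
  h8 = der (hyp' here₈)
  h9 : ∀ {a b d e f g h i j c} → a ∷ b ∷ d ∷ e ∷ f ∷ g ∷ h ∷ i ∷ j ∷ c ∷ Γ ⊩ c
  h9 = der (hyp' here₉)

  up : ∀ {c d} → Γ ⊩ c → d ∷ Γ ⊩ c
  up (der d) = der (weaken d)

  cut : ∀ {c d} → Γ ⊩ c → c ∷ Γ ⊩ d → Γ ⊩ d
  cut (der d) (der e) = der (app (lam e) d)

  same : ∀ {c d} → ⌊ c ⌋ᶜ ≡ ⌊ d ⌋ᶜ → Γ ⊩ c → Γ ⊩ d
  same p (der d) = der (conv p d)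

  infixl 5 _·_
  _·_ : ∀ {c d} → Γ ⊩' ⌊ c ⌋ᶜ ⇒ ⌊ d ⌋ᶜ → Γ ⊩ c → Γ ⊩ d
  f · der d = der (app f d)

  efq : ∀ {m} {σ : Vec (Term n) m} {c} → Γ ⊩ bot ⟨ σ ⟩ → Γ ⊩ c
  efq (der d) = der (efq' d)

  refl⊩ : ∀ {t} → Γ ⊩ Eq t t
  refl⊩ = der (thm axRefl)

  LeI : ∀ {a b} u → Γ ⊩ Eq (a `+ u) b → Γ ⊩ Le a b
  LeI {a} {b} u (der d) = der (∃I' {σ = a ∷ b ∷ []} (v1 `+ v0 ≐ v2) u d)

  LeE : ∀ {a b c} → Γ ⊩ Le a b → Eq (wkT a `+ v0) (wkT b) ∷ wkΓ Γ ⊩ wkC c → Γ ⊩ c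
  LeE {a} {b} {c} (der d) (der e) = der (∃E' {σ = a ∷ b ∷ []} (v1 `+ v0 ≐ v2) c d (lam e))

module _ {n : ℕ} {Γ : Cxt n} {m : ℕ} {σ : Vec (Term n) m} where

  ⊃I : ∀ {φ ψ} → φ ⟨ σ ⟩ ∷ Γ ⊩ ψ ⟨ σ ⟩ → Γ ⊩ imp φ ψ ⟨ σ ⟩
  ⊃I (der d) = der (lam d)
  ⊃E : ∀ {φ ψ} → Γ ⊩ imp φ ψ ⟨ σ ⟩ → Γ ⊩ φ ⟨ σ ⟩ → Γ ⊩ ψ ⟨ σ ⟩
  ⊃E (der d) (der e) = der (app d e)

  negI : ∀ {φ} → φ ⟨ σ ⟩ ∷ Γ ⊩ Bot → Γ ⊩ neg φ ⟨ σ ⟩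
  negI (der d) = der (lam d)
  negE : ∀ {φ} → Γ ⊩ neg φ ⟨ σ ⟩ → Γ ⊩ φ ⟨ σ ⟩ → Γ ⊩ Bot
  negE (der d) (der e) = der (app d e)

  ∧I : ∀ {φ ψ} → Γ ⊩ φ ⟨ σ ⟩ → Γ ⊩ ψ ⟨ σ ⟩ → Γ ⊩ and φ ψ ⟨ σ ⟩
  ∧I (der d) (der e) = der (∧I' d e)
  ∧E₁ : ∀ {φ ψ} → Γ ⊩ and φ ψ ⟨ σ ⟩ → Γ ⊩ φ ⟨ σ ⟩
  ∧E₁ (der d) = der (∧E₁' d)
  ∧E₂ : ∀ {φ ψ} → Γ ⊩ and φ ψ ⟨ σ ⟩ → Γ ⊩ ψ ⟨ σ ⟩
  ∧E₂ (der d) = der (∧E₂' d)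

  ∨I₁ : ∀ {φ ψ} → Γ ⊩ φ ⟨ σ ⟩ → Γ ⊩ or φ ψ ⟨ σ ⟩
  ∨I₁ {φ} {ψ} (der d) = der (lam {c = neg φ ⟨ σ ⟩} (efq' (app (hyp' here₀) (weaken d))))
  ∨I₂ : ∀ {φ ψ} → Γ ⊩ ψ ⟨ σ ⟩ → Γ ⊩ or φ ψ ⟨ σ ⟩
  ∨I₂ (der d) = der (app (thm axK) d)
  ∨E : ∀ {φ ψ c} → Γ ⊩ or φ ψ ⟨ σ ⟩ → φ ⟨ σ ⟩ ∷ Γ ⊩ c → ψ ⟨ σ ⟩ ∷ Γ ⊩ c → Γ ⊩ c
  ∨E (der d) (der e) (der f) = der (∨E' d (lam e) (lam f))

  cases : ∀ φ {c} → φ ⟨ σ ⟩ ∷ Γ ⊩ c → neg φ ⟨ σ ⟩ ∷ Γ ⊩ c → Γ ⊩ c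
  cases φ (der d) (der e) = der (∨E' (lam {c = neg φ ⟨ σ ⟩} (hyp' here₀)) (lam d) (lam e))

  eqI : ∀ {s t} → Γ ⊩ Eq (s ⟦ σ ⟧ₜ) (t ⟦ σ ⟧ₜ) → Γ ⊩ eq s t ⟨ σ ⟩
  eqI (der d) = der d
  eqE : ∀ {s t} → Γ ⊩ eq s t ⟨ σ ⟩ → Γ ⊩ Eq (s ⟦ σ ⟧ₜ) (t ⟦ σ ⟧ₜ)
  eqE (der d) = der d

  leI : ∀ {s t} → Γ ⊩ Le (s ⟦ σ ⟧ₜ) (t ⟦ σ ⟧ₜ) → Γ ⊩ le s t ⟨ σ ⟩
  leI {s} {t} = same (sym (le-Le σ s t))
  leE : ∀ {s t} → Γ ⊩ le s t ⟨ σ ⟩ → Γ ⊩ Le (s ⟦ σ ⟧ₜ) (t ⟦ σ ⟧ₜ)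
  leE {s} {t} = same (le-Le σ s t)

  callI : ∀ {k} {φ : Fm k} {τ} → Γ ⊩ φ ⟨ map (_⟦ σ ⟧ₜ) τ ⟩ → Γ ⊩ call φ τ ⟨ σ ⟩
  callI {φ = φ} {τ} = same (sym (call-eq σ φ τ))
  callE : ∀ {k} {φ : Fm k} {τ} → Γ ⊩ call φ τ ⟨ σ ⟩ → Γ ⊩ φ ⟨ map (_⟦ σ ⟧ₜ) τ ⟩
  callE {φ = φ} {τ} = same (call-eq σ φ τ)

  allBI : ∀ {t φ} → Le v0 (wkT (t ⟦ σ ⟧ₜ)) ∷ wkΓ Γ ⊩ φ ⟨ v0 ∷ map wkT σ ⟩ → Γ ⊩ allB t φ ⟨ σ ⟩
  allBI {t} {φ} (der d) = der (∀I' {φ = var fz ≤' wkT t ⇒ ⌊ φ ⌋}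
    (conv (cong (_⇒ fsub (lookup (v0 ∷ map wkT σ)) ⌊ φ ⌋) (sym (bound-wk-eq σ t))) (lam d)))

  allBE : ∀ {t φ} → Γ ⊩ allB t φ ⟨ σ ⟩ → ∀ {u} → Γ ⊩ Le u (t ⟦ σ ⟧ₜ) → Γ ⊩ φ ⟨ u ∷ σ ⟩
  allBE {t} {φ} (der d) {u} (der e) =
    der (app (∀E' (var fz ≤' wkT t ⇒ ⌊ φ ⌋) d u) (conv (sym (bound-eq σ u t)) e))

  exBI : ∀ {t φ} u → Γ ⊩ Le u (t ⟦ σ ⟧ₜ) → Γ ⊩ φ ⟨ u ∷ σ ⟩ → Γ ⊩ exB t φ ⟨ σ ⟩
  exBI {t} {φ} u (der e) (der d) =
    der (lamr (app (app (∀E' (var fz ≤' wkT t ⇒ ¬' ⌊ φ ⌋) (hypr here₀) u)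
      (weaken (conv (sym (bound-eq σ u t)) e))) (weaken d)))

  exBE : ∀ {t φ c} → Γ ⊩ exB t φ ⟨ σ ⟩ →
         φ ⟨ v0 ∷ map wkT σ ⟩ ∷ Le v0 (wkT (t ⟦ σ ⟧ₜ)) ∷ wkΓ Γ ⊩ wkC c → Γ ⊩ c
  exBE {t} {φ} {c} (der d) (der e) = der (dne' (app (weaken d)
    (∀I' {φ = var fz ≤' wkT t ⇒ ¬' ⌊ φ ⌋} (lamr (lamr
      (app (conv (cong ¬' (⌊wkC⌋ c)) (hypr here₂))
        (app (app (weaken (weaken (weaken (lam (lam e))))) (conv (bound-wk-eq σ t) (hypr here₁))) (hypr here₀))))))))

  exI : ∀ {φ} u → Γ ⊩ φ ⟨ u ∷ σ ⟩ → Γ ⊩ exC φ σ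
  exI {φ} u (der d) = der (∃I' ⌊ φ ⌋ u d)

  exE : ∀ {φ c} → Γ ⊩ exC φ σ → φ ⟨ v0 ∷ map wkT σ ⟩ ∷ wkΓ Γ ⊩ wkC c → Γ ⊩ c
  exE {φ} {c} (der d) (der e) = der (∃E' ⌊ φ ⌋ c d (lam e))

  Leib : ∀ φ {a b} → Γ ⊩ Eq a b → Γ ⊩ φ ⟨ a ∷ σ ⟩ → Γ ⊩ φ ⟨ b ∷ σ ⟩
  Leib φ (der d) (der e) = der (leib' ⌊ φ ⌋ d e)

wk-⟹ : ∀ {n} (Γ : List (Formula n)) φ → wk (Γ ⟹ φ) ≡ (mapL wk Γ ⟹ wk φ)
wk-⟹ [] φ = refl
wk-⟹ (γ ∷ Γ) φ = wk-⟹ Γ (γ ⇒ φ)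

upW : ∀ {n} {Γ : Cxt n} {c} → Γ ⊩ c → wkΓ Γ ⊩ wkC c
upW {Γ = Γ} {c} (der (drv d)) = der (drv (subst (PA ⊢_)
  (trans (wk-⟹ (mapL ⌊_⌋ᶜ Γ) ⌊ c ⌋ᶜ) (cong₂ _⟹_ (wkΓ-eq Γ) (⌊wkC⌋ c))) (⊢-sub d _)))

-- Peano arithmetic

module _ {n : ℕ} {Γ : Cxt n} where

  axiom : ∀ {m} {φ : Formula m} → PA (closeAll φ) → (σ : Fin m → Term n) → Γ ⊩' fsub σ φ
  axiom {φ = φ} p σ = thm (closeAll-inst φ σ (ax p))

  S≢0 : ∀ {a} → Γ ⊩ Eq (`S a) `0 → Γ ⊩ Bot
  S≢0 {a} (der d) = der (app (axiom {m = 1} pa1 (λ _ → a)) d)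

  S-inj : ∀ {a b} → Γ ⊩ Eq (`S a) (`S b) → Γ ⊩ Eq a b
  S-inj {a} {b} (der d) = der (app (axiom {m = 2} pa2 (λ { fz → b ; (fs _) → a })) d)

  +-0 : ∀ {a} → Γ ⊩ Eq (a `+ `0) a
  +-0 {a} = der (axiom {m = 1} pa3 (λ _ → a))

  +-S : ∀ {a b} → Γ ⊩ Eq (a `+ `S b) (`S (a `+ b))
  +-S {a} {b} = der (axiom {m = 2} pa4 (λ { fz → b ; (fs _) → a }))

  *-0 : ∀ {a} → Γ ⊩ Eq (a `* `0) `0
  *-0 {a} = der (axiom {m = 1} pa5 (λ _ → a))

  *-S : ∀ {a b} → Γ ⊩ Eq (a `* `S b) (a `* b `+ a)
  *-S {a} {b} = der (axiom {m = 2} pa6 (λ { fz → b ; (fs _) → a }))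

  ind : ∀ {m} {σ : Vec (Term n) m} (φ : Fm (suc m)) → Γ ⊩ φ ⟨ `0 ∷ σ ⟩ →
        φ ⟨ v0 ∷ map wkT σ ⟩ ∷ wkΓ Γ ⊩ φ ⟨ `S v0 ∷ map wkT σ ⟩ → ∀ {t} → Γ ⊩ φ ⟨ t ∷ σ ⟩
  ind {σ = σ} φ (der b) (der s) {t} = der (∀E' ⌊ φ ⌋ (app (axiom {φ = indInst ⌊ φ ⌋} (paInd ⌊ φ ⌋) (lookup σ))
      (∧I' (conv (sym base) b) (∀I' {φ = ⌊ φ ⌋ ⇒ stepS ⌊ φ ⌋}
         (conv (cong (fsub (lookup (v0 ∷ map wkT σ)) ⌊ φ ⌋ ⇒_) (sym step)) (lam s))))) t)
    where
    base : fsub (lookup σ) (⌊ φ ⌋ [ `0 ]) ≡ fsub (lookup (`0 ∷ σ)) ⌊ φ ⌋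
    base = trans (sym (fsub-lift-[] (lookup σ) ⌊ φ ⌋ `0)) (inst-lookup σ ⌊ φ ⌋ `0)
    step : fsub (lookup (v0 ∷ map wkT σ)) (stepS ⌊ φ ⌋) ≡ fsub (lookup (`S v0 ∷ map wkT σ)) ⌊ φ ⌋
    step = trans (fsub-fsub _ _ ⌊ φ ⌋) (fsub-cong (λ { fz → refl ; (fs i) → refl }) ⌊ φ ⌋)

  sym⊩ : ∀ {a b} → Γ ⊩ Eq a b → Γ ⊩ Eq b a
  sym⊩ {a} p = Leib {σ = a ∷ []} (eq v0 v1) p refl⊩

  trans⊩ : ∀ {a b c} → Γ ⊩ Eq a b → Γ ⊩ Eq b c → Γ ⊩ Eq a c
  trans⊩ {a} p q = eqE (Leib {σ = a ∷ []} (eq v1 v0) q (eqI p))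

  congS : ∀ {a b} → Γ ⊩ Eq a b → Γ ⊩ Eq (`S a) (`S b)
  congS {a} p = eqE (Leib {σ = a ∷ []} (eq (`S v1) (`S v0)) p (eqI refl⊩))

  cong+ : ∀ {a b c d} → Γ ⊩ Eq a b → Γ ⊩ Eq c d → Γ ⊩ Eq (a `+ c) (b `+ d)
  cong+ {a} {b} {c} p q = trans⊩
    (eqE (Leib {σ = a ∷ c ∷ []} (eq (v1 `+ v2) (v0 `+ v2)) p (eqI refl⊩)))
    (eqE (Leib {σ = b ∷ c ∷ []} (eq (v1 `+ v2) (v1 `+ v0)) q (eqI refl⊩)))

  cong* : ∀ {a b c d} → Γ ⊩ Eq a b → Γ ⊩ Eq c d → Γ ⊩ Eq (a `* c) (b `* d)
  cong* {a} {b} {c} p q = trans⊩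
    (eqE (Leib {σ = a ∷ c ∷ []} (eq (v1 `* v2) (v0 `* v2)) p (eqI refl⊩)))
    (eqE (Leib {σ = b ∷ c ∷ []} (eq (v1 `* v2) (v1 `* v0)) q (eqI refl⊩)))

module _ {n : ℕ} {Γ : Cxt n} where

  0-+ : ∀ {a} → Γ ⊩ Eq (`0 `+ a) a
  0-+ = eqE (ind {σ = []} (eq (`0 `+ v0) v0) (eqI +-0) (eqI (trans⊩ +-S (congS (eqE h0)))))

  S-+ : ∀ {a b} → Γ ⊩ Eq (`S a `+ b) (`S (a `+ b))
  S-+ {a} = eqE (ind {σ = a ∷ []} (eq (`S v1 `+ v0) (`S (v1 `+ v0)))
    (eqI (trans⊩ +-0 (congS (sym⊩ +-0))))
    (eqI (trans⊩ +-S (congS (trans⊩ (eqE h0) (sym⊩ +-S))))))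

module _ {n : ℕ} {Γ : Cxt n} where

  +-assoc⊩ : ∀ {a b c} → Γ ⊩ Eq (a `+ b `+ c) (a `+ (b `+ c))
  +-assoc⊩ {a} {b} = eqE (ind {σ = a ∷ b ∷ []} (eq (v1 `+ v2 `+ v0) (v1 `+ (v2 `+ v0)))
    (eqI (trans⊩ +-0 (cong+ refl⊩ (sym⊩ +-0))))
    (eqI (trans⊩ +-S (trans⊩ (congS (eqE h0)) (trans⊩ (sym⊩ +-S) (cong+ refl⊩ (sym⊩ +-S)))))))

  a+Sb≢a : ∀ {a b} → Γ ⊩ Eq (a `+ `S b) a → Γ ⊩ Bot
  a+Sb≢a {a} {b} p = negE (ind {σ = b ∷ []} (neg (eq (v0 `+ `S v1) v0))
    (negI (S≢0 (trans⊩ (sym⊩ 0-+) (eqE h0))))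
    (negI (negE h1 (eqI (S-inj (trans⊩ (sym⊩ S-+) (eqE h0)))))) {a}) (eqI p)

  zero-or-suc : ∀ {a c} → Eq a `0 ∷ Γ ⊩ c → Eq (wkT a) (`S v0) ∷ wkΓ Γ ⊩ wkC c → Γ ⊩ c
  -- The predecessor is bounded by the number itself, which keeps the induction formula bounded.
  zero-or-suc {a} {c} p q = ∨E (ind {σ = []} (or (eq v0 `0) (exB v0 (eq v1 (`S v0))))
      (∨I₁ (eqI refl⊩))
      (∨I₂ (exBI v0 (LeI (`S `0) (trans⊩ +-S (congS +-0))) (eqI refl⊩))) {a})
    (weaken (lam (und p)) · eqE h0) (exBE h0 (weaken (weaken (weaken (lam (und q)))) · eqE h0))

module _ {n : ℕ} {Γ : Cxt n} where

  leRefl : ∀ {a} → Γ ⊩ Le a a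
  leRefl = LeI `0 +-0

  le-eq : ∀ {a b} → Γ ⊩ Eq a b → Γ ⊩ Le a b
  le-eq p = LeI `0 (trans⊩ +-0 p)

  le-0 : ∀ {a} → Γ ⊩ Le `0 a
  le-0 {a} = LeI a 0-+

  leTrans : ∀ {a b c} → Γ ⊩ Le a b → Γ ⊩ Le b c → Γ ⊩ Le a c
  leTrans p q = cut q (LeE (up p) (LeE h1 (LeI (v1 `+ v0)
    (trans⊩ (sym⊩ +-assoc⊩) (trans⊩ (cong+ h1 refl⊩) h0)))))

  le-SS : ∀ {a b} → Γ ⊩ Le a b → Γ ⊩ Le (`S a) (`S b)
  le-SS p = LeE p (LeI v0 (trans⊩ S-+ (congS h0)))

  le-SS⁻ : ∀ {a b} → Γ ⊩ Le (`S a) (`S b) → Γ ⊩ Le a b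
  le-SS⁻ p = LeE p (LeI v0 (S-inj (trans⊩ (sym⊩ S-+) h0)))

  le-S : ∀ {a} → Γ ⊩ Le a (`S a)
  le-S = LeI (`S `0) (trans⊩ +-S (congS +-0))

  S≰0 : ∀ {a} → Γ ⊩ Le (`S a) `0 → Γ ⊩ Bot
  S≰0 p = LeE p (S≢0 (trans⊩ (sym⊩ S-+) h0))

  S≰ : ∀ {a} → Γ ⊩ Le (`S a) a → Γ ⊩ Bot
  S≰ p = LeE p (a+Sb≢a (trans⊩ (trans⊩ +-S (sym⊩ S-+)) h0))

  le-split : ∀ {a b c} → Γ ⊩ Le a b → Eq a b ∷ Γ ⊩ c → Le (`S a) b ∷ Γ ⊩ c → Γ ⊩ c
  le-split {a} {b} p q r = ∨E
    (LeE {c = or (eq v0 v1) (le (`S v0) v1) ⟨ a ∷ b ∷ [] ⟩} p (zero-or-suc {a = v0}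
      (∨I₁ (eqI (trans⊩ (trans⊩ (sym⊩ +-0) (cong+ refl⊩ (sym⊩ h0))) h1)))
      (∨I₂ (leI (LeI v0 (trans⊩ S-+ (trans⊩ (sym⊩ +-S) (trans⊩ (cong+ refl⊩ (sym⊩ h0)) h1))))))))
    q (weaken (lam (und r)) · leE h0)

module _ {n : ℕ} {Γ : Cxt n} where

  le-total : ∀ {a b} → Γ ⊩ or (le v0 v1) (le (`S v1) v0) ⟨ a ∷ b ∷ [] ⟩
  le-total {a} {b} = ind {σ = b ∷ []} (or (le v0 v1) (le (`S v1) v0)) (∨I₁ (leI le-0))
    (∨E h0 (le-split h0 (∨I₂ (leI (le-SS (le-eq (sym⊩ h0))))) (∨I₁ (leI h0)))
      (∨I₂ (leI (leTrans (leE h0) le-S))))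

module _ {n : ℕ} {Γ : Cxt n} where

  le-cases : ∀ a b {c} → Le a b ∷ Γ ⊩ c → Le (`S b) a ∷ Γ ⊩ c → Γ ⊩ c
  le-cases a b p q = ∨E (le-total {a = a} {b}) p (weaken (lam (und q)) · leE h0)

  leAntisym : ∀ {a b} → Γ ⊩ Le a b → Γ ⊩ Le b a → Γ ⊩ Eq a b
  leAntisym p q = le-split p h0 (efq (S≰ (leTrans h0 (up q))))

le-num-cases : ∀ k {n} {Γ : Cxt n} {a c} → Γ ⊩ Le a (num k) → (∀ i → i ≤ k → Γ ⊩' ⌊ Eq a (num i) ⌋ᶜ ⇒ ⌊ c ⌋ᶜ) → Γ ⊩ c
le-num-cases zero p f = le-split p (der (app (weaken (f 0 z≤n)) (hyp' here₀))) (efq (S≰0 h0))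
le-num-cases (suc k) p f = le-split p (der (app (weaken (f (suc k) ≤-refl)) (hyp' here₀)))
  (le-num-cases k (le-SS⁻ h0) (λ i i≤k → weaken (f i (m≤n⇒m≤1+n i≤k))))

-- Truth of bounded formulas, and their decision by PA

evT : ∀ {m} → Term m → Vec ℕ m → ℕ
evT (var i) ρ = lookup ρ i
evT `0 ρ = 0
evT (`S t) ρ = suc (evT t ρ)
evT (s `+ t) ρ = evT s ρ + evT t ρ
evT (s `* t) ρ = evT s ρ * evT t ρ

⟦_⟧ : ∀ {m} → Fm m → Vec ℕ m → Set
⟦ bot ⟧ ρ = ⊥
⟦ eq s t ⟧ ρ = evT s ρ ≡ evT t ρ
⟦ le s t ⟧ ρ = evT s ρ ≤ evT t ρ
⟦ imp φ ψ ⟧ ρ = ⟦ φ ⟧ ρ → ⟦ ψ ⟧ ρ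
⟦ and φ ψ ⟧ ρ = ⟦ φ ⟧ ρ × ⟦ ψ ⟧ ρ
⟦ or φ ψ ⟧ ρ = ⟦ φ ⟧ ρ ⊎ ⟦ ψ ⟧ ρ
⟦ allB t φ ⟧ ρ = ∀ x → x ≤ evT t ρ → ⟦ φ ⟧ (x ∷ ρ)
⟦ exB t φ ⟧ ρ = ∃ λ x → x ≤ evT t ρ × ⟦ φ ⟧ (x ∷ ρ)
⟦ call φ τ ⟧ ρ = ⟦ φ ⟧ (map (λ t → evT t ρ) τ)

-- The terms need only be provably equal to numerals. A bounded variable that a case distinction has
-- equated with a numeral, as in `allB-decided`, then counts as that numeral, and nothing has to be
-- rewritten.
data EnvEq {n} (Γ : Cxt n) : ∀ {m} → Vec (Term n) m → Vec ℕ m → Set where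
  [] : EnvEq Γ [] []
  _∷_ : ∀ {m t k} {σ : Vec (Term n) m} {ρ} → Γ ⊩ Eq t (num k) → EnvEq Γ σ ρ → EnvEq Γ (t ∷ σ) (k ∷ ρ)

nums : ∀ {n m} → Vec ℕ m → Vec (Term n) m
nums = map num

nums-eq : ∀ {n} {Γ : Cxt n} {m} (ρ : Vec ℕ m) → EnvEq Γ (nums ρ) ρ
nums-eq [] = []
nums-eq (k ∷ ρ) = refl⊩ ∷ nums-eq ρ

wkT-num : ∀ {n} k → wkT {n} (num k) ≡ num k
wkT-num zero = refl
wkT-num (suc k) = cong `S (wkT-num k)

tsub-num : ∀ {m n} (σ : Fin m → Term n) k → tsub σ (num k) ≡ num k
tsub-num σ zero = refl
tsub-num σ (suc k) = cong `S (tsub-num σ k)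

module _ {n : ℕ} {Γ : Cxt n} where

  env-head : ∀ {m t k} {σ : Vec (Term n) m} {ρ} → EnvEq Γ (t ∷ σ) (k ∷ ρ) → Γ ⊩ Eq t (num k)
  env-head (p ∷ ps) = p

  env-tail : ∀ {m t k} {σ : Vec (Term n) m} {ρ} → EnvEq Γ (t ∷ σ) (k ∷ ρ) → EnvEq Γ σ ρ
  env-tail (p ∷ ps) = ps

  up-env : ∀ {c m} {σ : Vec (Term n) m} {ρ} → EnvEq Γ σ ρ → EnvEq (c ∷ Γ) σ ρ
  up-env [] = []
  up-env (p ∷ ps) = up p ∷ up-env ps

  upW-env : ∀ {m} {σ : Vec (Term n) m} {ρ} → EnvEq Γ σ ρ → EnvEq (wkΓ Γ) (map wkT σ) ρ
  upW-env [] = []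
  upW-env {ρ = k ∷ ρ} (_∷_ {t = t} p ps) = subst (λ u → wkΓ Γ ⊩ Eq (wkT t) u) (wkT-num k) (upW p) ∷ upW-env ps

  num-+ : ∀ a b → Γ ⊩ Eq (num a `+ num b) (num (a + b))
  num-+ a zero = subst (λ k → Γ ⊩ Eq (num a `+ `0) (num k)) (sym (+-identityʳ a)) +-0
  num-+ a (suc b) = subst (λ k → Γ ⊩ Eq (num a `+ `S (num b)) (num k)) (sym (+-suc a b)) (trans⊩ +-S (congS (num-+ a b)))

  num-* : ∀ a b → Γ ⊩ Eq (num a `* num b) (num (a * b))
  num-* a zero = subst (λ k → Γ ⊩ Eq (num a `* `0) (num k)) (sym (*-zeroʳ a)) *-0
  num-* a (suc b) = subst (λ k → Γ ⊩ Eq (num a `* `S (num b)) (num k)) (sym (trans (*-suc a b) (+-comm a (a * b))))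
    (trans⊩ *-S (trans⊩ (cong+ (num-* a b) refl⊩) (num-+ (a * b) a)))

  num-≢ : ∀ a b → ¬ a ≡ b → Γ ⊩ Eq (num a) (num b) → Γ ⊩ Bot
  num-≢ zero zero h p = ⊥-elim (h refl)
  num-≢ zero (suc b) h p = S≢0 (sym⊩ p)
  num-≢ (suc a) zero h p = S≢0 p
  num-≢ (suc a) (suc b) h p = num-≢ a b (h ∘ cong suc) (S-inj p)

  num-≤ : ∀ {a b} → a ≤ b → Γ ⊩ Le (num a) (num b)
  num-≤ z≤n = le-0
  num-≤ (s≤s p) = le-SS (num-≤ p)

  num-≰ : ∀ a b → ¬ a ≤ b → Γ ⊩ Le (num a) (num b) → Γ ⊩ Bot
  num-≰ zero b h p = ⊥-elim (h z≤n)
  num-≰ (suc a) zero h p = S≰0 p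
  num-≰ (suc a) (suc b) h p = num-≰ a b (h ∘ s≤s) (le-SS⁻ p)

  evT⊩ : ∀ {m} {σ : Vec (Term n) m} {ρ} → EnvEq Γ σ ρ → ∀ t → Γ ⊩ Eq (t ⟦ σ ⟧ₜ) (num (evT t ρ))
  evT⊩ (p ∷ ps) (var fz) = p
  evT⊩ (p ∷ ps) (var (fs i)) = evT⊩ ps (var i)
  evT⊩ ps `0 = refl⊩
  evT⊩ ps (`S t) = congS (evT⊩ ps t)
  evT⊩ ps (s `+ t) = trans⊩ (cong+ (evT⊩ ps s) (evT⊩ ps t)) (num-+ _ _)
  evT⊩ ps (s `* t) = trans⊩ (cong* (evT⊩ ps s) (evT⊩ ps t)) (num-* _ _)

  map-env : ∀ {m k} {σ : Vec (Term n) m} {ρ} → EnvEq Γ σ ρ → (τ : Vec (Term m) k) →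
            EnvEq Γ (map (_⟦ σ ⟧ₜ) τ) (map (λ t → evT t ρ) τ)
  map-env ps [] = []
  map-env ps (t ∷ τ) = evT⊩ ps t ∷ map-env ps τ

Verified Refuted : ∀ {m} → Fm m → Vec ℕ m → Set
Verified {m} φ ρ = ∀ {n} {Γ : Cxt n} {σ : Vec (Term n) m} → EnvEq Γ σ ρ → Γ ⊩ φ ⟨ σ ⟩
Refuted {m} φ ρ = ∀ {n} {Γ : Cxt n} {σ : Vec (Term n) m} → EnvEq Γ σ ρ → Γ ⊩ neg φ ⟨ σ ⟩

data Decided {m} (φ : Fm m) (ρ : Vec ℕ m) : Set where
  holds : ⟦ φ ⟧ ρ → Verified φ ρ → Decided φ ρ
  fails : ¬ ⟦ φ ⟧ ρ → Refuted φ ρ → Decided φ ρ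

data Search {m} (φ : Fm (suc m)) (ρ : Vec ℕ m) (k : ℕ) : Set where
  each : (∀ i → i ≤ k → ⟦ φ ⟧ (i ∷ ρ) × Verified φ (i ∷ ρ)) → Search φ ρ k
  one : ∀ i → i ≤ k → ¬ ⟦ φ ⟧ (i ∷ ρ) → Refuted φ (i ∷ ρ) → Search φ ρ k

search : ∀ {m} {φ : Fm (suc m)} {ρ} → (∀ i → Decided φ (i ∷ ρ)) → ∀ k → Search φ ρ k
search d zero with d 0
... | holds p v = each λ { zero z≤n → p , v }
... | fails p v = one 0 z≤n p v
search d (suc k) with search d k
... | one i i≤k p v = one i (m≤n⇒m≤1+n i≤k) p v
... | each f with d (suc k)
...   | fails p v = one (suc k) ≤-refl p v
...   | holds p v = each g
  where
  g : ∀ i → i ≤ suc k → _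
  g i i≤ with m≤n⇒m<n∨m≡n i≤
  ... | inj₁ (s≤s i≤k) = f i i≤k
  ... | inj₂ refl = p , v

module _ {m : ℕ} {φ : Fm m} {ρ : Vec ℕ m} where

  neg-decided : Decided φ ρ → Decided (neg φ) ρ
  neg-decided (holds p v) = fails (λ q → q p) (λ es → negI (negE h0 (v (up-env es))))
  neg-decided (fails p v) = holds p v

allB-decided : ∀ {m} (t : Term m) {φ : Fm (suc m)} {ρ} → (∀ i → Decided φ (i ∷ ρ)) → Decided (allB t φ) ρ
allB-decided t {φ} {ρ} d with search d (evT t ρ)
... | each f = holds (λ i i≤ → proj₁ (f i i≤)) λ {_} {_} {σ} es →
        allBI (le-num-cases (evT t ρ) (leTrans h0 (subst (λ u → _ ⊩ Le (wkT (t ⟦ σ ⟧ₜ)) u) (wkT-num (evT t ρ)) (up (upW (le-eq (evT⊩ es t))))))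
          λ i i≤ → lam (und (proj₂ (f i i≤) (h0 ∷ up-env (up-env (upW-env es))))))
... | one i i≤ p v = fails (λ q → p (q i i≤)) λ es →
        negI (negE (v (refl⊩ ∷ up-env es)) (allBE h0 (leTrans (num-≤ i≤) (up (le-eq (sym⊩ (evT⊩ es t)))))))

opaque
  decided : ∀ {m} (φ : Fm m) (ρ : Vec ℕ m) → Decided φ ρ
  decided bot ρ = fails (λ ()) (λ _ → negI (cut h0 (der (und h0))))
  decided (eq s t) ρ with evT s ρ ℕₚ.≟ evT t ρ
  ... | yes p = holds p λ {_} {_} {σ} es → eqI (trans⊩ (evT⊩ es s) (subst (λ k → _ ⊩ Eq (num k) (t ⟦ σ ⟧ₜ)) (sym p) (sym⊩ (evT⊩ es t))))
  ... | no p = fails p λ es → negI (num-≢ _ _ p (trans⊩ (sym⊩ (up (evT⊩ es s))) (trans⊩ (eqE h0) (up (evT⊩ es t)))))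
  decided (le s t) ρ with evT s ρ ℕₚ.≤? evT t ρ
  ... | yes p = holds p λ es → leI (leTrans (le-eq (evT⊩ es s)) (leTrans (num-≤ p) (le-eq (sym⊩ (evT⊩ es t)))))
  ... | no p = fails p λ es → negI (num-≰ _ _ p (leTrans (le-eq (sym⊩ (up (evT⊩ es s)))) (leTrans (leE h0) (up (le-eq (evT⊩ es t))))))
  decided (imp φ ψ) ρ with decided φ ρ | decided ψ ρ
  ... | fails p v | _ = holds (λ q → ⊥-elim (p q)) λ es → ⊃I (efq (negE (up (v es)) h0))
  ... | holds p v | holds q w = holds (λ _ → q) λ es → ⊃I (up (w es))
  ... | holds p v | fails q w = fails (λ f → q (f p)) λ es → negI (negE (up (w es)) (⊃E h0 (up (v es))))
  decided (and φ ψ) ρ with decided φ ρ | decided ψ ρ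
  ... | fails p v | _ = fails (λ q → p (proj₁ q)) λ es → negI (negE (up (v es)) (∧E₁ h0))
  ... | holds p v | holds q w = holds (p , q) λ es → ∧I (v es) (w es)
  ... | holds p v | fails q w = fails (λ f → q (proj₂ f)) λ es → negI (negE (up (w es)) (∧E₂ h0))
  decided (or φ ψ) ρ with decided φ ρ | decided ψ ρ
  ... | holds p v | _ = holds (inj₁ p) λ es → ∨I₁ (v es)
  ... | fails p v | holds q w = holds (inj₂ q) λ es → ∨I₂ (w es)
  ... | fails p v | fails q w = fails (λ { (inj₁ x) → p x ; (inj₂ y) → q y }) λ es →
          negI (∨E h0 (negE (up (up (v es))) h0) (negE (up (up (w es))) h0))
  decided (allB t φ) ρ = allB-decided t λ i → decided φ (i ∷ ρ)
  decided (exB t φ) ρ with search (λ i → neg-decided (decided φ (i ∷ ρ))) (evT t ρ) | allB-decided t {neg φ} {ρ} (λ i → neg-decided (decided φ (i ∷ ρ)))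
  -- By its translation `exB t φ` is the negation of `allB t (neg φ)`, so a proof of the latter
  -- refutes it.
  ... | each f | holds p v = fails (λ { (i , i≤ , x) → p i i≤ x }) λ {_} {_} {σ} es → der (lam {c = exB t φ ⟨ σ ⟩} (app (hyp' here₀) (weaken (und (v es)))))
  ... | each f | fails p v = ⊥-elim (p λ i i≤ → proj₁ (f i i≤))
  ... | one i i≤ p v | _ with decided φ (i ∷ ρ)
  ...   | fails q _ = ⊥-elim (p q)
  ...   | holds q w = holds (i , i≤ , q) λ es → exBI (num i) (leTrans (num-≤ i≤) (le-eq (sym⊩ (evT⊩ es t)))) (w (refl⊩ ∷ es))
  decided (call φ τ) ρ with decided φ (map (λ t → evT t ρ) τ)
  ... | holds p v = holds p λ es → callI (v (map-env es τ))
  ... | fails p v = fails p λ es → negI (negE (v (map-env (up-env es) τ)) (callE h0))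

opaque
  verify : ∀ {m} (φ : Fm m) {ρ} → ⟦ φ ⟧ ρ → Verified φ ρ
  verify φ {ρ} p with decided φ ρ
  ... | holds _ v = v
  ... | fails q _ = ⊥-elim (q p)

  refute : ∀ {m} (φ : Fm m) {ρ} → ¬ ⟦ φ ⟧ ρ → Refuted φ ρ
  refute φ {ρ} p with decided φ ρ
  ... | holds q _ = ⊥-elim (p q)
  ... | fails _ v = v

-- Truth with an arbitrary answer type for ⊥' (Friedman's translation): since it is sound for
-- classical PA, Σ₁ sentences provable in PA get an actual witness without Markov's principle.

module Friedman (A : Set) where

  Tv : ∀ {n} → Formula n → Vec ℕ n → Set
  Tv ⊥' ρ = A
  Tv (s ≐ t) ρ = (evT s ρ ≡ evT t ρ) ⊎ A
  Tv (φ ⇒ ψ) ρ = Tv φ ρ → Tv ψ ρ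
  Tv (∀' φ) ρ = ∀ x → Tv φ (x ∷ ρ)

  Tv-efq : ∀ {n} (φ : Formula n) {ρ} → A → Tv φ ρ
  Tv-efq ⊥' a = a
  Tv-efq (s ≐ t) a = inj₂ a
  Tv-efq (φ ⇒ ψ) a _ = Tv-efq ψ a
  Tv-efq (∀' φ) a x = Tv-efq φ a

  Tv-stable : ∀ {n} (φ : Formula n) {ρ} → ((Tv φ ρ → A) → A) → Tv φ ρ
  Tv-stable ⊥' k = k id
  Tv-stable (s ≐ t) {ρ} k with evT s ρ ℕₚ.≟ evT t ρ
  ... | yes p = inj₁ p
  ... | no p = inj₂ (k λ { (inj₁ q) → ⊥-elim (p q) ; (inj₂ a) → a })
  Tv-stable (φ ⇒ ψ) k x = Tv-stable ψ λ f → k λ g → f (g x)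
  Tv-stable (∀' φ) k x = Tv-stable φ λ f → k λ g → f (g x)

  evT-tren : ∀ {m n} (r : Fin m → Fin n) {ρ ρ'} → (∀ i → lookup ρ (r i) ≡ lookup ρ' i) → ∀ t → evT (tren r t) ρ ≡ evT t ρ'
  evT-tren r h (var i) = h i
  evT-tren r h `0 = refl
  evT-tren r h (`S t) = cong suc (evT-tren r h t)
  evT-tren r h (s `+ t) = cong₂ _+_ (evT-tren r h s) (evT-tren r h t)
  evT-tren r h (s `* t) = cong₂ _*_ (evT-tren r h s) (evT-tren r h t)

  evT-tsub : ∀ {m n} {σ : Fin m → Term n} {ρ ρ'} → (∀ i → evT (σ i) ρ ≡ lookup ρ' i) → ∀ t → evT (tsub σ t) ρ ≡ evT t ρ'
  evT-tsub h (var i) = h i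
  evT-tsub h `0 = refl
  evT-tsub h (`S t) = cong suc (evT-tsub h t)
  evT-tsub h (s `+ t) = cong₂ _+_ (evT-tsub h s) (evT-tsub h t)
  evT-tsub h (s `* t) = cong₂ _*_ (evT-tsub h s) (evT-tsub h t)

  Tv-sub : ∀ {m n} (φ : Formula m) {σ : Fin m → Term n} {ρ ρ'} → (∀ i → evT (σ i) ρ ≡ lookup ρ' i) →
           Tv (fsub σ φ) ρ ⟺ Tv φ ρ'
  Tv-sub ⊥' h = id , id
  Tv-sub (s ≐ t) h =
    (λ { (inj₁ p) → inj₁ (trans (sym (evT-tsub h s)) (trans p (evT-tsub h t))) ; (inj₂ a) → inj₂ a }) ,
    (λ { (inj₁ p) → inj₁ (trans (evT-tsub h s) (trans p (sym (evT-tsub h t)))) ; (inj₂ a) → inj₂ a })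
  Tv-sub (φ ⇒ ψ) h =
    (λ f x → proj₁ (Tv-sub ψ h) (f (proj₂ (Tv-sub φ h) x))) ,
    (λ f x → proj₂ (Tv-sub ψ h) (f (proj₁ (Tv-sub φ h) x)))
  Tv-sub (∀' φ) {σ} {ρ} {ρ'} h =
    (λ f x → proj₁ (Tv-sub φ (h' x)) (f x)) , (λ f x → proj₂ (Tv-sub φ (h' x)) (f x))
    where
    h' : ∀ x i → evT (lift σ i) (x ∷ ρ) ≡ lookup (x ∷ ρ') i
    h' x fz = refl
    h' x (fs i) = trans (evT-tren fs (λ _ → refl) (σ i)) (h i)

  Tv-inst : ∀ {n} (φ : Formula (suc n)) t {ρ} → Tv (φ [ t ]) ρ ⟺ Tv φ (evT t ρ ∷ ρ)
  Tv-inst φ t = Tv-sub φ λ { fz → refl ; (fs i) → refl }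

  Tv-closeAll : ∀ {n} (φ : Formula n) → (∀ ρ → Tv φ ρ) → Tv (closeAll φ) []
  Tv-closeAll {zero} φ h = h []
  Tv-closeAll {suc n} φ h = Tv-closeAll (∀' φ) λ ρ x → h (x ∷ ρ)

  Tv-ind : ∀ {n} (φ : Formula (suc n)) ρ → Tv (indInst φ) ρ
  -- The conjunction in `indInst` is a double negation and yields its two halves only on the way to
  -- `A`; stability of φ makes this enough.
  Tv-ind φ ρ h x = Tv-stable φ λ k → h λ b s → k (go (proj₁ (Tv-inst φ `0) b) s x)
    where
    go : Tv φ (0 ∷ ρ) → (∀ x → Tv φ (x ∷ ρ) → Tv (stepS φ) (x ∷ ρ)) → ∀ x → Tv φ (x ∷ ρ)
    go b s zero = b
    go b s (suc x) = proj₁ (Tv-sub φ λ { fz → refl ; (fs i) → refl }) (s x (go b s x))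

  PA-true : ∀ {φ} → PA φ → Tv φ []
  PA-true pa1 x (inj₂ a) = a
  PA-true pa2 x y (inj₁ p) = inj₁ (ℕₚ.suc-injective p)
  PA-true pa2 x y (inj₂ a) = inj₂ a
  PA-true pa3 x = inj₁ (ℕₚ.+-identityʳ x)
  PA-true pa4 x y = inj₁ (ℕₚ.+-suc x y)
  PA-true pa5 x = inj₁ (ℕₚ.*-zeroʳ x)
  PA-true pa6 x y = inj₁ (trans (ℕₚ.*-suc x y) (ℕₚ.+-comm x (x * y)))
  PA-true (paInd φ) = Tv-closeAll (indInst φ) (Tv-ind φ)

  sound : ∀ {n} {φ : Formula n} → PA ⊢ φ → ∀ ρ → Tv φ ρ
  sound (ax {ψ = ψ} p) ρ = proj₂ (Tv-sub ψ (λ ())) (PA-true p)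
  sound axK ρ x _ = x
  sound axS ρ f g x = f x (g x)
  sound (axDN {φ = φ}) ρ = Tv-stable φ
  sound (mp d e) ρ = sound d ρ (sound e ρ)
  sound (axInst {φ = φ} {t}) ρ f = proj₂ (Tv-inst φ t) (f (evT t ρ))
  sound (axDist {ψ = ψ}) ρ f x y = f y (proj₂ (Tv-sub ψ (λ _ → refl)) x)
  sound (gen d) ρ x = sound d (x ∷ ρ)
  sound axRefl ρ = inj₁ refl
  sound (axLeib {s = s} {t} {φ}) ρ (inj₁ p) x =
    proj₂ (Tv-inst φ t) (subst (λ k → Tv φ (k ∷ ρ)) p (proj₁ (Tv-inst φ s) x))
  sound (axLeib {t = t} {φ}) ρ (inj₂ a) x = Tv-efq (φ [ t ]) a

evT-num : ∀ {n} k (ρ : Vec ℕ n) → evT (num k) ρ ≡ k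
evT-num zero ρ = refl
evT-num (suc k) ρ = cong suc (evT-num k ρ)

-- For `A` take the wanted witness itself. Truth of the existential then says: if `Tv` of φ at any y
-- yields a witness, there is one. The premise comes from `decided`: either y is a witness, or PA
-- refutes φ at y, and soundness of this refutation turns `Tv` of φ into `A`.
Σ₁-witness : ∀ {m} (φ : Fm (suc m)) ρ → PA ⊢ ⌊ exC {0} φ (nums ρ) ⌋ᶜ → ∃ λ y → ⟦ φ ⟧ (y ∷ ρ)
Σ₁-witness φ ρ d = sound d [] λ y t → give y (proj₁ (Tv-sub ⌊ φ ⌋ (env y)) t)
  where
  open Friedman (∃ λ y → ⟦ φ ⟧ (y ∷ ρ))
  env : ∀ y i → evT (lift (lookup (nums ρ)) i) (y ∷ []) ≡ lookup (y ∷ ρ) i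
  env y fz = refl
  env y (fs i) = trans (evT-tren fs {ρ' = []} (λ ()) (lookup (nums ρ) i))
    (trans (cong (λ t → evT t []) (lookup-map i num ρ)) (evT-num (lookup ρ i) []))
  env' : ∀ ρ → (i : Fin (suc _)) → evT (lookup (nums {0} {suc _} ρ) i) [] ≡ lookup ρ i
  env' ρ i = trans (cong (λ t → evT t []) (lookup-map i num ρ)) (evT-num (lookup ρ i) [])
  give : ∀ y → Tv ⌊ φ ⌋ (y ∷ ρ) → ∃ λ y → ⟦ φ ⟧ (y ∷ ρ)
  give y t with decided φ (y ∷ ρ)
  ... | holds p _ = y , p
  ... | fails _ v = sound (get (und (v {0} {[]} (nums-eq (y ∷ ρ))))) [] (proj₂ (Tv-sub ⌊ φ ⌋ (env' (y ∷ ρ))) t)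

Σ₁-complete : ∀ {m} (φ : Fm (suc m)) ρ {y} → ⟦ φ ⟧ (y ∷ ρ) → ∀ {n} {Γ : Cxt n} → Γ ⊩ exC φ (nums ρ)
Σ₁-complete φ ρ {y} p = exI (num y) (verify φ p (nums-eq (y ∷ ρ)))

-- Pairing and codes

tri-mono : ∀ {m n} → m ≤ n → tri m ≤ tri n
tri-mono z≤n = z≤n
tri-mono (s≤s p) = +-mono-≤ (s≤s p) (tri-mono p)

n≤tri : ∀ n → n ≤ tri n
n≤tri zero = z≤n
n≤tri (suc n) = m≤m+n (suc n) (tri n)

pair-lt : ∀ a b c d → a + b < c + d → pair a b < pair c d
pair-lt a b c d p = begin-strict
  tri (a + b) + b ≤⟨ +-monoʳ-≤ (tri (a + b)) (m≤n+m b a) ⟩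
  tri (a + b) + (a + b) <⟨ ≤-reflexive (sym (ℕₚ.+-suc (tri (a + b)) (a + b))) ⟩
  tri (a + b) + suc (a + b) ≡⟨ ℕₚ.+-comm (tri (a + b)) _ ⟩
  tri (suc (a + b)) ≤⟨ tri-mono p ⟩
  tri (c + d) ≤⟨ m≤m+n _ d ⟩
  pair c d ∎
  where open ℕₚ.≤-Reasoning

pair-inj : ∀ {a b c d} → pair a b ≡ pair c d → a ≡ c × b ≡ d
pair-inj {a} {b} {c} {d} p with <-cmp (a + b) (c + d)
... | tri< q _ _ = ⊥-elim (ℕₚ.<-irrefl p (pair-lt a b c d q))
... | tri> _ _ q = ⊥-elim (ℕₚ.<-irrefl (sym p) (pair-lt c d a b q))
... | tri≈ _ q _ = ℕₚ.+-cancelʳ-≡ b a c (trans q (cong (c +_) (sym b≡d))) , b≡d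
  where
  b≡d : b ≡ d
  b≡d = ℕₚ.+-cancelˡ-≡ (tri (a + b)) b d (trans p (cong (λ k → tri k + d) (sym q)))

pair-≥ₗ : ∀ a b → a ≤ pair a b
pair-≥ₗ a b = ≤-trans (≤-trans (m≤m+n a b) (n≤tri (a + b))) (m≤m+n _ b)

pair-≥ᵣ : ∀ a b → b ≤ pair a b
pair-≥ᵣ a b = m≤n+m b _

double-tri : ∀ n → tri n + tri n ≡ n * suc n
double-tri zero = refl
double-tri (suc n) = trans (lem n (tri n)) (trans (cong (λ k → (suc n + suc n) + k) (double-tri n)) (lem' n))
  where
  lem : ∀ n t → (suc n + t) + (suc n + t) ≡ (suc n + suc n) + (t + t)
  lem = solve-∀
  lem' : ∀ n → (suc n + suc n) + n * suc n ≡ suc n * suc (suc n)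
  lem' = solve-∀

-- Doubling removes the triangular number, so the graph of `pair` becomes a polynomial equation;
-- this is `PAIR`.
double-pair : ∀ a b → (a + b) * suc (a + b) + (b + b) ≡ pair a b + pair a b
double-pair a b = trans (cong (_+ (b + b)) (sym (double-tri (a + b)))) (lem (tri (a + b)) b)
  where
  lem : ∀ t b → (t + t) + (b + b) ≡ (t + b) + (t + b)
  lem = solve-∀

double-inj : ∀ {a b} → a + a ≡ b + b → a ≡ b
double-inj {a} {b} p with <-cmp a b
... | tri< q _ _ = ⊥-elim (ℕₚ.<-irrefl p (ℕₚ.+-mono-< q q))
... | tri≈ _ q _ = q
... | tri> _ _ q = ⊥-elim (ℕₚ.<-irrefl (sym p) (ℕₚ.+-mono-< q q))

-- An opaque copy of pair, and codes built from it: unfolding pair on numerals is useless and slow.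

opaque
  pr : ℕ → ℕ → ℕ
  pr = pair

  pr≡pair : ∀ a b → pr a b ≡ pair a b
  pr≡pair a b = refl

  pr-inj : ∀ {a b c d} → pr a b ≡ pr c d → a ≡ c × b ≡ d
  pr-inj {a} {b} {c} {d} = pair-inj {a} {b} {c} {d}

  pr-≥ₗ : ∀ a b → a ≤ pr a b
  pr-≥ₗ = pair-≥ₗ

  pr-≥ᵣ : ∀ a b → b ≤ pr a b
  pr-≥ᵣ = pair-≥ᵣ

  double-pr : ∀ a b → (a + b) * suc (a + b) + (b + b) ≡ pr a b + pr a b
  double-pr = double-pair

-- Tag and payload are separate functions so that a code is visibly a pair before the term is
-- analysed; comparing tags by `pr-inj` then leaves only the matching constructor.
tagₜ payₜ cdₜ : ∀ {n} → Term n → ℕ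
tagₜ (var i) = 0
tagₜ `0 = 1
tagₜ (`S t) = 2
tagₜ (s `+ t) = 3
tagₜ (s `* t) = 4
payₜ (var i) = toℕ i
payₜ `0 = 0
payₜ (`S t) = cdₜ t
payₜ (s `+ t) = pr (cdₜ s) (cdₜ t)
payₜ (s `* t) = pr (cdₜ s) (cdₜ t)
cdₜ t = pr (tagₜ t) (payₜ t)

tag pay cd : ∀ {n} → Formula n → ℕ
tag ⊥' = 0
tag (s ≐ t) = 1
tag (φ ⇒ ψ) = 2
tag (∀' φ) = 3
pay ⊥' = 0
pay (s ≐ t) = pr (cdₜ s) (cdₜ t)
pay (φ ⇒ ψ) = pr (cd φ) (cd ψ)
pay (∀' φ) = cd φ
cd φ = pr (tag φ) (pay φ)

pr-cong : ∀ {a b c d} → a ≡ c → b ≡ d → pr a b ≡ pair c d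
pr-cong refl refl = pr≡pair _ _

cdₜ≡⌜⌝ : ∀ {n} (t : Term n) → cdₜ t ≡ ⌜ t ⌝ₜ
cdₜ≡⌜⌝ (var i) = pr≡pair _ _
cdₜ≡⌜⌝ `0 = pr≡pair _ _
cdₜ≡⌜⌝ (`S t) = pr-cong refl (cdₜ≡⌜⌝ t)
cdₜ≡⌜⌝ (s `+ t) = pr-cong refl (pr-cong (cdₜ≡⌜⌝ s) (cdₜ≡⌜⌝ t))
cdₜ≡⌜⌝ (s `* t) = pr-cong refl (pr-cong (cdₜ≡⌜⌝ s) (cdₜ≡⌜⌝ t))

cd≡⌜⌝ : ∀ {n} (φ : Formula n) → cd φ ≡ ⌜ φ ⌝
cd≡⌜⌝ ⊥' = pr≡pair _ _
cd≡⌜⌝ (s ≐ t) = pr-cong refl (pr-cong (cdₜ≡⌜⌝ s) (cdₜ≡⌜⌝ t))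
cd≡⌜⌝ (φ ⇒ ψ) = pr-cong refl (pr-cong (cd≡⌜⌝ φ) (cd≡⌜⌝ ψ))
cd≡⌜⌝ (∀' φ) = pr-cong refl (cd≡⌜⌝ φ)

mutual
  cdₜ-inj : ∀ {n} (s t : Term n) → cdₜ s ≡ cdₜ t → s ≡ t
  cdₜ-inj s t p = cdₜ-inj' s t (proj₁ (pr-inj p)) (proj₂ (pr-inj p))

  cdₜ-inj' : ∀ {n} (s t : Term n) → tagₜ s ≡ tagₜ t → payₜ s ≡ payₜ t → s ≡ t
  cdₜ-inj' (var i) (var j) refl p = cong var (toℕ-injective p)
  cdₜ-inj' `0 `0 refl p = refl
  cdₜ-inj' (`S s) (`S t) refl p = cong `S (cdₜ-inj s t p)
  cdₜ-inj' (s `+ s') (t `+ t') refl p =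
    cong₂ _`+_ (cdₜ-inj s t (proj₁ (pr-inj p))) (cdₜ-inj s' t' (proj₂ (pr-inj p)))
  cdₜ-inj' (s `* s') (t `* t') refl p =
    cong₂ _`*_ (cdₜ-inj s t (proj₁ (pr-inj p))) (cdₜ-inj s' t' (proj₂ (pr-inj p)))

mutual
  cd-inj : ∀ {n} (φ ψ : Formula n) → cd φ ≡ cd ψ → φ ≡ ψ
  cd-inj φ ψ p = cd-inj' φ ψ (proj₁ (pr-inj p)) (proj₂ (pr-inj p))

  cd-inj' : ∀ {n} (φ ψ : Formula n) → tag φ ≡ tag ψ → pay φ ≡ pay ψ → φ ≡ ψ
  cd-inj' ⊥' ⊥' refl p = refl
  cd-inj' (s ≐ t) (s' ≐ t') refl p =
    cong₂ _≐_ (cdₜ-inj s s' (proj₁ (pr-inj p))) (cdₜ-inj t t' (proj₂ (pr-inj p)))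
  cd-inj' (φ ⇒ χ) (ψ ⇒ ξ) refl p =
    cong₂ _⇒_ (cd-inj φ ψ (proj₁ (pr-inj p))) (cd-inj χ ξ (proj₂ (pr-inj p)))
  cd-inj' (∀' φ) (∀' ψ) refl p = cong ∀' (cd-inj φ ψ p)

-- Codes record a variable by its index alone, not the context it lives in. Moving a formula to
-- another context by such a substitution, as `close↑` and `raise` do, leaves its code alone.
IndexPreserving : ∀ {m n} → (Fin m → Term n) → Set
IndexPreserving σ = ∀ i → ∃ λ j → σ i ≡ var j × toℕ j ≡ toℕ i

lift-preserving : ∀ {m n} {σ : Fin m → Term n} → IndexPreserving σ → IndexPreserving (lift σ)
lift-preserving h fz = fz , refl , refl
lift-preserving h (fs i) with h i
... | j , p , q = fs j , cong wkT p , cong suc q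

cdₜ-tsub : ∀ {m n} {σ : Fin m → Term n} → IndexPreserving σ → ∀ t → cdₜ (tsub σ t) ≡ cdₜ t
cdₜ-tsub h (var i) with h i
... | j , p , q = trans (cong cdₜ p) (cong (pr 0) q)
cdₜ-tsub h `0 = refl
cdₜ-tsub h (`S t) = cong (pr 2) (cdₜ-tsub h t)
cdₜ-tsub h (s `+ t) = cong₂ (λ a b → pr 3 (pr a b)) (cdₜ-tsub h s) (cdₜ-tsub h t)
cdₜ-tsub h (s `* t) = cong₂ (λ a b → pr 4 (pr a b)) (cdₜ-tsub h s) (cdₜ-tsub h t)

cd-fsub : ∀ {m n} {σ : Fin m → Term n} → IndexPreserving σ → ∀ φ → cd (fsub σ φ) ≡ cd φ
cd-fsub h ⊥' = refl
cd-fsub h (s ≐ t) = cong₂ (λ a b → pr 1 (pr a b)) (cdₜ-tsub h s) (cdₜ-tsub h t)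
cd-fsub h (φ ⇒ ψ) = cong₂ (λ a b → pr 2 (pr a b)) (cd-fsub h φ) (cd-fsub h ψ)
cd-fsub h (∀' φ) = cong (pr 3) (cd-fsub (lift-preserving h) φ)

-- Coded finite sets

PAIR : Fm 3
PAIR = eq ((v0 `+ v1) `* `S (v0 `+ v1) `+ (v1 `+ v1)) (v2 `+ v2)

PAIR-intro : ∀ a b {c} → c ≡ pr a b → ⟦ PAIR ⟧ (a ∷ b ∷ c ∷ [])
PAIR-intro a b refl = double-pr a b

PAIR-elim : ∀ a b c → ⟦ PAIR ⟧ (a ∷ b ∷ c ∷ []) → c ≡ pr a b
PAIR-elim a b c p = double-inj (trans (sym p) (double-pr a b))

-- u ∈ pr a b iff 1 + (1 + u) b divides a, as in Gödel's β-function.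
MEM : Fm 2
MEM = exB v1 (exB v2 (and (call PAIR (v1 ∷ v0 ∷ v3 ∷ [])) (exB v3 (eq (v0 `* `S (`S v3 `* v1)) v2))))

infix 4 _∈ᶜ_
_∈ᶜ_ : ℕ → ℕ → Set
u ∈ᶜ s = ⟦ MEM ⟧ (u ∷ s ∷ [])

modulus : ℕ → ℕ → ℕ
modulus b u = suc (suc u * b)

∈ᶜ-intro : ∀ u a b → modulus b u ∣ a → u ∈ᶜ pr a b
∈ᶜ-intro u a b (divides q p) =
  a , pr-≥ₗ a b , b , pr-≥ᵣ a b , PAIR-intro a b refl ,
  q , ≤-trans (m≤m*n q (modulus b u)) (≤-trans (≤-reflexive (sym p)) (pr-≥ₗ a b)) , sym p

∈ᶜ-elim : ∀ u a b → u ∈ᶜ pr a b → modulus b u ∣ a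
∈ᶜ-elim u a b (a' , _ , b' , _ , p , q , _ , r) with pr-inj {a} {b} {a'} {b'} (PAIR-elim a' b' (pr a b) p)
... | refl , refl = divides q (sym r)

fact : ℕ → ℕ
fact zero = 1
fact (suc n) = suc n * fact n

suc∣fact : ∀ {k n} → k < n → suc k ∣ fact n
suc∣fact {k} {suc n} (s≤s k≤n) with m≤n⇒m<n∨m≡n k≤n
... | inj₁ k<n = ∣n⇒∣m*n (suc n) (suc∣fact k<n)
... | inj₂ refl = m∣m*n (fact n)

fact≢0 : ∀ n → ¬ fact n ≡ 0
fact≢0 (suc n) p with ℕₚ.m*n≡0⇒m≡0∨n≡0 (suc n) p
... | inj₂ q = fact≢0 n q

-- Coprimality of the modulus and b in the form of cancellation: w · (1 + (1 + u)b) and w b (1 + u)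
-- differ by w. No greatest common divisors are involved.
cancel-b : ∀ b u w → modulus b u ∣ w * b → modulus b u ∣ w
cancel-b b u w p = ∣m+n∣m⇒∣n (subst (modulus b u ∣_) (lem w u b) (n∣m*n w)) (∣m⇒∣m*n (suc u) p)
  where
  lem : ∀ w u b → w * suc (suc u * b) ≡ w * b * suc u + w
  lem = solve-∀

cancel-kb : ∀ b u k z → suc k ∣ b → modulus b u ∣ z * (suc k * b) → modulus b u ∣ z
cancel-kb b u k z (divides c r) p = cancel-b b u z (cancel-b b u (z * b)
  (subst (modulus b u ∣_) (trans (lem z (suc k) b c) (cong (λ x → z * x * b) (sym r))) (∣m⇒∣m*n c p)))
  where
  lem : ∀ z k b c → z * (k * b) * c ≡ z * (c * k) * b
  lem = solve-∀

-- Two moduli differ by (u - v)b up to sign, and the distance of u and v, being positive and at most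
-- n, divides b = n!. Hence distinct moduli are coprime, again as cancellation; this is why b is a
-- factorial.
cancel-modulus : ∀ n u v z → u ≤ n → v ≤ n → ¬ u ≡ v →
                 modulus (fact n) u ∣ z * modulus (fact n) v → modulus (fact n) u ∣ z
cancel-modulus n u v z u≤n v≤n u≢v p with <-cmp u v
... | tri≈ _ q _ = ⊥-elim (u≢v q)
... | tri< q _ _ with ℕₚ.m≤n⇒∃[o]m+o≡n q
...   | k , refl = cancel-kb (fact n) u k z (suc∣fact (≤-trans (s≤s (m≤n+m k u)) v≤n))
        (∣m+n∣m⇒∣n (subst (modulus (fact n) u ∣_) (lem z u k (fact n)) p) (n∣m*n z))
  where
  lem : ∀ z u k b → z * suc (suc (suc u + k) * b) ≡ z * suc (suc u * b) + z * (suc k * b)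
  lem = solve-∀
cancel-modulus n u v z u≤n v≤n u≢v p | tri> _ _ q with ℕₚ.m≤n⇒∃[o]m+o≡n q
...   | k , refl = cancel-kb (fact n) u k z (suc∣fact (≤-trans (s≤s (m≤n+m k v)) u≤n))
        (∣m+n∣m⇒∣n (subst (modulus (fact n) u ∣_) (lem z v k (fact n)) (n∣m*n z)) p)
  where
  lem : ∀ z v k b → z * suc (suc (suc v + k) * b) ≡ z * suc (suc v * b) + z * (suc k * b)
  lem = solve-∀

module _ (p : ℕ → Bool) where

  factor : ℕ → ℕ → ℕ
  factor b u = if p u then modulus b u else 1

  prod : ℕ → ℕ → ℕ
  prod b zero = factor b 0
  prod b (suc m) = prod b m * factor b (suc m)

  prod-∋ : ∀ b m u → u ≤ m → p u ≡ true → modulus b u ∣ prod b m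
  prod-∋ b zero zero z≤n q rewrite q = ∣-refl
  prod-∋ b (suc m) u u≤ q with m≤n⇒m<n∨m≡n u≤
  ... | inj₁ (s≤s u≤m) = ∣m⇒∣m*n _ (prod-∋ b m u u≤m q)
  ... | inj₂ refl rewrite q = n∣m*n (prod b m)

  factor-cancel : ∀ n u v z → u ≤ n → v ≤ n → p u ≡ false → modulus (fact n) u ∣ z * factor (fact n) v → modulus (fact n) u ∣ z
  factor-cancel n u v z u≤n v≤n q h with p v in eq
  ... | false = subst (modulus (fact n) u ∣_) (ℕₚ.*-identityʳ z) h
  ... | true = cancel-modulus n u v z u≤n v≤n (λ { refl → case (trans (sym q) eq) }) h
    where
    case : ¬ false ≡ true
    case ()

  prod-∌ : ∀ n m u → m ≤ n → u ≤ n → p u ≡ false → ¬ modulus (fact n) u ∣ prod (fact n) m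
  prod-∌ n zero u m≤n u≤n q h =
    absurd (ℕₚ.m*n≡0⇒m≡0∨n≡0 (suc u) (ℕₚ.suc-injective (∣1⇒≡1
      (factor-cancel n u 0 1 u≤n z≤n q (subst (modulus (fact n) u ∣_) (sym (ℕₚ.*-identityˡ _)) h)))))
    where
    absurd : ¬ (suc u ≡ 0 ⊎ fact n ≡ 0)
    absurd (inj₂ r) = fact≢0 n r
  prod-∌ n (suc m) u m≤n u≤n q h =
    prod-∌ n m u (≤-trans (ℕₚ.n≤1+n m) m≤n) u≤n q (factor-cancel n u (suc m) (prod (fact n) m) u≤n m≤n q h)

  -- The product of the moduli of the elements. Beyond n nothing is controlled, which is why sets
  -- are always compared on an interval only.
  setCode : ℕ → ℕ
  setCode n = pr (prod (fact n) n) (fact n)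

  setCode-∋ : ∀ n u → u ≤ n → p u ≡ true → u ∈ᶜ setCode n
  setCode-∋ n u u≤n q = ∈ᶜ-intro u (prod (fact n) n) (fact n) (prod-∋ (fact n) n u u≤n q)

  setCode-∌ : ∀ n u → u ≤ n → p u ≡ false → ¬ u ∈ᶜ setCode n
  setCode-∌ n u u≤n q h = prod-∌ n n u ≤-refl u≤n q (∈ᶜ-elim u (prod (fact n) n) (fact n) h)

listCode : List ℕ → ℕ → ℕ
listCode L = setCode λ u → does (u ∈? L)

listCode-∋ : ∀ L n u → u ≤ n → u ∈ L → u ∈ᶜ listCode L n
listCode-∋ L n u u≤n q = setCode-∋ _ n u u≤n (dec-true (u ∈? L) q)

listCode-∌ : ∀ L n u → u ≤ n → u ∈ᶜ listCode L n → u ∈ L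
listCode-∌ L n u u≤n h with u ∈? L
... | yes q = q
... | no q = ⊥-elim (setCode-∌ _ n u u≤n (dec-false (u ∈? L) q) h)

maximum : List ℕ → ℕ
maximum [] = 0
maximum (x ∷ l) = x ⊔ maximum l

maximum-≥ : ∀ {l x} → x ∈ l → x ≤ maximum l
maximum-≥ {x ∷ l} (here refl) = m≤m⊔n x (maximum l)
maximum-≥ {x ∷ l} (there m) = ≤-trans (maximum-≥ m) (m≤n⊔m x (maximum l))

-- Horn clause programs over ℕ with pairing define Σ₁ relations.

data HTerm (k : ℕ) : Set where
  hv : Fin k → HTerm k
  hc : ℕ → HTerm k
  hs : HTerm k → HTerm k
  hp : HTerm k → HTerm k → HTerm k

hev : ∀ {k} → HTerm k → (Fin k → ℕ) → ℕ
hev (hv i) e = e i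
hev (hc c) e = c
hev (hs t) e = suc (hev t e)
hev (hp s t) e = pr (hev s e) (hev t e)

hev-cong : ∀ {k} (t : HTerm k) {e e'} → (∀ i → e i ≡ e' i) → hev t e ≡ hev t e'
hev-cong (hv i) h = h i
hev-cong (hc c) h = refl
hev-cong (hs t) h = cong suc (hev-cong t h)
hev-cong (hp s t) h = cong₂ pr (hev-cong s h) (hev-cong t h)

-- The value of the term is variable r, with the values of subterms bounded by variable y. Successor
-- and pairing dominate their arguments, so a bound on the final value is enough for completeness.
HEQ : ∀ {k m} → HTerm k → (Fin k → Fin m) → (r y : Fin m) → Fm m
HEQ (hv i) f r y = eq (var (f i)) (var r)
HEQ (hc c) f r y = eq (num c) (var r)
HEQ (hs t) f r y = exB (var y) (and (HEQ t (fs ∘ f) fz (fs y)) (eq (`S v0) (var (fs r))))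
HEQ (hp s t) f r y = exB (var y) (exB (var (fs y))
  (and (HEQ s (fs ∘ fs ∘ f) (fs fz) (fs (fs y))) (and (HEQ t (fs ∘ fs ∘ f) fz (fs (fs y))) (call PAIR (v1 ∷ v0 ∷ var (fs (fs r)) ∷ [])))))

HEQ-sound : ∀ {k m} (t : HTerm k) (f : Fin k → Fin m) r y {ρ} → ⟦ HEQ t f r y ⟧ ρ → hev t (lookup ρ ∘ f) ≡ lookup ρ r
HEQ-sound (hv i) f r y p = p
HEQ-sound (hc c) f r y {ρ} p = trans (sym (evT-num c ρ)) p
HEQ-sound (hs t) f r y (x , _ , p , q) = trans (cong suc (HEQ-sound t (fs ∘ f) fz (fs y) p)) q
HEQ-sound (hp s t) f r y (a , _ , b , _ , p , q , w) =
  trans (cong₂ pr (HEQ-sound s (fs ∘ fs ∘ f) (fs fz) (fs (fs y)) p) (HEQ-sound t (fs ∘ fs ∘ f) fz (fs (fs y)) q)) (sym (PAIR-elim a b _ w))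

HEQ-complete : ∀ {k m} (t : HTerm k) (f : Fin k → Fin m) r y {ρ} → hev t (lookup ρ ∘ f) ≡ lookup ρ r →
               lookup ρ r ≤ lookup ρ y → ⟦ HEQ t f r y ⟧ ρ
HEQ-complete (hv i) f r y p _ = p
HEQ-complete (hc c) f r y {ρ} p _ = trans (evT-num c ρ) p
HEQ-complete (hs t) f r y {ρ} p b = x , x≤ , HEQ-complete t (fs ∘ f) fz (fs y) refl x≤ , p
  where
  x = hev t (lookup ρ ∘ f)
  x≤ : x ≤ lookup ρ y
  x≤ = ≤-trans (≤-trans (ℕₚ.n≤1+n x) (≤-reflexive p)) b
HEQ-complete (hp s t) f r y {ρ} p b =
  a , a≤ , c , c≤ , HEQ-complete s (fs ∘ fs ∘ f) (fs fz) (fs (fs y)) refl a≤ , HEQ-complete t (fs ∘ fs ∘ f) fz (fs (fs y)) refl c≤ , PAIR-intro a c (sym p)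
  where
  a = hev s (lookup ρ ∘ f)
  c = hev t (lookup ρ ∘ f)
  a≤ : a ≤ lookup ρ y
  a≤ = ≤-trans (≤-trans (pr-≥ₗ a c) (≤-reflexive p)) b
  c≤ : c ≤ lookup ρ y
  c≤ = ≤-trans (≤-trans (pr-≥ᵣ a c) (≤-reflexive p)) b

EXS : ∀ k {m} → Fin m → Fm (k + m) → Fm m
EXS zero y φ = φ
EXS (suc k) y φ = EXS k y (exB (var (k ↑ʳ y)) φ)

EXS-sound : ∀ k {m} (y : Fin m) φ {ρ} → ⟦ EXS k y φ ⟧ ρ → Σ (Vec ℕ k) λ e → ⟦ φ ⟧ (e ++ ρ)
EXS-sound zero y φ p = [] , p
EXS-sound (suc k) y φ p with EXS-sound k y _ p
... | e , x , _ , q = x ∷ e , q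

EXS-complete : ∀ k {m} (y : Fin m) φ {ρ} (e : Vec ℕ k) → (∀ i → lookup e i ≤ lookup ρ y) → ⟦ φ ⟧ (e ++ ρ) → ⟦ EXS k y φ ⟧ ρ
EXS-complete zero y φ [] b p = p
EXS-complete (suc k) y φ {ρ} (x ∷ e) b p =
  EXS-complete k y _ e (b ∘ fs) (x , subst (x ≤_) (sym (lookup-++ʳ e ρ y)) (b fz) , p)

record Clause : Set where
  constructor clause
  field
    arity : ℕ
    head : HTerm arity
    body : List (HTerm arity)
open Clause public

module Horn (Pg : List Clause) where

  data Deriv : ℕ → Set where
    step : ∀ {c} → c ∈ Pg → (e : Vec ℕ (arity c)) → All (λ t → Deriv (hev t (lookup e))) (body c) → Deriv (hev (head c) (lookup e))

  -- environment: clause variables, then rank r, conclusion z, set s, bound n for its elements, bound y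
  PREM : ∀ {k} → HTerm k → Fm (k + 5)
  PREM {k} t = exB (var y) (and (HEQ t (λ i → fs (i ↑ˡ 5)) fz (fs y))
      (exB (var (fs r)) (and (le (`S v0) (var (fs (fs r))))
        (exB (var (fs (fs n))) (and (call PAIR (v1 ∷ v2 ∷ v0 ∷ [])) (call MEM (v0 ∷ var (fs (fs (fs s))) ∷ [])))))))
    where
    r s n y : Fin (k + 5)
    r = k ↑ʳ fz
    s = k ↑ʳ 2F
    n = k ↑ʳ 3F
    y = k ↑ʳ 4F

  PREMS : ∀ {k} → List (HTerm k) → Fm (k + 5)
  PREMS [] = eq `0 `0
  PREMS (t ∷ ts) = and (PREM t) (PREMS ts)

  CLAUSE : Clause → Fm 5
  CLAUSE (clause k h b) = EXS k 4F
    (and (HEQ h (_↑ˡ 5) (k ↑ʳ fs fz) (k ↑ʳ 4F)) (PREMS b))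

  CLAUSES : List Clause → Fm 5
  CLAUSES [] = bot
  CLAUSES (c ∷ cs) = or (CLAUSE c) (CLAUSES cs)

  opaque
    -- A derivation is a coded set of pairs (rank, conclusion) in which each pair is justified by a
    -- clause from pairs of smaller rank. The ranks replace the tree: they exclude circular
    -- justifications, and soundness is an induction on them.
    HORN : Fm 2
    HORN = exB v1 (exB v2 (and
      (exB v0 (exB v1 (and (call PAIR (v1 ∷ v4 ∷ v0 ∷ [])) (call MEM (v0 ∷ v3 ∷ [])))))
      (allB v0 (allB v1 (allB v2 (call PAIR (v1 ∷ v0 ∷ v2 ∷ []) ⊃ call MEM (v2 ∷ v4 ∷ []) ⊃
        call (CLAUSES Pg) (v1 ∷ v0 ∷ v4 ∷ v3 ∷ v6 ∷ [])))))))

  module _ (r z s n y : ℕ) where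

    ρ₅ : Vec ℕ 5
    ρ₅ = r ∷ z ∷ s ∷ n ∷ y ∷ []

    Below : ℕ → Set
    Below p = ∃ λ r' → r' < r × pr r' p ≤ n × pr r' p ∈ᶜ s

    Justified : Set
    Justified = ∃ λ c → c ∈ Pg × Σ (Vec ℕ (arity c)) λ e →
      hev (head c) (lookup e) ≡ z × All (λ t → Below (hev t (lookup e))) (body c)

    PREM-sound : ∀ {k} (t : HTerm k) e → ⟦ PREM t ⟧ (e ++ ρ₅) → Below (hev t (lookup e))
    PREM-sound t e (p , _ , q , r' , _ , lt , u , u≤ , w , m) with PAIR-elim r' p u w
    ... | refl with trans (hev-cong t (λ i → sym (lookup-++ˡ e ρ₅ i))) (HEQ-sound t _ fz _ {p ∷ (e ++ ρ₅)} q)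
    ... | refl = r' , subst (suc r' ≤_) (lookup-++ʳ e ρ₅ fz) lt , subst (_ ≤_) (lookup-++ʳ e ρ₅ _) u≤ ,
                 subst (pr r' p ∈ᶜ_) (lookup-++ʳ e ρ₅ _) m

    PREM-complete : ∀ {k} (t : HTerm k) e → n ≤ y → Below (hev t (lookup e)) → ⟦ PREM t ⟧ (e ++ ρ₅)
    PREM-complete t e n≤y (r' , lt , u≤ , m) =
      p , p≤ , HEQ-complete t _ fz _ {p ∷ (e ++ ρ₅)} (hev-cong t (λ i → lookup-++ˡ e ρ₅ i)) p≤ ,
      r' , subst (r' ≤_) (sym (lookup-++ʳ e ρ₅ fz)) (ℕₚ.<⇒≤ lt) , subst (suc r' ≤_) (sym (lookup-++ʳ e ρ₅ fz)) lt ,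
      pr r' p , subst (_ ≤_) (sym (lookup-++ʳ e ρ₅ _)) u≤ , PAIR-intro r' p refl , subst (pr r' p ∈ᶜ_) (sym (lookup-++ʳ e ρ₅ _)) m
      where
      p = hev t (lookup e)
      p≤ : p ≤ lookup (e ++ ρ₅) _
      p≤ = subst (p ≤_) (sym (lookup-++ʳ e ρ₅ 4F)) (≤-trans (pr-≥ᵣ r' p) (≤-trans u≤ n≤y))

    PREMS-sound : ∀ {k} (ts : List (HTerm k)) e → ⟦ PREMS ts ⟧ (e ++ ρ₅) → All (λ t → Below (hev t (lookup e))) ts
    PREMS-sound [] e _ = []
    PREMS-sound (t ∷ ts) e (p , q) = PREM-sound t e p ∷ PREMS-sound ts e q

    PREMS-complete : ∀ {k} (ts : List (HTerm k)) e → n ≤ y → All (λ t → Below (hev t (lookup e))) ts → ⟦ PREMS ts ⟧ (e ++ ρ₅)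
    PREMS-complete [] e n≤y _ = refl
    PREMS-complete (t ∷ ts) e n≤y (p ∷ q) = PREM-complete t e n≤y p , PREMS-complete ts e n≤y q

    CLAUSES-sound : ∀ cs → (∀ {c} → c ∈ cs → c ∈ Pg) → ⟦ CLAUSES cs ⟧ ρ₅ → Justified
    CLAUSES-sound (c@(clause k h b) ∷ cs) sub (inj₁ p) with EXS-sound k _ _ p
    ... | e , q , w = c , sub (here refl) , e ,
      trans (hev-cong h (λ i → sym (lookup-++ˡ e ρ₅ i))) (trans (HEQ-sound h (_↑ˡ 5) _ _ {e ++ ρ₅} q) (lookup-++ʳ e ρ₅ (fs fz))) ,
      PREMS-sound b e w
    CLAUSES-sound (c ∷ cs) sub (inj₂ p) = CLAUSES-sound cs (sub ∘ there) p

    CLAUSES-complete : ∀ cs {c} → c ∈ cs → (e : Vec ℕ (arity c)) → (∀ i → lookup e i ≤ y) → n ≤ y → z ≤ y →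
      hev (head c) (lookup e) ≡ z → All (λ t → Below (hev t (lookup e))) (body c) → ⟦ CLAUSES cs ⟧ ρ₅
    CLAUSES-complete (clause k h b ∷ cs) (here refl) e e≤ n≤y z≤y p q = inj₁ (EXS-complete k 4F _ e e≤
      (HEQ-complete h (_↑ˡ 5) (k ↑ʳ fs fz) _ {e ++ ρ₅} (trans (hev-cong h (λ i → lookup-++ˡ e ρ₅ i)) (trans p (sym (lookup-++ʳ e ρ₅ (fs fz)))))
        (subst₂ _≤_ (sym (lookup-++ʳ e ρ₅ (fs fz))) (sym (lookup-++ʳ e ρ₅ 4F)) z≤y) ,
       PREMS-complete b e n≤y q))
    CLAUSES-complete (_ ∷ cs) (there i) e e≤ n≤y z≤y p q = inj₂ (CLAUSES-complete cs i e e≤ n≤y z≤y p q)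

  opaque
    unfolding HORN

    HORN-sound : ∀ z y → ⟦ HORN ⟧ (z ∷ y ∷ []) → Deriv z
    HORN-sound z y (s , _ , n , _ , (r , _ , u , u≤ , w , m) , jst) with PAIR-elim r z u w
    ... | refl = go (suc r) r z ≤-refl u≤ m
      where
      go : ∀ b r z → r < b → pr r z ≤ n → pr r z ∈ᶜ s → Deriv z
      goAll : ∀ b r z → r ≤ b → ∀ {k} (ts : List (HTerm k)) e → All (λ t → Below r z s n y (hev t (lookup e))) ts → All (λ t → Deriv (hev t (lookup e))) ts
      go (suc b) r z (s≤s r≤b) u≤ m
        with CLAUSES-sound r z s n y Pg id (jst (pr r z) u≤ r (≤-trans (pr-≥ₗ r z) u≤) z (≤-trans (pr-≥ᵣ r z) u≤) (PAIR-intro r z refl) m)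
      ... | c , i , e , refl , ps = step i e (goAll b r z r≤b (body c) e ps)
      goAll b r z r≤b [] e [] = []
      goAll b r z r≤b (t ∷ ts) e ((r' , lt , u≤ , m) ∷ ps) = go b r' _ (≤-trans lt r≤b) u≤ m ∷ goAll b r z r≤b ts e ps

  private
    Ranked : Set
    Ranked = List (ℕ × ℕ)

    Just : Ranked → ℕ → ℕ → ℕ → Set
    Just L y r z = ∃ λ c → c ∈ Pg × Σ (Vec ℕ (arity c)) λ e → (∀ i → lookup e i ≤ y) ×
      hev (head c) (lookup e) ≡ z × All (λ t → ∃ λ r' → r' < r × (r' , hev t (lookup e)) ∈ L) (body c)

    Good : Ranked → ℕ → Set
    Good L y = ∀ {r z} → (r , z) ∈ L → Just L y r z

    Just-mono : ∀ {L L' y y' r z} → (∀ {x} → x ∈ L → x ∈ L') → y ≤ y' → Just L y r z → Just L' y' r z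
    Just-mono sub y≤ (c , i , e , b , p , q) =
      c , i , e , (λ j → ≤-trans (b j) y≤) , p , All.map (λ { (r' , lt , m) → r' , lt , sub m }) q

    Good-++ : ∀ {L L' y y'} → Good L y → Good L' y' → Good (L ++ᴸ L') (y ⊔ y')
    Good-++ {L} {L'} {y} {y'} g g' m with ∈-++⁻ L m
    ... | inj₁ m = Just-mono ∈-++⁺ˡ (m≤m⊔n y y') (g m)
    ... | inj₂ m = Just-mono (∈-++⁺ʳ L) (m≤n⊔m y y') (g' m)

    maxV : ∀ {k} → Vec ℕ k → ℕ
    maxV [] = 0
    maxV (x ∷ e) = x ⊔ maxV e

    maxV-≥ : ∀ {k} (e : Vec ℕ k) i → lookup e i ≤ maxV e
    maxV-≥ (x ∷ e) fz = m≤m⊔n x (maxV e)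
    maxV-≥ (x ∷ e) (fs i) = ≤-trans (maxV-≥ e i) (m≤n⊔m x (maxV e))

    -- A justification only asks for premises of smaller rank somewhere in the list, so it survives
    -- the merging of lists; the new conclusion receives a rank above those of its premises.
    flatten : ∀ {z} → Deriv z → ∃ λ L → ∃ λ y → ∃ λ r → Good L y × (r , z) ∈ L
    flattenAll : ∀ {k} {ts : List (HTerm k)} (e : Vec ℕ k) → All (λ t → Deriv (hev t (lookup e))) ts →
      ∃ λ L → ∃ λ y → ∃ λ R → Good L y × All (λ t → ∃ λ r' → r' < R × (r' , hev t (lookup e)) ∈ L) ts
    flatten (step {c} i e ds) with flattenAll e ds
    ... | L , y , R , g , q = (R , hev (head c) (lookup e)) ∷ L , maxV e ⊔ y , R , good , here refl
      where
      good : Good ((R , hev (head c) (lookup e)) ∷ L) (maxV e ⊔ y)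
      good (here refl) = c , i , e , (λ j → ≤-trans (maxV-≥ e j) (m≤m⊔n (maxV e) y)) , refl ,
        All.map (λ { (r' , lt , m) → r' , lt , there m }) q
      good (there m) = Just-mono there (m≤n⊔m (maxV e) y) (g m)
    flattenAll e [] = [] , 0 , 0 , (λ ()) , []
    flattenAll e (d ∷ ds) with flatten d | flattenAll e ds
    ... | L , y , r , g , m | L' , y' , R , g' , q = L ++ᴸ L' , y ⊔ y' , suc r ⊔ R , Good-++ g g' ,
      (r , m≤m⊔n (suc r) R , ∈-++⁺ˡ m) ∷ All.map (λ { (r' , lt , m') → r' , ≤-trans lt (m≤n⊔m (suc r) R) , ∈-++⁺ʳ L m' }) q

  opaque
    unfolding HORN

    HORN-complete : ∀ z → Deriv z → ∃ λ y → z ≤ y × ⟦ HORN ⟧ (z ∷ y ∷ [])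
    HORN-complete z d with flatten d
    ... | L , y , r , g , m = Y , ≤-trans (≤-trans (pr-≥ᵣ r z) (u≤ m)) n≤Y , s , s≤Y , n , n≤Y ,
        (r , ≤-trans (pr-≥ₗ r z) (u≤ m) , pr r z , u≤ m , PAIR-intro r z refl , mem m) , justify
      where
      codes : List ℕ
      codes = mapL (λ (r , z) → pr r z) L
      n s Y : ℕ
      n = maximum codes
      s = listCode codes n
      Y = y ⊔ (s ⊔ n)
      y≤Y : y ≤ Y
      y≤Y = m≤m⊔n y _
      s≤Y : s ≤ Y
      s≤Y = ≤-trans (m≤m⊔n s n) (m≤n⊔m y _)
      n≤Y : n ≤ Y
      n≤Y = ≤-trans (m≤n⊔m s n) (m≤n⊔m y _)
      u≤ : ∀ {r z} → (r , z) ∈ L → pr r z ≤ n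
      u≤ m = maximum-≥ (∈-map⁺ (λ (r , z) → pr r z) m)
      mem : ∀ {r z} → (r , z) ∈ L → pr r z ∈ᶜ s
      mem m = listCode-∋ codes n _ (u≤ m) (∈-map⁺ (λ (r , z) → pr r z) m)
      justify : ∀ u → u ≤ n → ∀ r → r ≤ n → ∀ z → z ≤ n → ⟦ PAIR ⟧ (r ∷ z ∷ u ∷ []) → u ∈ᶜ s → ⟦ CLAUSES Pg ⟧ (r ∷ z ∷ s ∷ n ∷ Y ∷ [])
      justify u u≤n r _ z zn w m' with ∈-map⁻ _ (listCode-∌ codes n u u≤n m')
      ... | (r' , z') , i , p with pr-inj {r} {z} {r'} {z'} (trans (sym (PAIR-elim r z u w)) p)
      ...   | refl , refl with g i
      ...     | c , ic , e , e≤ , q , ps = CLAUSES-complete r z s n Y Pg ic e (λ j → ≤-trans (e≤ j) y≤Y) n≤Y (≤-trans zn n≤Y) q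
                (All.map (λ { (r' , lt , m) → r' , lt , u≤ m , mem m }) ps)

-- Codes of substitutions and of primitive recursive functions

data Sb : ℕ → ℕ → Set where
  instB : ∀ {n} → Term n → Sb (suc n) n
  wkB : ∀ {n} → Sb n (suc n)
  liftB : ∀ {m n} → Sb m n → Sb (suc m) (suc n)

-- These are the substitutions met in checking a derivation: instantiation for `axInst` and
-- `axLeib`, weakening for `axDist`, and their lifts under quantifiers. Unlike arbitrary functions
-- they can be coded.
⟦_⟧ˢ : ∀ {m n} → Sb m n → Fin m → Term n
⟦ instB t ⟧ˢ = instS t
⟦ wkB ⟧ˢ = var ∘ fs
⟦ liftB σ ⟧ˢ = lift ⟦ σ ⟧ˢ

tagˢ payˢ cdˢ : ∀ {m n} → Sb m n → ℕ
tagˢ (instB t) = 0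
tagˢ wkB = 1
tagˢ (liftB σ) = 2
payˢ (instB t) = cdₜ t
payˢ wkB = 0
payˢ (liftB σ) = cdˢ σ
cdˢ σ = pr (tagˢ σ) (payˢ σ)

-- The successor separates nonempty lists from the empty one, whose code is 0.
cdᵛ : ∀ {n} → Vec ℕ n → ℕ
cdᵛ [] = 0
cdᵛ (x ∷ xs) = suc (pr x (cdᵛ xs))

tagᴾ payᴾ cdᴾ : ∀ {n} → PR n → ℕ
cdᴾˢ : ∀ {k n} → Vec (PR n) k → ℕ
tagᴾ zeroF = 0
tagᴾ succF = 1
tagᴾ (proj i) = 2
tagᴾ (comp f gs) = 3
tagᴾ (rec f g) = 4
payᴾ zeroF = 0
payᴾ succF = 0
payᴾ (proj i) = toℕ i
payᴾ (comp f gs) = pr (cdᴾ f) (cdᴾˢ gs)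
payᴾ (rec f g) = pr (cdᴾ f) (cdᴾ g)
cdᴾ p = pr (tagᴾ p) (payᴾ p)
cdᴾˢ [] = 0
cdᴾˢ (g ∷ gs) = suc (pr (cdᴾ g) (cdᴾˢ gs))

enc : ℕ → ℕ → ℕ → ℕ → ℕ
enc t a b c = pr t (pr a (pr b c))

cdImp : ℕ → ℕ → ℕ
cdImp a b = pr 2 (pr a b)

-- The code of ∀x₁ ∀x₀ (x₀ = e ⇒ x₁ = i ⇒ Θ) where e is the code of Θ: no substitution into Θ is needed.
Λcode : ℕ → ℕ → ℕ
Λcode e i = pr 3 (pr 3 (cdImp (pr 1 (pr (pr 0 0) (cdₜ {0} (num e)))) (cdImp (pr 1 (pr (pr 0 1) (cdₜ {0} (num i)))) e)))

cdₜ-num : ∀ {m n} k → cdₜ {m} (num k) ≡ cdₜ {n} (num k)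
cdₜ-num zero = refl
cdₜ-num (suc k) = cong (pr 2) (cdₜ-num k)

-- The Horn program for provability in T. A judgement is a tag with three arguments (unused ones are 0);
-- the numbers in the comments are clause positions.

private
  module _ {k : ℕ} where
    J : ℕ → HTerm k → HTerm k → HTerm k → HTerm k
    J t a b c = hp (hc t) (hp a (hp b c))
    T2 : ℕ → HTerm k → HTerm k
    T2 t a = hp (hc t) a
    T3 : ℕ → HTerm k → HTerm k → HTerm k
    T3 t a b = hp (hc t) (hp a b)
    IMP' : HTerm k → HTerm k → HTerm k
    IMP' = T3 2
    cons : HTerm k → HTerm k → HTerm k
    cons a b = hs (hp a b)
    o : HTerm k
    o = hc 0
    LT TM FM NM PV : HTerm k → HTerm k → HTerm k
    LT i n = J 0 i n o
    TM n c = J 1 n c o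
    FM n c = J 2 n c o
    NM n c = J 9 n c o
    PV n c = J 10 n c o
    SV ST SF LK EV EVS LL : HTerm k → HTerm k → HTerm k → HTerm k
    SV = J 3
    ST = J 4
    SF = J 5
    LK = J 6
    EV = J 7
    EVS = J 8
    LL = J 11
    wkH : HTerm k
    wkH = T2 1 o
  x0 : ∀ {k} → HTerm (suc k)
  x0 = hv fz
  x1 : ∀ {k} → HTerm (2 + k)
  x1 = hv 1F
  x2 : ∀ {k} → HTerm (3 + k)
  x2 = hv 2F
  x3 : ∀ {k} → HTerm (4 + k)
  x3 = hv 3F
  x4 : ∀ {k} → HTerm (5 + k)
  x4 = hv 4F
  x5 : ∀ {k} → HTerm (6 + k)
  x5 = hv 5F

program : PR 1 → List Clause
program χ =
  -- 0: i < n
  clause 1 (LT o (hs x0)) [] ∷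
  clause 2 (LT (hs x0) (hs x1)) (LT x0 x1 ∷ []) ∷
  -- 2: terms
  clause 2 (TM x0 (T2 0 x1)) (LT x1 x0 ∷ []) ∷
  clause 1 (TM x0 (T2 1 o)) [] ∷
  clause 2 (TM x0 (T2 2 x1)) (TM x0 x1 ∷ []) ∷
  clause 3 (TM x0 (T3 3 x1 x2)) (TM x0 x1 ∷ TM x0 x2 ∷ []) ∷
  clause 3 (TM x0 (T3 4 x1 x2)) (TM x0 x1 ∷ TM x0 x2 ∷ []) ∷
  -- 7: formulas
  clause 1 (FM x0 (T2 0 o)) [] ∷
  clause 3 (FM x0 (T3 1 x1 x2)) (TM x0 x1 ∷ TM x0 x2 ∷ []) ∷
  clause 3 (FM x0 (T3 2 x1 x2)) (FM x0 x1 ∷ FM x0 x2 ∷ []) ∷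
  clause 2 (FM x0 (T2 3 x1)) (FM (hs x0) x1 ∷ []) ∷
  -- 11: a substitution applied to a variable
  clause 1 (SV (T2 0 x0) o x0) [] ∷
  clause 2 (SV (T2 0 x0) (hs x1) (T2 0 x1)) [] ∷
  clause 1 (SV wkH x0 (T2 0 (hs x0))) [] ∷
  clause 1 (SV (T2 2 x0) o (T2 0 o)) [] ∷
  clause 4 (SV (T2 2 x0) (hs x1) x2) (SV x0 x1 x3 ∷ ST wkH x3 x2 ∷ []) ∷
  -- 16: a substitution applied to a term
  clause 3 (ST x0 (T2 0 x1) x2) (SV x0 x1 x2 ∷ []) ∷
  clause 1 (ST x0 (T2 1 o) (T2 1 o)) [] ∷
  clause 3 (ST x0 (T2 2 x1) (T2 2 x2)) (ST x0 x1 x2 ∷ []) ∷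
  clause 5 (ST x0 (T3 3 x1 x2) (T3 3 x3 x4)) (ST x0 x1 x3 ∷ ST x0 x2 x4 ∷ []) ∷
  clause 5 (ST x0 (T3 4 x1 x2) (T3 4 x3 x4)) (ST x0 x1 x3 ∷ ST x0 x2 x4 ∷ []) ∷
  -- 21: a substitution applied to a formula
  clause 1 (SF x0 (T2 0 o) (T2 0 o)) [] ∷
  clause 5 (SF x0 (T3 1 x1 x2) (T3 1 x3 x4)) (ST x0 x1 x3 ∷ ST x0 x2 x4 ∷ []) ∷
  clause 5 (SF x0 (T3 2 x1 x2) (T3 2 x3 x4)) (SF x0 x1 x3 ∷ SF x0 x2 x4 ∷ []) ∷
  clause 3 (SF x0 (T2 3 x1) (T2 3 x2)) (SF (T2 2 x0) x1 x2 ∷ []) ∷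
  -- 25: lookup in a list
  clause 2 (LK o (cons x0 x1) x0) [] ∷
  clause 4 (LK (hs x0) (cons x1 x2) x3) (LK x0 x2 x3 ∷ []) ∷
  -- 27: evaluation of primitive recursive functions
  clause 1 (EV (T2 0 o) x0 o) [] ∷
  clause 2 (EV (T2 1 o) (cons x0 x1) (hs x0)) [] ∷
  clause 3 (EV (T2 2 x0) x1 x2) (LK x0 x1 x2 ∷ []) ∷
  clause 5 (EV (T3 3 x0 x1) x2 x3) (EVS x1 x2 x4 ∷ EV x0 x4 x3 ∷ []) ∷
  clause 4 (EV (T3 4 x0 x1) (cons o x2) x3) (EV x0 x2 x3 ∷ []) ∷
  clause 6 (EV (T3 4 x0 x1) (cons (hs x2) x3) x4) (EV (T3 4 x0 x1) (cons x2 x3) x5 ∷ EV x1 (cons x5 (cons x2 x3)) x4 ∷ []) ∷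
  clause 1 (EVS o x0 o) [] ∷
  clause 5 (EVS (cons x0 x1) x2 (cons x3 x4)) (EV x0 x2 x3 ∷ EVS x1 x2 x4 ∷ []) ∷
  -- 35: codes of numerals
  clause 0 (NM o (T2 1 o)) [] ∷
  clause 2 (NM (hs x0) (T2 2 x1)) (NM x0 x1 ∷ []) ∷
  -- 37: derivations
  clause 2 (PV x0 x1) (EV (hc (cdᴾ χ)) (cons x1 o) o ∷ []) ∷
  clause 3 (PV x0 (IMP' x1 (IMP' x2 x1))) (FM x0 x1 ∷ FM x0 x2 ∷ []) ∷
  clause 4 (PV x0 (IMP' (IMP' x1 (IMP' x2 x3)) (IMP' (IMP' x1 x2) (IMP' x1 x3)))) (FM x0 x1 ∷ FM x0 x2 ∷ FM x0 x3 ∷ []) ∷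
  clause 2 (PV x0 (IMP' (IMP' (IMP' x1 (T2 0 o)) (T2 0 o)) x1)) (FM x0 x1 ∷ []) ∷
  clause 3 (PV x0 x1) (PV x0 (IMP' x2 x1) ∷ PV x0 x2 ∷ []) ∷
  clause 4 (PV x0 (IMP' (T2 3 x1) x2)) (FM (hs x0) x1 ∷ TM x0 x3 ∷ SF (T2 0 x3) x1 x2 ∷ []) ∷
  clause 4 (PV x0 (IMP' (T2 3 (IMP' x1 x2)) (IMP' x3 (T2 3 x2)))) (FM x0 x3 ∷ FM (hs x0) x2 ∷ SF wkH x3 x1 ∷ []) ∷
  clause 2 (PV x0 (T2 3 x1)) (PV (hs x0) x1 ∷ []) ∷
  clause 2 (PV x0 (T3 1 x1 x1)) (TM x0 x1 ∷ []) ∷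
  clause 6 (PV x0 (IMP' (T3 1 x1 x2) (IMP' x3 x4))) (TM x0 x1 ∷ TM x0 x2 ∷ FM (hs x0) x5 ∷ SF (T2 0 x1) x5 x3 ∷ SF (T2 0 x2) x5 x4 ∷ []) ∷
  -- 47: listed formulas
  clause 3 (LL x0 o x1) (PV x2 x1 ∷ []) ∷
  clause 4 (LL x0 (hs x1) (T2 3 (T2 3 (IMP' (T3 1 (T2 0 o) x2) (IMP' (T3 1 (T2 0 (hc 1)) x3) x0))))) (NM x0 x2 ∷ NM x1 x3 ∷ []) ∷
  []

module Program (T : Theory) (χ : PR 1)
  (spec : ∀ m → (evalPR χ (m ∷ []) ≡ 0) ⟺ (Σ (Formula 0) λ φ → T φ × ⌜ φ ⌝ ≡ m)) where

  open Horn (program χ)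

  Provable : ℕ → Set
  Provable x = ∃ λ n → Σ (Formula n) λ φ → cd φ ≡ x × (T ⊢ φ)

  Listed : ℕ → ℕ → ℕ → Set
  Listed e zero x = Provable x
  Listed e (suc i) x = x ≡ Λcode e i

  -- The computations 3 to 8 are read universally: whatever objects have the first two codes, the
  -- result has the third. Clause variables range over all numbers, and in this form soundness never
  -- has to show that an argument is a code.
  Mean : ℕ → ℕ → ℕ → ℕ → Set
  Mean 0 i n _ = i < n
  Mean 1 n c _ = Σ (Term n) λ t → cdₜ t ≡ c
  Mean 2 n c _ = Σ (Formula n) λ φ → cd φ ≡ c
  Mean 3 s i c = ∀ {m n} (σ : Sb m n) → cdˢ σ ≡ s → (j : Fin m) → toℕ j ≡ i → cdₜ (⟦ σ ⟧ˢ j) ≡ c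
  Mean 4 s a c = ∀ {m n} (σ : Sb m n) → cdˢ σ ≡ s → (t : Term m) → cdₜ t ≡ a → cdₜ (tsub ⟦ σ ⟧ˢ t) ≡ c
  Mean 5 s a c = ∀ {m n} (σ : Sb m n) → cdˢ σ ≡ s → (φ : Formula m) → cd φ ≡ a → cd (fsub ⟦ σ ⟧ˢ φ) ≡ c
  Mean 6 i xs v = ∀ {n} (as : Vec ℕ n) → cdᵛ as ≡ xs → (j : Fin n) → toℕ j ≡ i → lookup as j ≡ v
  Mean 7 f xs v = ∀ {n} (p : PR n) (as : Vec ℕ n) → cdᴾ p ≡ f → cdᵛ as ≡ xs → evalPR p as ≡ v
  Mean 8 f xs v = ∀ {k n} (p : Vec (PR n) k) (as : Vec ℕ n) → cdᴾˢ p ≡ f → cdᵛ as ≡ xs → cdᵛ (evalPRs p as) ≡ v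
  Mean 9 k c _ = cdₜ {0} (num k) ≡ c
  Mean 10 n x _ = Σ (Formula n) λ φ → cd φ ≡ x × (T ⊢ φ)
  Mean 11 e j x = Listed e j x
  Mean _ _ _ _ = ⊤

  M : ℕ → Set
  M z = ∀ t a b c → enc t a b c ≡ z → Mean t a b c

  intro : ∀ {t a b c} → Mean t a b c → M (enc t a b c)
  intro m t' a' b' c' p with pr-inj p
  ... | refl , p with pr-inj p
  ... | refl , p with pr-inj p
  ... | refl , refl = m

  elim : ∀ {t a b c} → M (enc t a b c) → Mean t a b c
  elim {t} {a} {b} {c} m = m t a b c refl

  Preserves : Clause → Set
  Preserves c = ∀ e → All (λ t → M (hev t (lookup e))) (body c) → M (hev (head c) (lookup e))

  module Sound where

    sv0 : ∀ {t m n} (σ : Sb m n) → cdˢ σ ≡ pr 0 t → ∀ j → toℕ j ≡ 0 → cdₜ (⟦ σ ⟧ˢ j) ≡ t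
    sv0 σ p j q with pr-inj p
    sv0 (instB t) p fz refl | refl , r = r

    sv1 : ∀ {t i m n} (σ : Sb m n) → cdˢ σ ≡ pr 0 t → ∀ j → toℕ j ≡ suc i → cdₜ (⟦ σ ⟧ˢ j) ≡ pr 0 i
    sv1 σ p j q with pr-inj p
    sv1 (instB t) p (fs j) refl | refl , _ = refl

    sv2 : ∀ {i m n} (σ : Sb m n) → cdˢ σ ≡ pr 1 0 → ∀ j → toℕ j ≡ i → cdₜ (⟦ σ ⟧ˢ j) ≡ pr 0 (suc i)
    sv2 σ p j q with pr-inj p
    sv2 wkB p j refl | refl , _ = refl

    sv3 : ∀ {s m n} (σ : Sb m n) → cdˢ σ ≡ pr 2 s → ∀ j → toℕ j ≡ 0 → cdₜ (⟦ σ ⟧ˢ j) ≡ pr 0 0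
    sv3 σ p j q with pr-inj p
    sv3 (liftB σ) p fz refl | refl , _ = refl

    sv4 : ∀ {s i t u} → Mean 3 s i u → Mean 4 (pr 1 0) u t → Mean 3 (pr 2 s) (suc i) t
    sv4 h h' σ p j q with pr-inj p
    sv4 h h' (liftB σ) p (fs j) refl | refl , r =
      trans (cong cdₜ (wkT-tsub (⟦ σ ⟧ˢ j))) (h' wkB refl (⟦ σ ⟧ˢ j) (h σ r j refl))

    st0 : ∀ {s i c} → Mean 3 s i c → Mean 4 s (pr 0 i) c
    st0 h σ p t q with pr-inj q
    st0 h σ p (var j) q | refl , r = h σ p j r

    st1 : ∀ {s} → Mean 4 s (pr 1 0) (pr 1 0)
    st1 σ p t q with pr-inj q
    st1 σ p `0 q | refl , _ = refl

    st2 : ∀ {s a c} → Mean 4 s a c → Mean 4 s (pr 2 a) (pr 2 c)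
    st2 h σ p t q with pr-inj q
    st2 h σ p (`S t) q | refl , r = cong (pr 2) (h σ p t r)

    st3 : ∀ {s a b c d} → Mean 4 s a c → Mean 4 s b d → Mean 4 s (pr 3 (pr a b)) (pr 3 (pr c d))
    st3 h h' σ p t q with pr-inj q
    st3 h h' σ p (t `+ t') q | refl , r = cong (pr 3) (cong₂ pr (h σ p t (proj₁ (pr-inj r))) (h' σ p t' (proj₂ (pr-inj r))))

    st4 : ∀ {s a b c d} → Mean 4 s a c → Mean 4 s b d → Mean 4 s (pr 4 (pr a b)) (pr 4 (pr c d))
    st4 h h' σ p t q with pr-inj q
    st4 h h' σ p (t `* t') q | refl , r = cong (pr 4) (cong₂ pr (h σ p t (proj₁ (pr-inj r))) (h' σ p t' (proj₂ (pr-inj r))))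

    sf0 : ∀ {s} → Mean 5 s (pr 0 0) (pr 0 0)
    sf0 σ p φ q with pr-inj q
    sf0 σ p ⊥' q | refl , _ = refl

    sf1 : ∀ {s a b c d} → Mean 4 s a c → Mean 4 s b d → Mean 5 s (pr 1 (pr a b)) (pr 1 (pr c d))
    sf1 h h' σ p φ q with pr-inj q
    sf1 h h' σ p (t ≐ t') q | refl , r = cong (pr 1) (cong₂ pr (h σ p t (proj₁ (pr-inj r))) (h' σ p t' (proj₂ (pr-inj r))))

    sf2 : ∀ {s a b c d} → Mean 5 s a c → Mean 5 s b d → Mean 5 s (cdImp a b) (cdImp c d)
    sf2 h h' σ p φ q with pr-inj q
    sf2 h h' σ p (φ ⇒ ψ) q | refl , r = cong (pr 2) (cong₂ pr (h σ p φ (proj₁ (pr-inj r))) (h' σ p ψ (proj₂ (pr-inj r))))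

    sf3 : ∀ {s a b} → Mean 5 (pr 2 s) a b → Mean 5 s (pr 3 a) (pr 3 b)
    sf3 h σ p φ q with pr-inj q
    sf3 h σ p (∀' φ) q | refl , r = cong (pr 3) (h (liftB σ) (cong (pr 2) p) φ r)

    ev0 : ∀ {xs} → Mean 7 (pr 0 0) xs 0
    ev0 p as q _ with pr-inj q
    ev0 zeroF [] q _ | refl , _ = refl

    ev1 : ∀ {x xs} → Mean 7 (pr 1 0) (suc (pr x xs)) (suc x)
    ev1 p as q r with pr-inj q
    ev1 succF (x ∷ []) q r | refl , _ = cong suc (proj₁ (pr-inj (ℕₚ.suc-injective r)))

    ev2 : ∀ {i xs v} → Mean 6 i xs v → Mean 7 (pr 2 i) xs v
    ev2 h p as q r with pr-inj q
    ev2 h (proj i) as q r | refl , w = h as r i w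

    ev3 : ∀ {f gs xs ys v} → Mean 8 gs xs ys → Mean 7 f ys v → Mean 7 (pr 3 (pr f gs)) xs v
    ev3 h h' p as q r with pr-inj q
    ev3 h h' (comp f gs) as q r | refl , w = h' f (evalPRs gs as) (proj₁ (pr-inj w)) (h gs as (proj₂ (pr-inj w)) r)

    ev4 : ∀ {f g xs v} → Mean 7 f xs v → Mean 7 (pr 4 (pr f g)) (suc (pr 0 xs)) v
    ev4 h p as q r with pr-inj q
    ev4 h (rec f g) (k ∷ as) q r | refl , w with pr-inj (ℕₚ.suc-injective r)
    ... | refl , r' = h f as (proj₁ (pr-inj w)) r'

    ev5 : ∀ {f g k xs u v} → Mean 7 (pr 4 (pr f g)) (suc (pr k xs)) u → Mean 7 g (suc (pr u (suc (pr k xs)))) v →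
          Mean 7 (pr 4 (pr f g)) (suc (pr (suc k) xs)) v
    ev5 h h' p as q r with pr-inj q
    ev5 {k = k} h h' (rec f g) (_ ∷ as) q r | refl , w with pr-inj (ℕₚ.suc-injective r)
    ... | refl , r' = h' g (evalRec f g k as ∷ k ∷ as) (proj₂ (pr-inj w))
            (cong₂ (λ a b → suc (pr a (suc (pr k b)))) (h (rec f g) (k ∷ as) q (cong (λ b → suc (pr k b)) r')) r')

    lk0 : ∀ {x xs} → Mean 6 0 (suc (pr x xs)) x
    lk0 (a ∷ as) p fz refl = proj₁ (pr-inj (ℕₚ.suc-injective p))

    lk1 : ∀ {i x xs v} → Mean 6 i xs v → Mean 6 (suc i) (suc (pr x xs)) v
    lk1 h (a ∷ as) p (fs j) refl = h as (proj₂ (pr-inj (ℕₚ.suc-injective p))) j refl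

    evs0 : ∀ {xs} → Mean 8 0 xs 0
    evs0 [] as p _ = refl

    evs1 : ∀ {g gs xs y ys} → Mean 7 g xs y → Mean 8 gs xs ys → Mean 8 (suc (pr g gs)) xs (suc (pr y ys))
    evs1 h h' (p ∷ ps) as q r with pr-inj (ℕₚ.suc-injective q)
    ... | q₁ , q₂ = cong₂ (λ a b → suc (pr a b)) (h p as q₁ r) (h' ps as q₂ r)

    inst-code : ∀ {n a b t} (φ : Formula (suc n)) (u : Term n) → cd φ ≡ a → cdₜ u ≡ t → Mean 5 (pr 0 t) a b → cd (φ [ u ]) ≡ b
    inst-code φ u p q h = trans (cong cd ([]-instS φ u)) (h (instB u) (cong (pr 0) q) φ p)

    preserved : All Preserves (program χ)
    preserved =
      (λ { (n ∷ []) _ → intro (s≤s z≤n) }) ∷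
      (λ { (i ∷ n ∷ []) (h ∷ []) → intro (s≤s (elim h)) }) ∷
      (λ { (n ∷ i ∷ []) (h ∷ []) → intro (var (fromℕ< (elim h)) , cong (pr 0) (toℕ-fromℕ< (elim h))) }) ∷
      (λ { (n ∷ []) _ → intro (`0 , refl) }) ∷
      (λ { (n ∷ c ∷ []) (h ∷ []) → intro (let t , p = elim h in `S t , cong (pr 2) p) }) ∷
      (λ { (n ∷ a ∷ b ∷ []) (h ∷ h' ∷ []) → intro (let t , p = elim h ; t' , p' = elim h' in
           t `+ t' , cong₂ (λ x y → pr 3 (pr x y)) p p') }) ∷
      (λ { (n ∷ a ∷ b ∷ []) (h ∷ h' ∷ []) → intro (let t , p = elim h ; t' , p' = elim h' in
           t `* t' , cong₂ (λ x y → pr 4 (pr x y)) p p') }) ∷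
      (λ { (n ∷ []) _ → intro (⊥' , refl) }) ∷
      (λ { (n ∷ a ∷ b ∷ []) (h ∷ h' ∷ []) → intro (let t , p = elim h ; t' , p' = elim h' in
           (t ≐ t') , cong₂ (λ x y → pr 1 (pr x y)) p p') }) ∷
      (λ { (n ∷ a ∷ b ∷ []) (h ∷ h' ∷ []) → intro (let t , p = elim h ; t' , p' = elim h' in
           (t ⇒ t') , cong₂ (λ x y → pr 2 (pr x y)) p p') }) ∷
      (λ { (n ∷ a ∷ []) (h ∷ []) → intro (let t , p = elim h in ∀' t , cong (pr 3) p) }) ∷
      (λ { (t ∷ []) _ → intro {3} sv0 }) ∷
      (λ { (t ∷ i ∷ []) _ → intro {3} sv1 }) ∷
      (λ { (i ∷ []) _ → intro {3} sv2 }) ∷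
      (λ { (s ∷ []) _ → intro {3} sv3 }) ∷
      (λ { (s ∷ i ∷ t ∷ u ∷ []) (h ∷ h' ∷ []) → intro {3} (sv4 {u = u} (elim h) (elim h')) }) ∷
      (λ { (s ∷ i ∷ t ∷ []) (h ∷ []) → intro {4} (st0 (elim h)) }) ∷
      (λ { (s ∷ []) _ → intro {4} st1 }) ∷
      (λ { (s ∷ a ∷ b ∷ []) (h ∷ []) → intro {4} (st2 (elim h)) }) ∷
      (λ { (s ∷ a ∷ b ∷ c ∷ d ∷ []) (h ∷ h' ∷ []) → intro {4} (st3 (elim h) (elim h')) }) ∷
      (λ { (s ∷ a ∷ b ∷ c ∷ d ∷ []) (h ∷ h' ∷ []) → intro {4} (st4 (elim h) (elim h')) }) ∷
      (λ { (s ∷ []) _ → intro {5} sf0 }) ∷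
      (λ { (s ∷ a ∷ b ∷ c ∷ d ∷ []) (h ∷ h' ∷ []) → intro {5} (sf1 (elim h) (elim h')) }) ∷
      (λ { (s ∷ a ∷ b ∷ c ∷ d ∷ []) (h ∷ h' ∷ []) → intro {5} (sf2 (elim h) (elim h')) }) ∷
      (λ { (s ∷ a ∷ b ∷ []) (h ∷ []) → intro {5} (sf3 (elim h)) }) ∷
      (λ { (x ∷ xs ∷ []) _ → intro {6} lk0 }) ∷
      (λ { (i ∷ x ∷ xs ∷ v ∷ []) (h ∷ []) → intro {6} (lk1 (elim h)) }) ∷
      (λ { (xs ∷ []) _ → intro {7} ev0 }) ∷
      (λ { (x ∷ xs ∷ []) _ → intro {7} ev1 }) ∷
      (λ { (i ∷ xs ∷ v ∷ []) (h ∷ []) → intro {7} (ev2 (elim h)) }) ∷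
      (λ { (f ∷ gs ∷ xs ∷ v ∷ ys ∷ []) (h ∷ h' ∷ []) → intro {7} (ev3 {ys = ys} (elim h) (elim h')) }) ∷
      (λ { (f ∷ g ∷ xs ∷ v ∷ []) (h ∷ []) → intro {7} (ev4 (elim h)) }) ∷
      (λ { (f ∷ g ∷ k ∷ xs ∷ v ∷ u ∷ []) (h ∷ h' ∷ []) → intro {7} (ev5 {u = u} (elim h) (elim h')) }) ∷
      (λ { (xs ∷ []) _ → intro {8} evs0 }) ∷
      (λ { (g ∷ gs ∷ xs ∷ y ∷ ys ∷ []) (h ∷ h' ∷ []) → intro {8} (evs1 (elim h) (elim h')) }) ∷
      (λ { [] _ → intro refl }) ∷
      (λ { (k ∷ c ∷ []) (h ∷ []) → intro (cong (pr 2) (elim h)) }) ∷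
      (λ { (n ∷ x ∷ []) (h ∷ []) → intro (let φ , t , p = proj₁ (spec x) (elim h χ (x ∷ []) refl refl) in
           close↑ φ , trans (cd-fsub (λ ()) φ) (trans (cd≡⌜⌝ φ) p) , ax t) }) ∷
      (λ { (n ∷ a ∷ b ∷ []) (h ∷ h' ∷ []) → intro (let φ , p = elim h ; ψ , q = elim h' in
           (φ ⇒ ψ ⇒ φ) , cong₂ (λ x y → cdImp x (cdImp y x)) p q , axK) }) ∷
      (λ { (n ∷ a ∷ b ∷ c ∷ []) (h ∷ h' ∷ h'' ∷ []) → intro (case-S (elim h) (elim h') (elim h'')) }) ∷
      (λ { (n ∷ a ∷ []) (h ∷ []) → intro (let φ , p = elim h in
           (¬' (¬' φ) ⇒ φ) , cong (λ x → cdImp (cdImp (cdImp x (pr 0 0)) (pr 0 0)) x) p , axDN) }) ∷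
      (λ { (n ∷ b ∷ a ∷ []) (h ∷ h' ∷ []) → intro (case-mp (elim h) (elim h')) }) ∷
      (λ { (n ∷ a ∷ b ∷ t ∷ []) (h ∷ h' ∷ h'' ∷ []) → intro (let φ , p = elim h ; u , q = elim h' in
           (∀' φ ⇒ φ [ u ]) , cong₂ (λ x y → cdImp (pr 3 x) y) p (inst-code φ u p q (elim h'')) , axInst) }) ∷
      (λ { (n ∷ c ∷ a ∷ b ∷ []) (h ∷ h' ∷ h'' ∷ []) → intro (case-dist (elim h) (elim h') (elim h'')) }) ∷
      (λ { (n ∷ a ∷ []) (h ∷ []) → intro (let φ , p , d = elim h in ∀' φ , cong (pr 3) p , gen d) }) ∷
      (λ { (n ∷ a ∷ []) (h ∷ []) → intro (let t , p = elim h in (t ≐ t) , cong (λ x → pr 1 (pr x x)) p , axRefl) }) ∷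
      (λ { (n ∷ a ∷ b ∷ c ∷ d ∷ f ∷ []) (h ∷ h' ∷ k ∷ k' ∷ k'' ∷ []) → intro
           (case-leib (elim h) (elim h') (elim k) (elim k') (elim k'')) }) ∷
      (λ { (e ∷ x ∷ n ∷ []) (h ∷ []) → intro (n , elim h) }) ∷
      (λ { (e ∷ i ∷ c ∷ d ∷ []) (h ∷ h' ∷ []) → intro
           (cong₂ (λ x y → pr 3 (pr 3 (cdImp (pr 1 (pr (pr 0 0) x)) (cdImp (pr 1 (pr (pr 0 1) y)) e)))) (sym (elim h)) (sym (elim h'))) }) ∷
      []
      where
      case-S : ∀ {n a b c} → Mean 2 n a 0 → Mean 2 n b 0 → Mean 2 n c 0 →
               Mean 10 n (cdImp (cdImp a (cdImp b c)) (cdImp (cdImp a b) (cdImp a c))) 0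
      case-S (φ , refl) (ψ , refl) (ξ , refl) = ((φ ⇒ ψ ⇒ ξ) ⇒ (φ ⇒ ψ) ⇒ φ ⇒ ξ) , refl , axS
      case-mp : ∀ {n a b} → Mean 10 n (cdImp a b) 0 → Mean 10 n a 0 → Mean 10 n b 0
      case-mp (φ , p , d) (ψ , q , d') with pr-inj p
      case-mp ((ψ' ⇒ ξ) , p , d) (ψ , q , d') | refl , r with cd-inj ψ' ψ (trans (proj₁ (pr-inj r)) (sym q))
      ... | refl = ξ , proj₂ (pr-inj r) , mp d d'
      case-dist : ∀ {n a b c} → Mean 2 n b 0 → Mean 2 (suc n) a 0 → Mean 5 (pr 1 0) b c →
                  Mean 10 n (cdImp (pr 3 (cdImp c a)) (cdImp b (pr 3 a))) 0
      case-dist (ψ , refl) (φ , refl) h = (∀' (wk ψ ⇒ φ) ⇒ ψ ⇒ ∀' φ) ,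
        cong (λ c → cdImp (pr 3 (cdImp c (cd φ))) (cdImp (cd ψ) (pr 3 (cd φ)))) (h wkB refl ψ refl) , axDist
      case-leib : ∀ {n a b c d f} → Mean 1 n a 0 → Mean 1 n b 0 → Mean 2 (suc n) f 0 → Mean 5 (pr 0 a) f c → Mean 5 (pr 0 b) f d →
                  Mean 10 n (cdImp (pr 1 (pr a b)) (cdImp c d)) 0
      case-leib (s , refl) (t , refl) (φ , refl) h h' = (s ≐ t ⇒ φ [ s ] ⇒ φ [ t ]) ,
        cong₂ (λ x y → cdImp (pr 1 (pr (cdₜ s) (cdₜ t))) (cdImp x y)) (inst-code φ s refl refl h) (inst-code φ t refl refl h') , axLeib

  deriv-sound : ∀ {z} → Deriv z → M z
  deriv-sounds : ∀ {k} {ts : List (HTerm k)} (e : Vec ℕ k) → All (λ t → Deriv (hev t (lookup e))) ts → All (λ t → M (hev t (lookup e))) ts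
  deriv-sound (step i e ds) = All.lookup Sound.preserved i e (deriv-sounds e ds)
  deriv-sounds e [] = []
  deriv-sounds e (d ∷ ds) = deriv-sound d ∷ deriv-sounds e ds

  by : (i : Fin (length (program χ))) (e : Vec ℕ (arity (lookupL (program χ) i))) →
       All (λ t → Deriv (hev t (lookup e))) (body (lookupL (program χ) i)) → Deriv (hev (head (lookupL (program χ) i)) (lookup e))
  by i e ds = step (∈-lookup {xs = program χ} i) e ds

  dLT : ∀ {i n} → i < n → Deriv (enc 0 i n 0)
  dLT {zero} {suc n} (s≤s p) = by (# 0) (n ∷ []) []
  dLT {suc i} {suc n} (s≤s p) = by (# 1) (i ∷ n ∷ []) (dLT p ∷ [])

  dTM : ∀ {n} (t : Term n) → Deriv (enc 1 n (cdₜ t) 0)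
  dTM (var i) = by (# 2) (_ ∷ _ ∷ []) (dLT (toℕ<n i) ∷ [])
  dTM `0 = by (# 3) (_ ∷ []) []
  dTM (`S t) = by (# 4) (_ ∷ _ ∷ []) (dTM t ∷ [])
  dTM (s `+ t) = by (# 5) (_ ∷ _ ∷ _ ∷ []) (dTM s ∷ dTM t ∷ [])
  dTM (s `* t) = by (# 6) (_ ∷ _ ∷ _ ∷ []) (dTM s ∷ dTM t ∷ [])

  dFM : ∀ {n} (φ : Formula n) → Deriv (enc 2 n (cd φ) 0)
  dFM ⊥' = by (# 7) (_ ∷ []) []
  dFM (s ≐ t) = by (# 8) (_ ∷ _ ∷ _ ∷ []) (dTM s ∷ dTM t ∷ [])
  dFM (φ ⇒ ψ) = by (# 9) (_ ∷ _ ∷ _ ∷ []) (dFM φ ∷ dFM ψ ∷ [])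
  dFM (∀' φ) = by (# 10) (_ ∷ _ ∷ []) (dFM φ ∷ [])

  module _ {m n} (σ : Sb m n) (d : ∀ j → Deriv (enc 3 (cdˢ σ) (toℕ j) (cdₜ (⟦ σ ⟧ˢ j)))) where
    -- The derivations for variables are a parameter because `dSV` of a lifted substitution needs
    -- this lemma for `wkB`; this avoids a circle.
    dST' : ∀ t → Deriv (enc 4 (cdˢ σ) (cdₜ t) (cdₜ (tsub ⟦ σ ⟧ˢ t)))
    dST' (var j) = by (# 16) (_ ∷ _ ∷ _ ∷ []) (d j ∷ [])
    dST' `0 = by (# 17) (_ ∷ []) []
    dST' (`S t) = by (# 18) (_ ∷ _ ∷ _ ∷ []) (dST' t ∷ [])
    dST' (s `+ t) = by (# 19) (_ ∷ _ ∷ _ ∷ _ ∷ _ ∷ []) (dST' s ∷ dST' t ∷ [])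
    dST' (s `* t) = by (# 20) (_ ∷ _ ∷ _ ∷ _ ∷ _ ∷ []) (dST' s ∷ dST' t ∷ [])

  dSV : ∀ {m n} (σ : Sb m n) j → Deriv (enc 3 (cdˢ σ) (toℕ j) (cdₜ (⟦ σ ⟧ˢ j)))
  dSV (instB t) fz = by (# 11) (_ ∷ []) []
  dSV (instB t) (fs j) = by (# 12) (cdₜ t ∷ toℕ j ∷ []) []
  dSV wkB j = by (# 13) (_ ∷ []) []
  dSV (liftB σ) fz = by (# 14) (_ ∷ []) []
  dSV (liftB σ) (fs j) = by (# 15) (_ ∷ _ ∷ _ ∷ _ ∷ []) (dSV σ j ∷
    subst (λ u → Deriv (enc 4 (pr 1 0) (cdₜ (⟦ σ ⟧ˢ j)) (cdₜ u))) (sym (wkT-tsub (⟦ σ ⟧ˢ j)))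
      (dST' wkB (λ i → by (# 13) (_ ∷ []) []) (⟦ σ ⟧ˢ j)) ∷ [])

  dSF : ∀ {m n} (σ : Sb m n) φ → Deriv (enc 5 (cdˢ σ) (cd φ) (cd (fsub ⟦ σ ⟧ˢ φ)))
  dSF σ ⊥' = by (# 21) (_ ∷ []) []
  dSF σ (s ≐ t) = by (# 22) (_ ∷ _ ∷ _ ∷ _ ∷ _ ∷ []) (dST' σ (dSV σ) s ∷ dST' σ (dSV σ) t ∷ [])
  dSF σ (φ ⇒ ψ) = by (# 23) (_ ∷ _ ∷ _ ∷ _ ∷ _ ∷ []) (dSF σ φ ∷ dSF σ ψ ∷ [])
  dSF σ (∀' φ) = by (# 24) (_ ∷ _ ∷ _ ∷ []) (dSF (liftB σ) φ ∷ [])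

  dLK : ∀ {n} (as : Vec ℕ n) j → Deriv (enc 6 (toℕ j) (cdᵛ as) (lookup as j))
  dLK (a ∷ as) fz = by (# 25) (_ ∷ _ ∷ []) []
  dLK (a ∷ as) (fs j) = by (# 26) (_ ∷ _ ∷ _ ∷ _ ∷ []) (dLK as j ∷ [])

  dEV : ∀ {n} (p : PR n) as → Deriv (enc 7 (cdᴾ p) (cdᵛ as) (evalPR p as))
  dEVS : ∀ {k n} (ps : Vec (PR n) k) as → Deriv (enc 8 (cdᴾˢ ps) (cdᵛ as) (cdᵛ (evalPRs ps as)))
  dREC : ∀ {n} (f : PR n) (g : PR (suc (suc n))) k as → Deriv (enc 7 (pr 4 (pr (cdᴾ f) (cdᴾ g))) (suc (pr k (cdᵛ as))) (evalRec f g k as))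
  dEV zeroF [] = by (# 27) (_ ∷ []) []
  dEV succF (x ∷ []) = by (# 28) (_ ∷ _ ∷ []) []
  dEV (proj i) as = by (# 29) (_ ∷ _ ∷ _ ∷ []) (dLK as i ∷ [])
  dEV (comp f gs) as = by (# 30) (_ ∷ _ ∷ _ ∷ _ ∷ _ ∷ []) (dEVS gs as ∷ dEV f (evalPRs gs as) ∷ [])
  dEV (rec f g) (k ∷ as) = dREC f g k as
  dEVS [] as = by (# 33) (_ ∷ []) []
  dEVS (p ∷ ps) as = by (# 34) (_ ∷ _ ∷ _ ∷ _ ∷ _ ∷ []) (dEV p as ∷ dEVS ps as ∷ [])
  dREC f g zero as = by (# 31) (_ ∷ _ ∷ _ ∷ _ ∷ []) (dEV f as ∷ [])
  dREC f g (suc k) as = by (# 32) (_ ∷ _ ∷ _ ∷ _ ∷ _ ∷ _ ∷ []) (dREC f g k as ∷ dEV g (evalRec f g k as ∷ k ∷ as) ∷ [])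

  dNM : ∀ k → Deriv (enc 9 k (cdₜ {0} (num k)) 0)
  dNM zero = by (# 35) [] []
  dNM (suc k) = by (# 36) (_ ∷ _ ∷ []) (dNM k ∷ [])

  dinst : ∀ {n} (φ : Formula (suc n)) t → Deriv (enc 5 (pr 0 (cdₜ t)) (cd φ) (cd (φ [ t ])))
  dinst φ t = subst (λ ψ → Deriv (enc 5 (pr 0 (cdₜ t)) (cd φ) (cd ψ))) (sym ([]-instS φ t)) (dSF (instB t) φ)

  dPV : ∀ {n} {φ : Formula n} → T ⊢ φ → Deriv (enc 10 n (cd φ) 0)
  dPV (ax {ψ = ψ} p) = by (# 37) (_ ∷ _ ∷ []) (subst₂ (λ x v → Deriv (enc 7 (cdᴾ χ) (suc (pr x 0)) v))
    (trans (sym (cd≡⌜⌝ ψ)) (sym (cd-fsub (λ ()) ψ))) (proj₂ (spec ⌜ ψ ⌝) (ψ , p , refl)) (dEV χ (⌜ ψ ⌝ ∷ [])) ∷ [])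
  dPV (axK {φ = φ} {ψ}) = by (# 38) (_ ∷ _ ∷ _ ∷ []) (dFM φ ∷ dFM ψ ∷ [])
  dPV (axS {φ = φ} {ψ} {ξ}) = by (# 39) (_ ∷ _ ∷ _ ∷ _ ∷ []) (dFM φ ∷ dFM ψ ∷ dFM ξ ∷ [])
  dPV (axDN {φ = φ}) = by (# 40) (_ ∷ _ ∷ []) (dFM φ ∷ [])
  dPV (mp d e) = by (# 41) (_ ∷ _ ∷ _ ∷ []) (dPV d ∷ dPV e ∷ [])
  dPV (axInst {φ = φ} {t}) = by (# 42) (_ ∷ _ ∷ _ ∷ _ ∷ []) (dFM φ ∷ dTM t ∷ dinst φ t ∷ [])
  dPV (axDist {ψ = ψ} {φ}) = by (# 43) (_ ∷ _ ∷ _ ∷ _ ∷ []) (dFM ψ ∷ dFM φ ∷ dSF wkB ψ ∷ [])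
  dPV (gen d) = by (# 44) (_ ∷ _ ∷ []) (dPV d ∷ [])
  dPV (axRefl {t = t}) = by (# 45) (_ ∷ _ ∷ []) (dTM t ∷ [])
  dPV (axLeib {s = s} {t} {φ}) = by (# 46) (_ ∷ _ ∷ _ ∷ _ ∷ _ ∷ _ ∷ []) (dTM s ∷ dTM t ∷ dFM φ ∷ dinst φ s ∷ dinst φ t ∷ [])

  dLL : ∀ e j x → Listed e j x → Deriv (enc 11 e j x)
  dLL e zero x (n , φ , refl , d) = by (# 47) (_ ∷ _ ∷ _ ∷ []) (dPV d ∷ [])
  dLL e (suc i) x refl = by (# 48) (_ ∷ _ ∷ _ ∷ _ ∷ []) (dNM e ∷ dNM i ∷ [])

  opaque
    -- arguments e, j, x, y: the formula coded by x is listed at stage y under index j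
    LISTED : Fm 4
    LISTED = exB v3 (and (HEQ (J 11 x0 x1 x2) fs fz 4F) (call HORN (v0 ∷ v4 ∷ [])))

    LISTED-sound : ∀ e j x y → ⟦ LISTED ⟧ (e ∷ j ∷ x ∷ y ∷ []) → Listed e j x
    LISTED-sound e j x y (z , _ , p , q) = deriv-sound (HORN-sound z y q) 11 e j x
      (HEQ-sound (J 11 x0 x1 x2) fs fz 4F {z ∷ e ∷ j ∷ x ∷ y ∷ []} p)

    LISTED-complete : ∀ e j x → Listed e j x → ∃ λ y → ⟦ LISTED ⟧ (e ∷ j ∷ x ∷ y ∷ [])
    LISTED-complete e j x h with HORN-complete (enc 11 e j x) (dLL e j x h)
    ... | y , z≤y , q = y , enc 11 e j x , z≤y ,
      HEQ-complete (J 11 x0 x1 x2) fs fz 4F {enc 11 e j x ∷ e ∷ j ∷ x ∷ y ∷ []} refl z≤y , q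

-- K is complete for finite trees, effectively.

data Tree : Set where
  node : List ℕ → List Tree → Tree

labels : Tree → List ℕ
labels (node vs ts) = vs

children : Tree → List Tree
children (node vs ts) = ts

force : Tree → MF → Bool
force t (`p i) = does (i ∈? labels t)
force t `⊥ = false
force t (`¬ A) = not (force t A)
force t (A `∧ B) = force t A ∧ force t B
force t (A `∨ B) = force t A ∨ force t B
force t (A `→ B) = not (force t A) ∨ force t B
force t (□ A) = all (λ u → force u A) (children t)

Signed : Set → Set
Signed X = Bool × X

Sat : (MF → Bool) → List (Signed MF) → Set
Sat v = All (λ (b , A) → evalB v A ≡ b)

literal : Signed MF → MF
literal (true , A) = A
literal (false , A) = `¬ A

refutation : List (Signed MF) → MF
refutation [] = `⊥
refutation (x ∷ S) = literal x `→ refutation S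

literal-true : ∀ v b A → evalB v A ≡ b → evalB v (literal (b , A)) ≡ true
literal-true v true A p = p
literal-true v false A p rewrite p = refl

literal-true⁻ : ∀ v b A → evalB v (literal (b , A)) ≡ true → evalB v A ≡ b
literal-true⁻ v true A p = p
literal-true⁻ v false A p with evalB v A
... | false = refl

refutation-false : ∀ v S → Sat v S → evalB v (refutation S) ≡ false
refutation-false v [] [] = refl
refutation-false v ((b , A) ∷ S) (p ∷ ps) rewrite literal-true v b A p = refutation-false v S ps

refutation-false⁻ : ∀ v S → evalB v (refutation S) ≡ false → Sat v S
refutation-false⁻ v [] p = []
refutation-false⁻ v ((b , A) ∷ S) p with evalB v (literal (b , A)) in eq
... | true = literal-true⁻ v b A eq ∷ refutation-false⁻ v S p

Refutable : List (Signed MF) → Set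
Refutable S = K⊢ (refutation S)

taut-refutable : ∀ S → (∀ v → ¬ Sat v S) → Refutable S
taut-refutable S h = taut t
  where
  t : ∀ v → evalB v (refutation S) ≡ true
  t v with evalB v (refutation S) in eq
  ... | true = refl
  ... | false = ⊥-elim (h v (refutation-false⁻ v S eq))

consequence : ∀ A S → (∀ v → Sat v S → evalB v A ≡ false) → K⊢ A → Refutable S
consequence A S h d = mp (taut t) d
  where
  t : ∀ v → evalB v (A `→ refutation S) ≡ true
  t v with evalB v (refutation S) in eq
  ... | true = 𝔹.∨-zeroʳ _
  ... | false rewrite h v (refutation-false⁻ v S eq) = refl

reduce : ∀ S S₁ → (∀ v → Sat v S → Sat v S₁) → Refutable S₁ → Refutable S
reduce S S₁ h = consequence (refutation S₁) S (λ v p → refutation-false v S₁ (h v p))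

combine : ∀ {A B C} → K⊢ A → K⊢ B → (∀ v → evalB v A ≡ true → evalB v B ≡ true → evalB v C ≡ true) → K⊢ C
combine {A} {B} {C} d e h = mp (mp (taut t) d) e
  where
  t : ∀ v → evalB v (A `→ B `→ C) ≡ true
  t v with evalB v A in p | evalB v B in q
  ... | true | true = h v p q
  ... | true | false = refl
  ... | false | _ = refl

chain : List MF → MF → MF
chain [] D = D
chain (C ∷ Cs) D = C `→ chain Cs D

box-chain : ∀ Cs D → K⊢ (□ (chain Cs D) `→ chain (mapL □ Cs) (□ D))
box-chain [] D = taut λ v → 𝔹.∨-inverseˡ (v (□ D))
box-chain (C ∷ Cs) D = combine {C = □ (C `→ chain Cs D) `→ □ C `→ chain (mapL □ Cs) (□ D)} axK (box-chain Cs D) h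
  where
  h : ∀ v → evalB v (□ (C `→ chain Cs D) `→ □ C `→ □ (chain Cs D)) ≡ true → evalB v (□ (chain Cs D) `→ chain (mapL □ Cs) (□ D)) ≡ true →
      evalB v (□ (C `→ chain Cs D) `→ □ C `→ chain (mapL □ Cs) (□ D)) ≡ true
  h v p q with v (□ (C `→ chain Cs D)) | v (□ C) | v (□ (chain Cs D))
  ... | false | _ | _ = refl
  ... | true | false | _ = refl
  ... | true | true | true = q

chain-true : ∀ v Cs D → (All (λ C → evalB v C ≡ true) Cs → evalB v D ≡ true) → evalB v (chain Cs D) ≡ true
chain-true v [] D h = h []
chain-true v (C ∷ Cs) D h with evalB v C in eq
... | false = refl
... | true = chain-true v Cs D (λ ps → h (eq ∷ ps))

chain-false : ∀ v Cs D → All (λ C → evalB v C ≡ true) Cs → evalB v D ≡ false → evalB v (chain Cs D) ≡ false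
chain-false v [] D [] q = q
chain-false v (C ∷ Cs) D (p ∷ ps) q rewrite p = chain-false v Cs D ps q

select : ∀ {X : Set} → Bool → List (Signed X) → List X
select b [] = []
select true ((true , x) ∷ l) = x ∷ select true l
select true ((false , x) ∷ l) = select true l
select false ((true , x) ∷ l) = select false l
select false ((false , x) ∷ l) = x ∷ select false l

select-∈ : ∀ {X : Set} {b} {l : List (Signed X)} {x} → (b , x) ∈ l → x ∈ select b l
select-∈ {b = true} (here refl) = here refl
select-∈ {b = false} (here refl) = here refl
select-∈ {b = true} {(true , _) ∷ l} (there m) = there (select-∈ m)
select-∈ {b = true} {(false , _) ∷ l} (there m) = select-∈ m
select-∈ {b = false} {(true , _) ∷ l} (there m) = select-∈ m
select-∈ {b = false} {(false , _) ∷ l} (there m) = there (select-∈ m)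

select-∈⁻ : ∀ {X : Set} b {l : List (Signed X)} {x} → x ∈ select b l → (b , x) ∈ l
select-∈⁻ true {(true , _) ∷ l} (here refl) = here refl
select-∈⁻ true {(true , _) ∷ l} (there m) = there (select-∈⁻ true m)
select-∈⁻ true {(false , _) ∷ l} m = there (select-∈⁻ true m)
select-∈⁻ false {(true , _) ∷ l} m = there (select-∈⁻ false m)
select-∈⁻ false {(false , _) ∷ l} (here refl) = here refl
select-∈⁻ false {(false , _) ∷ l} (there m) = there (select-∈⁻ false m)

-- A box weighs two more than its body. One unit is spent when it is set aside (see `boxSizes`), the
-- other when the body of a false box is opened at a successor.
size : MF → ℕ
size (`p i) = 1
size `⊥ = 1
size (`¬ A) = suc (size A)
size (A `∧ B) = suc (size A + size B)
size (A `∨ B) = suc (size A + size B)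
size (A `→ B) = suc (size A + size B)
size (□ A) = suc (suc (size A))

sizes boxSizes : List (Signed MF) → ℕ
sizes [] = 0
sizes ((_ , A) ∷ S) = size A + sizes S
boxSizes [] = 0
boxSizes ((_ , A) ∷ S) = suc (size A) + boxSizes S

vars : List (Signed ℕ) → List (Signed MF)
vars = mapL (λ (b , i) → b , `p i)

boxes : List (Signed MF) → List (Signed MF)
boxes = mapL (λ (b , A) → b , □ A)

Model : List (Signed MF) → Tree → Set
Model S t = All (λ (b , A) → force t A ≡ b) S

Answer : List (Signed MF) → Set
Answer S = Refutable S ⊎ ∃ (Model S)

transfer : ∀ S S₁ → (∀ v → Sat v S → Sat v S₁) → (∀ t → Model S₁ t → Model S t) → Answer S₁ → Answer S
transfer S S₁ h k (inj₁ d) = inj₁ (reduce S S₁ h d)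
transfer S S₁ h k (inj₂ (t , m)) = inj₂ (t , k t m)

all-true : ∀ {X : Set} (f : X → Bool) l → (∀ {x} → x ∈ l → f x ≡ true) → all f l ≡ true
all-true f [] h = refl
all-true f (x ∷ l) h rewrite h (here refl) = all-true f l (h ∘ there)

all-false : ∀ {X : Set} (f : X → Bool) l {x} → x ∈ l → f x ≡ false → all f l ≡ false
all-false f (y ∷ l) (here refl) q rewrite q = refl
all-false f (y ∷ l) (there m) q rewrite all-false f l m q = 𝔹.∧-zeroʳ (f y)

true≢false : ¬ true ≡ false
true≢false ()

≢false : ∀ x → ¬ x ≡ false → x ≡ true
≢false true h = refl
≢false false h = ⊥-elim (h refl)

find-clash : ∀ (ps qs : List ℕ) → (∃ λ i → i ∈ ps × i ∈ qs) ⊎ (∀ {i} → i ∈ ps → i ∈ qs → ⊥)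
find-clash [] qs = inj₂ λ ()
find-clash (i ∷ ps) qs with i ∈? qs
... | yes m = inj₁ (i , here refl , m)
... | no m with find-clash ps qs
...   | inj₁ (j , a , b) = inj₁ (j , there a , b)
...   | inj₂ h = inj₂ λ { (here refl) b → m b ; (there a) b → h a b }

collect : ∀ Cs Ds → (∀ D → D ∈ Ds → Answer ((false , D) ∷ mapL (true ,_) Cs)) →
  (∃ λ D → D ∈ Ds × Refutable ((false , D) ∷ mapL (true ,_) Cs)) ⊎
  (∃ λ ts → (∀ {C t} → C ∈ Cs → t ∈ ts → force t C ≡ true) × (∀ {D} → D ∈ Ds → ∃ λ t → t ∈ ts × force t D ≡ false))
collect Cs [] f = inj₂ ([] , (λ _ ()) , λ ())
collect Cs (D ∷ Ds) f with f D (here refl) | collect Cs Ds (λ E m → f E (there m))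
... | inj₁ d | _ = inj₁ (D , here refl , d)
... | inj₂ _ | inj₁ (E , m , d) = inj₁ (E , there m , d)
... | inj₂ (t , p ∷ ps) | inj₂ (ts , g , h) = inj₂ (t ∷ ts ,
  (λ { c (here refl) → All.lookup (map⁻ ps) c ; c (there m) → g c m }) ,
  (λ { (here refl) → t , here refl , p ; (there m) → let u , a , b = h m in u , there a , b }))

-- Only variables and boxes are left. A false □D needs a successor where D fails and all C with □C
-- true hold. If this demand is refutable, K proves the implication from the C to D, and
-- necessitation with iterated distribution refutes the whole. Otherwise the trees found for the
-- various D become the children.
final : ∀ ps bs → (∀ D → D ∈ select false bs → Answer ((false , D) ∷ mapL (true ,_) (select true bs))) → Answer (vars ps ++ᴸ boxes bs)
final ps bs f with find-clash (select true ps) (select false ps)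
... | inj₁ (i , m , m') = inj₁ (taut-refutable _ λ v s →
        true≢false (trans (sym (All.lookup (map⁻ (++⁻ˡ (vars ps) s)) (select-∈⁻ true m))) (All.lookup (map⁻ (++⁻ˡ (vars ps) s)) (select-∈⁻ false m'))))
... | inj₂ noclash with collect (select true bs) (select false bs) f
...   | inj₁ (D , m , d) = inj₁ (consequence (chain (mapL □ Cs) (□ D)) _
          (λ v s → let s' = map⁻ (++⁻ʳ (vars ps) s) in
            chain-false v (mapL □ Cs) (□ D) (map⁺ (All.tabulate λ c → All.lookup s' (select-∈⁻ true c))) (All.lookup s' (select-∈⁻ false m)))
          (mp (box-chain Cs D) (nec provable)))
  where
  Cs = select true bs
  provable : K⊢ (chain Cs D)
  provable = mp (taut t) d
    where
    S = (false , D) ∷ mapL (true ,_) Cs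
    t : ∀ v → evalB v (refutation S `→ chain Cs D) ≡ true
    t v with evalB v (refutation S) in eq
    ... | false = refl
    ... | true = chain-true v Cs D λ qs → D-true qs
      where
      D-true : All (λ C → evalB v C ≡ true) Cs → evalB v D ≡ true
      D-true qs = ≢false (evalB v D) λ eq' → true≢false (trans (sym eq) (refutation-false v S (eq' ∷ map⁺ qs)))
final ps bs f | inj₂ noclash | inj₂ (ts , g , h) = inj₂ (node vs ts , ++⁺ {xs = vars ps} (map⁺ {xs = ps} (All.tabulate λ { {b , i} m → var-ok b i m })) (map⁺ {xs = bs} (All.tabulate λ { {b , A} m → box-ok b A m })))
  where
  vs = select true ps
  var-ok : ∀ b i → (b , i) ∈ ps → does (i ∈? vs) ≡ b
  var-ok true i m = dec-true (i ∈? vs) (select-∈ m)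
  var-ok false i m = dec-false (i ∈? vs) (λ m' → noclash m' (select-∈ m))
  box-ok : ∀ b A → (b , A) ∈ bs → all (λ t → force t A) ts ≡ b
  box-ok true A m = all-true _ ts (λ t → g (select-∈ m) t)
  box-ok false A m = let t , a , b = h (select-∈ m) in all-false _ ts a b

module _ (op : Bool → Bool → Bool) (_⊕_ : MF → MF → MF)
  (ev-op : ∀ v A B → evalB v (A ⊕ B) ≡ op (evalB v A) (evalB v B))
  (fo-op : ∀ t A B → force t (A ⊕ B) ≡ op (force t A) (force t B)) where

  private
    Branch : Bool → MF → MF → List (Signed MF) → Bool → Bool → Set
    Branch b A B S x y = (op x y ≡ b → Refutable ((x , A) ∷ (y , B) ∷ S)) ⊎ ∃ (Model ((b , A ⊕ B) ∷ S))

    branch : ∀ b A B S x y → Answer ((x , A) ∷ (y , B) ∷ S) → Branch b A B S x y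
    branch b A B S x y (inj₁ d) = inj₁ λ _ → d
    branch b A B S x y (inj₂ (t , p ∷ q ∷ ps)) with op x y 𝔹.≟ b
    ... | yes r = inj₂ (t , trans (fo-op t A B) (trans (cong₂ op p q) r) ∷ ps)
    ... | no r = inj₁ λ r' → ⊥-elim (r r')

    guarded : Bool → MF → MF → List (Signed MF) → Bool → Bool → MF
    guarded b A B S x y with op x y 𝔹.≟ b
    ... | yes _ = refutation ((x , A) ∷ (y , B) ∷ S)
    ... | no _ = `⊥ `→ `⊥

    guarded-provable : ∀ b A B S x y → (op x y ≡ b → Refutable ((x , A) ∷ (y , B) ∷ S)) → K⊢ (guarded b A B S x y)
    guarded-provable b A B S x y h with op x y 𝔹.≟ b
    ... | yes r = h r
    ... | no _ = taut λ _ → refl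

    guarded-false : ∀ b A B S v → Sat v ((b , A ⊕ B) ∷ S) → evalB v (guarded b A B S (evalB v A) (evalB v B)) ≡ false
    guarded-false b A B S v (p ∷ ps) with op (evalB v A) (evalB v B) 𝔹.≟ b
    ... | yes _ = refutation-false v ((evalB v A , A) ∷ (evalB v B , B) ∷ S) (refl ∷ refl ∷ ps)
    ... | no r = ⊥-elim (r (trans (sym (ev-op v A B)) p))

    conj : ∀ {A B} → K⊢ A → K⊢ B → K⊢ (A `∧ B)
    conj d e = combine d e λ v p q → cong₂ _∧_ p q

  -- One argument for all three connectives. A model of a branch whose signs give b is a model of
  -- the whole. If all branches giving b are refutable, the conjunction of their refutations is
  -- false wherever the set is satisfied, since the values of A and B there single out one of these
  -- branches; the other branches contribute a harmless tautology.
  binary : ∀ b A B S → (∀ x y → Answer ((x , A) ∷ (y , B) ∷ S)) → Answer ((b , A ⊕ B) ∷ S)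
  binary b A B S f with branch b A B S true true (f true true) | branch b A B S true false (f true false)
                      | branch b A B S false true (f false true) | branch b A B S false false (f false false)
  ... | inj₂ m | _ | _ | _ = inj₂ m
  ... | inj₁ _ | inj₂ m | _ | _ = inj₂ m
  ... | inj₁ _ | inj₁ _ | inj₂ m | _ = inj₂ m
  ... | inj₁ _ | inj₁ _ | inj₁ _ | inj₂ m = inj₂ m
  ... | inj₁ d₁ | inj₁ d₂ | inj₁ d₃ | inj₁ d₄ = inj₁ (consequence
        ((G true true `∧ G true false) `∧ (G false true `∧ G false false)) _ falsified
        (conj (conj (guarded-provable b A B S true true d₁) (guarded-provable b A B S true false d₂))
              (conj (guarded-provable b A B S false true d₃) (guarded-provable b A B S false false d₄))))
    where
    G = guarded b A B S
    falsified : ∀ v → Sat v ((b , A ⊕ B) ∷ S) → evalB v ((G true true `∧ G true false) `∧ (G false true `∧ G false false)) ≡ false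
    falsified v p with evalB v A | evalB v B | guarded-false b A B S v p
    ... | true | true | q rewrite q = refl
    ... | true | false | q rewrite q | 𝔹.∧-zeroʳ (evalB v (G true true)) = refl
    ... | false | true | q rewrite q = 𝔹.∧-zeroʳ _
    ... | false | false | q rewrite q | 𝔹.∧-zeroʳ (evalB v (G false true)) = 𝔹.∧-zeroʳ _

private
  not-flip : ∀ x b → not x ≡ b → x ≡ not b
  not-flip true _ refl = refl
  not-flip false _ refl = refl

  not-flip⁻ : ∀ x b → x ≡ not b → not x ≡ b
  not-flip⁻ x true refl = refl
  not-flip⁻ x false refl = refl

  boxes-mono : ∀ (bs : List (Signed MF)) {D} → D ∈ select false bs →
               size D + sizes (mapL (true ,_) (select true bs)) < boxSizes bs
  true-≤ : ∀ (bs : List (Signed MF)) → sizes (mapL (true ,_) (select true bs)) ≤ boxSizes bs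
  true-≤ [] = z≤n
  true-≤ ((true , C) ∷ bs) = ℕₚ.+-mono-≤ (ℕₚ.n≤1+n (size C)) (true-≤ bs)
  true-≤ ((false , C) ∷ bs) = ≤-trans (true-≤ bs) (ℕₚ.m≤n+m _ (suc (size C)))
  boxes-mono ((true , C) ∷ bs) {D} m = begin-strict
    size D + (size C + sizes (mapL (true ,_) (select true bs))) ≡⟨ lem (size D) (size C) _ ⟩
    size C + (size D + sizes (mapL (true ,_) (select true bs))) <⟨ ℕₚ.+-mono-≤-< (ℕₚ.n≤1+n (size C)) (boxes-mono bs m) ⟩
    suc (size C) + boxSizes bs ∎
    where
    open ℕₚ.≤-Reasoning
    lem : ∀ a b c → a + (b + c) ≡ b + (a + c)
    lem = solve-∀
  boxes-mono ((false , C) ∷ bs) (here refl) = s≤s (ℕₚ.+-monoʳ-≤ (size C) (true-≤ bs))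
  boxes-mono ((false , C) ∷ bs) (there m) = ≤-trans (boxes-mono bs m) (ℕₚ.m≤n+m _ (suc (size C)))

pending : List (Signed MF) → List (Signed ℕ) → List (Signed MF) → List (Signed MF)
pending S ps bs = S ++ᴸ (vars ps ++ᴸ boxes bs)

-- `ps` and `bs` hold the variables and boxes set aside, and successors are opened only when S is
-- exhausted, so that all true boxes are known by then.
tableau : ∀ n S ps bs → sizes S + boxSizes bs < n → Answer (pending S ps bs)
tableau (suc n) [] ps bs lt = final ps bs λ D m →
  transfer ((false , D) ∷ mapL (true ,_) (select true bs)) _ (λ v s → ++⁺ s []) (λ t s → ++⁻ˡ _ s)
    (tableau n ((false , D) ∷ mapL (true ,_) (select true bs)) [] []
      (≤-trans (s≤s (≤-reflexive (ℕₚ.+-identityʳ _))) (≤-trans (boxes-mono bs m) (s≤s⁻¹ lt))))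
tableau (suc n) ((b , `p i) ∷ S) ps bs lt = transfer _ _ (λ v → shift) (λ t → unshift) (tableau n S ((b , i) ∷ ps) bs (s≤s⁻¹ lt))
  where
  shift : ∀ {P : Signed MF → Set} → All P ((b , `p i) ∷ pending S ps bs) → All P (pending S ((b , i) ∷ ps) bs)
  shift (q ∷ qs) = ++⁺ (++⁻ˡ S qs) (q ∷ ++⁻ʳ S qs)
  unshift : ∀ {P : Signed MF → Set} → All P (pending S ((b , i) ∷ ps) bs) → All P ((b , `p i) ∷ pending S ps bs)
  unshift qs with ++⁻ʳ S qs
  ... | r ∷ rs = r ∷ ++⁺ (++⁻ˡ S qs) rs
tableau (suc n) ((b , □ A) ∷ S) ps bs lt = transfer _ _ (λ v → shift) (λ t → unshift) (tableau n S ps ((b , A) ∷ bs)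
    (≤-trans (s≤s (≤-reflexive (lem (size A) (sizes S) (boxSizes bs)))) (s≤s⁻¹ lt)))
  where
  lem : ∀ a s β → s + (suc a + β) ≡ suc (a + s + β)
  lem = solve-∀
  shift : ∀ {P : Signed MF → Set} → All P ((b , □ A) ∷ pending S ps bs) → All P (pending S ps ((b , A) ∷ bs))
  shift (q ∷ qs) with ++⁻ʳ S qs
  ... | rs = ++⁺ (++⁻ˡ S qs) (++⁺ (++⁻ˡ (vars ps) rs) (q ∷ ++⁻ʳ (vars ps) rs))
  unshift : ∀ {P : Signed MF → Set} → All P (pending S ps ((b , A) ∷ bs)) → All P ((b , □ A) ∷ pending S ps bs)
  unshift qs with ++⁻ʳ S qs
  ... | rs with ++⁻ʳ (vars ps) rs
  ...   | w ∷ ws = w ∷ ++⁺ (++⁻ˡ S qs) (++⁺ (++⁻ˡ (vars ps) rs) ws)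
tableau (suc n) ((true , `⊥) ∷ S) ps bs lt = inj₁ (taut-refutable ((true , `⊥) ∷ pending S ps bs) λ { v (() ∷ _) })
tableau (suc n) ((false , `⊥) ∷ S) ps bs lt = transfer ((false , `⊥) ∷ pending S ps bs) (pending S ps bs) (λ { v (_ ∷ qs) → qs }) (λ t qs → refl ∷ qs) (tableau n S ps bs (s≤s⁻¹ lt))
tableau (suc n) ((b , `¬ A) ∷ S) ps bs lt = transfer ((b , `¬ A) ∷ pending S ps bs) ((not b , A) ∷ pending S ps bs) (λ { v (q ∷ qs) → not-flip _ b q ∷ qs }) (λ { t (q ∷ qs) → not-flip⁻ _ b q ∷ qs })
  (tableau n ((not b , A) ∷ S) ps bs (s≤s⁻¹ lt))
tableau (suc n) ((b , A `∧ B) ∷ S) ps bs lt = binary _∧_ _`∧_ (λ _ _ _ → refl) (λ _ _ _ → refl) b A B _ λ x y →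
  tableau n ((x , A) ∷ (y , B) ∷ S) ps bs (subst (λ k → suc (k + boxSizes bs) ≤ n) (+-assoc (size A) (size B) (sizes S)) (s≤s⁻¹ lt))
tableau (suc n) ((b , A `∨ B) ∷ S) ps bs lt = binary _∨_ _`∨_ (λ _ _ _ → refl) (λ _ _ _ → refl) b A B _ λ x y →
  tableau n ((x , A) ∷ (y , B) ∷ S) ps bs (subst (λ k → suc (k + boxSizes bs) ≤ n) (+-assoc (size A) (size B) (sizes S)) (s≤s⁻¹ lt))
tableau (suc n) ((b , (A `→ B)) ∷ S) ps bs lt = binary (λ x y → not x ∨ y) _`→_ (λ _ _ _ → refl) (λ _ _ _ → refl) b A B _ λ x y →
  tableau n ((x , A) ∷ (y , B) ∷ S) ps bs (subst (λ k → suc (k + boxSizes bs) ≤ n) (+-assoc (size A) (size B) (sizes S)) (s≤s⁻¹ lt))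

K-complete : ∀ A → K⊢ A ⊎ ∃ λ t → force t A ≡ false
K-complete A with tableau (suc (size A + 0 + 0)) ((false , A) ∷ []) [] [] ≤-refl
... | inj₁ d = inj₁ (mp (taut λ v → lem (evalB v A)) d)
  where
  lem : ∀ x → not (not (not x) ∨ false) ∨ x ≡ true
  lem true = refl
  lem false = refl
... | inj₂ (t , p ∷ []) = inj₂ (t , p)

-- Tautologies are provable under every interpretation (Kalmár's argument).

eqMF : (A B : MF) → Maybe (A ≡ B)
eqMF (`p i) (`p j) with i ℕₚ.≟ j
... | yes refl = just refl
... | no _ = nothing
eqMF `⊥ `⊥ = just refl
eqMF (`¬ A) (`¬ B) with eqMF A B
... | just refl = just refl
... | nothing = nothing
eqMF (A `∧ A') (B `∧ B') with eqMF A B | eqMF A' B'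
... | just refl | just refl = just refl
... | _ | _ = nothing
eqMF (A `∨ A') (B `∨ B') with eqMF A B | eqMF A' B'
... | just refl | just refl = just refl
... | _ | _ = nothing
eqMF (A `→ A') (B `→ B') with eqMF A B | eqMF A' B'
... | just refl | just refl = just refl
... | _ | _ = nothing
eqMF (□ A) (□ B) with eqMF A B
... | just refl = just refl
... | nothing = nothing
eqMF _ _ = nothing

eqMF-refl : ∀ A → ∃ λ p → eqMF A A ≡ just p
eqMF-refl (`p i) with i ℕₚ.≟ i
... | yes refl = refl , refl
... | no q = ⊥-elim (q refl)
eqMF-refl `⊥ = refl , refl
eqMF-refl (`¬ A) with eqMF A A | eqMF-refl A
... | just refl | _ = refl , refl
eqMF-refl (A `∧ B) with eqMF A A | eqMF-refl A | eqMF B B | eqMF-refl B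
... | just refl | _ | just refl | _ = refl , refl
eqMF-refl (A `∨ B) with eqMF A A | eqMF-refl A | eqMF B B | eqMF-refl B
... | just refl | _ | just refl | _ = refl , refl
eqMF-refl (A `→ B) with eqMF A A | eqMF-refl A | eqMF B B | eqMF-refl B
... | just refl | _ | just refl | _ = refl , refl
eqMF-refl (□ A) with eqMF A A | eqMF-refl A
... | just refl | _ = refl , refl

update : (MF → Bool) → MF → Bool → MF → Bool
update v A b B with eqMF B A
... | just _ = b
... | nothing = v B

atoms : MF → List MF
atoms (`p i) = `p i ∷ []
atoms `⊥ = []
atoms (`¬ A) = atoms A
atoms (A `∧ B) = atoms A ++ᴸ atoms B
atoms (A `∨ B) = atoms A ++ᴸ atoms B
atoms (A `→ B) = atoms A ++ᴸ atoms B
atoms (□ A) = □ A ∷ []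

module Kalmar (Pr : Formula 1) (f : ℕ → Formula 0) where

  I : MF → Formula 0
  I = interp Pr f

  signed : Bool → Formula 0 → Formula 0
  signed true φ = φ
  signed false φ = ¬' φ

  Decides : Cxt 0 → (MF → Bool) → List MF → Set
  Decides Γ v as = ∀ {a} → a ∈ as → Γ ⊩' signed (v a) (I a)

  -- Stated for any context that decides the atoms, boxes included, because it is used twice: for
  -- tautologies, where the context consists of case hypotheses, and in `world`, where Λᵢ decides
  -- the atoms.
  kalmar : ∀ v A {Γ} → Decides Γ v (atoms A) → Γ ⊩' signed (evalB v A) (I A)
  kalmar v (`p i) h = h (here refl)
  kalmar v `⊥ h = lamr (und (S≢0 {a = `0} (sym⊩ (der (hypr here₀)))))
  kalmar v (`¬ A) h with evalB v A | kalmar v A h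
  ... | true | d = lamr (app (hypr here₀) (weaken d))
  ... | false | d = d
  kalmar v (A `∧ B) h with evalB v A | kalmar v A (h ∘ ∈-++⁺ˡ) | evalB v B | kalmar v B (h ∘ ∈-++⁺ʳ (atoms A))
  ... | true | d | true | e = ∧I' d e
  ... | true | d | false | e = lamr (app (weaken e) (∧E₂' (hypr here₀)))
  ... | false | d | _ | e = lamr (app (weaken d) (∧E₁' (hypr here₀)))
  kalmar v (A `∨ B) h with evalB v A | kalmar v A (h ∘ ∈-++⁺ˡ) | evalB v B | kalmar v B (h ∘ ∈-++⁺ʳ (atoms A))
  ... | true | d | _ | e = lamr (efq' (app (hypr here₀) (weaken d)))
  ... | false | d | true | e = lamr (weaken e)
  ... | false | d | false | e = lamr (app (weaken e) (app (hypr here₀) (weaken d)))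
  kalmar v (A `→ B) h with evalB v A | kalmar v A (h ∘ ∈-++⁺ˡ) | evalB v B | kalmar v B (h ∘ ∈-++⁺ʳ (atoms A))
  ... | _ | d | true | e = goal _ e
    where
    goal : ∀ x {Γ} → Γ ⊩' I B → Γ ⊩' signed (not x ∨ true) (I A ⇒ I B)
    goal true e = lamr (weaken e)
    goal false e = lamr (weaken e)
  ... | true | d | false | e = lamr (app (weaken e) (app (hypr here₀) (weaken d)))
  ... | false | d | false | e = lamr (efq' (app (weaken d) (hypr here₀)))
  kalmar v (□ A) h = h (here refl)

  decides-update : ∀ {Γ v as a b} → Decides Γ v as → Decides (raw (signed b (I a)) ∷ Γ) (update v a b) (a ∷ as)
  decides-update {a = a} h {c} m with eqMF c a in eq
  ... | just refl = hypr here₀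
  decides-update {a = a} h {c} (here refl) | nothing with trans (sym eq) (proj₂ (eqMF-refl a))
  ... | ()
  decides-update h (there m) | nothing = weaken (h m)

  -- Excluded middle for one atom after another. The valuation records the cases taken and the
  -- context grows with them, hence the quantification over both.
  eliminate : ∀ as {φ} → (∀ v {Γ} → Decides Γ v as → Γ ⊩' φ) → ∀ {Γ} → Γ ⊩' φ
  eliminate [] h = h (λ _ → true) λ ()
  eliminate (a ∷ as) {φ} h = eliminate as λ v {Γ} d →
    ∨E' {φ = I a} {ψ = ¬' (I a)} (lamr (hypr here₀)) (lamr (h (update v a true) (decides-update d))) (lamr (h (update v a false) (decides-update d)))

  tautology : ∀ A → Tautology A → PA ⊢ I A
  tautology A t = get (eliminate (atoms A) {I A} (λ v d → subst (λ b → _ ⊩' signed b (I A)) (t v) (kalmar v A d)) {[]})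

-- Stagewise derivability

Mem : ∀ {n} → Term n → Term n → CF n
Mem u s = MEM ⟨ u ∷ s ∷ [] ⟩

-- s′ = s on [0, μ]
AGREE : Fm 3
AGREE = allB v2 (and (call MEM (v0 ∷ v1 ∷ []) ⊃ call MEM (v0 ∷ v2 ∷ [])) (call MEM (v0 ∷ v2 ∷ []) ⊃ call MEM (v0 ∷ v1 ∷ [])))

Agree : ∀ {n} (a b c : Term n) → CF n
Agree a b c = AGREE ⟨ a ∷ b ∷ c ∷ [] ⟩

-- s′ = s ∪ {k} on [0, μ]
ADJOIN : Fm 4
ADJOIN = allB v3 (and (call MEM (v0 ∷ v1 ∷ []) ⊃ or (call MEM (v0 ∷ v3 ∷ [])) (eq v0 v2))
                      (or (call MEM (v0 ∷ v3 ∷ [])) (eq v0 v2) ⊃ call MEM (v0 ∷ v1 ∷ [])))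

Adjoin : ∀ {n} (a b c d : Term n) → CF n
Adjoin a b c d = ADJOIN ⟨ a ∷ b ∷ c ∷ d ∷ [] ⟩

-- the codes ≤ w contain the empty set and are closed under adjunction, relative to [0, μ]
FULL : Fm 2
FULL = and (exB v1 (allB v1 (neg (call MEM (v0 ∷ v1 ∷ [])))))
           (allB v1 (allB v1 (exB v3 (call ADJOIN (v0 ∷ v1 ∷ v2 ∷ v3 ∷ [])))))

Full : ∀ {n} (a b : Term n) → CF n
Full a b = FULL ⟨ a ∷ b ∷ [] ⟩

-- s′ = s ∩ [0, n) on [0, μ]
INITIAL : Fm 4
INITIAL = allB v3 (and (call MEM (v0 ∷ v1 ∷ []) ⊃ and (call MEM (v0 ∷ v3 ∷ [])) (le (`S v0) v2))
                       (and (call MEM (v0 ∷ v3 ∷ [])) (le (`S v0) v2) ⊃ call MEM (v0 ∷ v1 ∷ [])))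

Initial : ∀ {n} (a b c d : Term n) → CF n
Initial a b c d = INITIAL ⟨ a ∷ b ∷ c ∷ d ∷ [] ⟩

module _ {n : ℕ} {Γ : Cxt n} where

  ADJOIN-use₁ : ∀ {s' k s μ i c} → Γ ⊩ Adjoin s' k s μ → Γ ⊩ Le i μ → Γ ⊩ Mem i s' →
                Mem i s ∷ Γ ⊩ c → Eq i k ∷ Γ ⊩ c → Γ ⊩ c
  ADJOIN-use₁ {s'} {k} {s} {μ} {i} a l m p q = ∨E (⊃E (∧E₁ (allBE a l)) (callI m))
    (weaken (lam (und p)) · callE h0) (weaken (lam (und q)) · eqE h0)

  ADJOIN-use₂ : ∀ {s' k s μ i} → Γ ⊩ Adjoin s' k s μ → Γ ⊩ Le i μ → Γ ⊩ Mem i s → Γ ⊩ Mem i s'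
  ADJOIN-use₂ a l m = callE (⊃E (∧E₂ (allBE a l)) (∨I₁ (callI m)))

  ADJOIN-use₃ : ∀ {s' k s μ i} → Γ ⊩ Adjoin s' k s μ → Γ ⊩ Le i μ → Γ ⊩ Eq i k → Γ ⊩ Mem i s'
  ADJOIN-use₃ a l m = callE (⊃E (∧E₂ (allBE a l)) (∨I₂ (eqI m)))

  AGREE-use₁ : ∀ {s' s μ i} → Γ ⊩ Agree s' s μ → Γ ⊩ Le i μ → Γ ⊩ Mem i s' → Γ ⊩ Mem i s
  AGREE-use₁ a l m = callE (⊃E (∧E₁ (allBE a l)) (callI m))

  AGREE-use₂ : ∀ {s' s μ i} → Γ ⊩ Agree s' s μ → Γ ⊩ Le i μ → Γ ⊩ Mem i s → Γ ⊩ Mem i s'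
  AGREE-use₂ a l m = callE (⊃E (∧E₂ (allBE a l)) (callI m))

  INITIAL-use₁ : ∀ {s' k s μ i} → Γ ⊩ Initial s' k s μ → Γ ⊩ Le i μ → Γ ⊩ Mem i s' → Γ ⊩ Mem i s
  INITIAL-use₁ a l m = callE (∧E₁ (⊃E (∧E₁ (allBE a l)) (callI m)))

  INITIAL-use₂ : ∀ {s' k s μ i} → Γ ⊩ Initial s' k s μ → Γ ⊩ Le i μ → Γ ⊩ Mem i s' → Γ ⊩ Le (`S i) k
  INITIAL-use₂ a l m = leE (∧E₂ (⊃E (∧E₁ (allBE a l)) (callI m)))

  INITIAL-use₃ : ∀ {s' k s μ i} → Γ ⊩ Initial s' k s μ → Γ ⊩ Le i μ → Γ ⊩ Mem i s → Γ ⊩ Le (`S i) k → Γ ⊩ Mem i s'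
  INITIAL-use₃ a l m q = callE (⊃E (∧E₂ (allBE a l)) (∧I (callI m) (leI q)))

  INITIAL-intro : ∀ {s' k s μ} →
    Mem v0 (wkT s') ∷ Le v0 (wkT μ) ∷ wkΓ Γ ⊩ Mem v0 (wkT s) →
    Mem v0 (wkT s') ∷ Le v0 (wkT μ) ∷ wkΓ Γ ⊩ Le (`S v0) (wkT k) →
    Le (`S v0) (wkT k) ∷ Mem v0 (wkT s) ∷ Le v0 (wkT μ) ∷ wkΓ Γ ⊩ Mem v0 (wkT s') →
    Γ ⊩ Initial s' k s μ
  INITIAL-intro p q r = allBI (∧I
    (⊃I (∧I (callI (weaken (lam (und p)) · callE h0)) (leI (weaken (lam (und q)) · callE h0))))
    (⊃I (callI (app (weaken (lam (lam (und r)))) (und (callE (∧E₁ h0))) · leE (∧E₂ h0)))))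

-- FULL allows every set to be restricted to [0, μ] below w: adjoin its elements one by one.

INITIALS : Fm 4
INITIALS = exB v2 (call INITIAL (v0 ∷ v1 ∷ v4 ∷ v2 ∷ []))

Initials : ∀ {n} (a b c d : Term n) → CF n
Initials a b c d = INITIALS ⟨ a ∷ b ∷ c ∷ d ∷ [] ⟩

module _ {n : ℕ} {Γ : Cxt n} {μ w s : Term n} (full : Γ ⊩ Full μ w) where

  initials-base : Γ ⊩ Initials `0 μ w s
  initials-base = exBE (∧E₁ full) (exBI v0 h1 (callI (INITIAL-intro
    (efq (negE (allBE h2 h1) (callI h0)))
    (efq (negE (allBE h2 h1) (callI h0)))
    (efq (S≰0 h0)))))

module _ {n : ℕ} {Γ : Cxt n} {μ w s k : Term n} (full : Γ ⊩ Full μ w) where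

  initials-step : Γ ⊩ Initials k μ w s → Γ ⊩ Initials (`S k) μ w s
  initials-step ih = cut full (exBE (up ih) (cut (callE h0) (cases {σ = wkT k ∷ wkT s ∷ []} (call MEM (v0 ∷ v1 ∷ []))
    (le-cases (wkT k) (wkT μ)
      (exBE (allBE (allBE (∧E₂ h5) h4) h0) (exBI v0 h1
        (cut (callE h0) (callI (INITIAL-intro
          (ADJOIN-use₁ h2 h1 h0 (INITIAL-use₁ h8 h2 h0) (callE (Leib (call MEM (v0 ∷ v1 ∷ [])) (sym⊩ h0) h7)))
          (ADJOIN-use₁ h2 h1 h0 (leTrans (INITIAL-use₂ h8 h2 h0) le-S) (le-SS (le-eq h0)))
          (le-split h0
            (ADJOIN-use₃ h4 h3 (S-inj h0))
            (ADJOIN-use₂ h4 h3 (INITIAL-use₃ h9 h3 h2 (le-SS⁻ h0)))))))))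
      -- Here k exceeds μ; sets are compared on [0, μ] only, so the old set still serves.
      (exBI v0 h4 (callI (INITIAL-intro
        (INITIAL-use₁ h4 h1 h0)
        (leTrans (INITIAL-use₂ h4 h1 h0) le-S)
        (le-split h0
          (efq (S≰ (leTrans h4 (leTrans (le-eq (sym⊩ (S-inj h0))) h3))))
          (INITIAL-use₃ h6 h3 h2 (le-SS⁻ h0)))))))
    (exBI v0 h3 (callI (INITIAL-intro
      (INITIAL-use₁ h3 h1 h0)
      (leTrans (INITIAL-use₂ h3 h1 h0) le-S)
      (le-split h0
        (efq (negE h4 (Leib (call MEM (v0 ∷ v1 ∷ [])) (S-inj h0) (callI h2))))
        (INITIAL-use₃ h5 h3 h2 (le-SS⁻ h0)))))))))

INITIAL-AGREE : ∀ {n} {Γ : Cxt n} {s' s μ} → Γ ⊩ Initial s' (`S μ) s μ → Γ ⊩ Agree s' s μ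
INITIAL-AGREE p = cut p (allBI (∧I (⊃I (callI (INITIAL-use₁ h2 h1 (callE h0))))
                                   (⊃I (callI (INITIAL-use₃ h2 h1 (callE h0) (le-SS h1))))))

module _ {n : ℕ} {Γ : Cxt n} {μ w s : Term n} (full : Γ ⊩ Full μ w) where

  -- The induction on the length of the initial segment stays bounded because the sets range below
  -- w. It replaces a theory of set codes inside PA: `FULL` is a hypothesis here, and `FULL-width`
  -- supplies its true instances.
  restrict : ∀ {c} → Agree v0 (wkT s) (wkT μ) ∷ Le v0 (wkT w) ∷ wkΓ Γ ⊩ wkC c → Γ ⊩ c
  restrict d = exBE (ind {σ = μ ∷ w ∷ s ∷ []} INITIALS (initials-base full) (initials-step (up (upW full)) h0) {`S μ})
    (app (weaken (weaken (lam (lam (und d))))) (und h1) · INITIAL-AGREE (callE h0))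

IMP : Fm 3
IMP = exB v2 (and (call PAIR (v1 ∷ v2 ∷ v0 ∷ [])) (call PAIR (`S (`S `0) ∷ v0 ∷ v3 ∷ [])))

Imp : ∀ {n} (a b c : Term n) → CF n
Imp a b c = IMP ⟨ a ∷ b ∷ c ∷ [] ⟩

-- s is closed under modus ponens for codes ≤ μ
CLOSED : Fm 2
CLOSED = allB v1 (allB v0 (allB v1 (call IMP (v1 ∷ v0 ∷ v2 ∷ []) ⊃ call MEM (v2 ∷ v3 ∷ []) ⊃ call MEM (v1 ∷ v3 ∷ []) ⊃ call MEM (v0 ∷ v3 ∷ []))))

Closed : ∀ {n} (a b : Term n) → CF n
Closed a b = CLOSED ⟨ a ∷ b ∷ [] ⟩

module _ {n : ℕ} {Γ : Cxt n} where

  CLOSED-use : ∀ {s μ a b c} → Γ ⊩ Closed s μ → Γ ⊩ Imp a b c → Γ ⊩ Le c μ → Γ ⊩ Le a c → Γ ⊩ Le b c →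
               Γ ⊩ Mem c s → Γ ⊩ Mem a s → Γ ⊩ Mem b s
  CLOSED-use cl i c≤ a≤ b≤ p q = callE (⊃E (⊃E (⊃E (allBE (allBE (allBE cl c≤) a≤) b≤) (callI i)) (callI p)) (callI q))

module _ {n : ℕ} {Γ : Cxt n} where

  CLOSED-restrict : ∀ {s s' μ μ'} → Γ ⊩ Closed s μ → Γ ⊩ Agree s' s μ' → Γ ⊩ Le μ' μ → Γ ⊩ Closed s' μ'
  CLOSED-restrict cl ag l = cut cl (cut (up ag) (cut (up (up l)) (allBI (allBI (allBI (⊃I (⊃I (⊃I (callI
    (AGREE-use₂ h7 (leTrans h3 h5)
      (CLOSED-use h8 (callE h2) (leTrans h5 h6) h4 h3
        (AGREE-use₁ h7 h5 (callE h1)) (AGREE-use₁ h7 (leTrans h4 h5) (callE h0)))))))))))))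

module Stages (LISTED : Fm 4) where

  LIST : Fm 4
  LIST = exB v3 (or (call LISTED (v1 ∷ `0 ∷ v3 ∷ v0 ∷ [])) (call LISTED (v1 ∷ v2 ∷ v3 ∷ v0 ∷ [])))

  Lst : ∀ {n} (a b c d : Term n) → CF n
  Lst a b c d = LIST ⟨ a ∷ b ∷ c ∷ d ∷ [] ⟩

  -- arguments e, j, y, μ, s: everything ≤ μ listed under j up to stage y is in s
  CONTAINS : Fm 5
  CONTAINS = allB v3 (call LIST (v1 ∷ v2 ∷ v0 ∷ v3 ∷ []) ⊃ call MEM (v0 ∷ v5 ∷ []))

  Contains : ∀ {n} (a b c d e : Term n) → CF n
  Contains a b c d e = CONTAINS ⟨ a ∷ b ∷ c ∷ d ∷ e ∷ [] ⟩

  FORCED : Fm 6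
  FORCED = allB v5 (call CLOSED (v0 ∷ v5 ∷ []) ⊃ call CONTAINS (v1 ∷ v2 ∷ v4 ∷ v5 ∷ v0 ∷ []) ⊃ call MEM (v3 ∷ v0 ∷ []))

  Forced : ∀ {n} (a b c d e f : Term n) → CF n
  Forced a b c d e f = FORCED ⟨ a ∷ b ∷ c ∷ d ∷ e ∷ f ∷ [] ⟩

  -- arguments e, j, x, y, μ, w
  DERIVES : Fm 6
  DERIVES = and (le (`S v4) v3) (and (le v5 v3) (and (call FULL (v4 ∷ v5 ∷ [])) (and (le v2 v4) (call FORCED (v0 ∷ v1 ∷ v2 ∷ v3 ∷ v4 ∷ v5 ∷ [])))))

  Derives : ∀ {n} (a b c d e f : Term n) → CF n
  Derives a b c d e f = DERIVES ⟨ a ∷ b ∷ c ∷ d ∷ e ∷ f ∷ [] ⟩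

  opaque
    -- arguments e, j, x, y: x is derived at stage y from what is listed under j
    P : Fm 4
    P = exB v3 (exB v4 (call DERIVES (v2 ∷ v3 ∷ v4 ∷ v5 ∷ v1 ∷ v0 ∷ [])))

  Der : ∀ {n} (a b c d : Term n) → CF n
  Der a b c d = P ⟨ a ∷ b ∷ c ∷ d ∷ [] ⟩

  LIST-mono : ∀ {n} {Γ : Cxt n} {e j z y y'} → Γ ⊩ Lst e j z y → Γ ⊩ Le y y' → Γ ⊩ Lst e j z y'
  LIST-mono p l = cut l (exBE (up p) (exBI v0 (leTrans h1 h2) (∨E h0 (∨I₁ (callI (callE h0))) (∨I₂ (callI (callE h0))))))

  LIST-zero : ∀ {n} {Γ : Cxt n} {e j z y} → Γ ⊩ Lst e `0 z y → Γ ⊩ Lst e j z y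
  LIST-zero p = exBE p (exBI v0 h1 (∨E h0 (∨I₁ (callI (callE h0))) (∨I₁ (callI (callE h0)))))

  module _ {n : ℕ} {Γ : Cxt n} where

    CONTAINS-use : ∀ {e j y μ s z} → Γ ⊩ Contains e j y μ s → Γ ⊩ Le z μ → Γ ⊩ Lst e j z y → Γ ⊩ Mem z s
    CONTAINS-use c l p = callE (⊃E (allBE c l) (callI p))

    CONTAINS-intro : ∀ {e j y μ s} → Lst (wkT e) (wkT j) v0 (wkT y) ∷ Le v0 (wkT μ) ∷ wkΓ Γ ⊩ Mem v0 (wkT s) →
                     Γ ⊩ Contains e j y μ s
    CONTAINS-intro d = allBI (⊃I (callI (weaken (lam (und d)) · callE h0)))

    FORCED-use : ∀ {e j x y μ w s} → Γ ⊩ Forced e j x y μ w → Γ ⊩ Le s w → Γ ⊩ Closed s μ →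
                 Γ ⊩ Contains e j y μ s → Γ ⊩ Mem x s
    FORCED-use f l c d = callE (⊃E (⊃E (allBE f l) (callI c)) (callI d))

    FORCED-intro : ∀ {e j x y μ w} → Contains (wkT e) (wkT j) (wkT y) (wkT μ) v0 ∷ Closed v0 (wkT μ) ∷ Le v0 (wkT w) ∷ wkΓ Γ ⊩ Mem (wkT x) v0 →
                   Γ ⊩ Forced e j x y μ w
    FORCED-intro d = allBI (⊃I (⊃I (callI (app (weaken (weaken (lam (lam (und d))))) (und (callE h1)) · callE h0))))

    module _ {e j x y μ w : Term n} (d : Γ ⊩ Derives e j x y μ w) where
      DERIVES-μ : Γ ⊩ Le (`S μ) y
      DERIVES-μ = leE (∧E₁ d)
      DERIVES-w : Γ ⊩ Le w y
      DERIVES-w = leE (∧E₁ (∧E₂ d))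
      DERIVES-full : Γ ⊩ Full μ w
      DERIVES-full = callE (∧E₁ (∧E₂ (∧E₂ d)))
      DERIVES-x : Γ ⊩ Le x μ
      DERIVES-x = leE (∧E₁ (∧E₂ (∧E₂ (∧E₂ d))))
      DERIVES-forced : Γ ⊩ Forced e j x y μ w
      DERIVES-forced = callE (∧E₂ (∧E₂ (∧E₂ (∧E₂ d))))

    DERIVES-intro : ∀ {e j x y μ w} → Γ ⊩ Le (`S μ) y → Γ ⊩ Le w y → Γ ⊩ Full μ w → Γ ⊩ Le x μ →
                    Γ ⊩ Forced e j x y μ w → Γ ⊩ Derives e j x y μ w
    DERIVES-intro p q r s t = ∧I (leI p) (∧I (leI q) (∧I (callI r) (∧I (leI s) (callI t))))

    opaque
      unfolding P

      P-use : ∀ {e j x y c} → Γ ⊩ Der e j x y →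
              Derives (wkT (wkT e)) (wkT (wkT j)) (wkT (wkT x)) (wkT (wkT y)) v1 v0 ∷ wkΓ (wkΓ Γ) ⊩ wkC (wkC c) → Γ ⊩ c
      P-use p d = exBE p (exBE h0 (weaken (weaken (weaken (weaken (lam (und d))))) · callE h0))

      P-intro : ∀ {e j x y μ w} → Γ ⊩ Derives e j x y μ w → Γ ⊩ Der e j x y
      P-intro {μ = μ} {w} d = exBI μ (leTrans le-S (DERIVES-μ d)) (exBI w (DERIVES-w d) (callI d))

  module _ {n : ℕ} {Γ : Cxt n} {e j x y μ w : Term n} where

    -- A set closed on a larger interval is first restricted to a code below w.
    DERIVES-member : ∀ {μ' s} → Γ ⊩ Derives e j x y μ w → Γ ⊩ Le μ μ' → Γ ⊩ Closed s μ' →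
                     Γ ⊩ Contains e j y μ' s → Γ ⊩ Mem x s
    DERIVES-member {s = s} d l c q = cut d (cut (up l) (cut (up (up c)) (cut (up (up (up q))) (restrict {s = s} (DERIVES-full h3)
      (AGREE-use₁ h0 (DERIVES-x h5) (FORCED-use (DERIVES-forced h5) h1 (CLOSED-restrict h3 h0 h4)
        (CONTAINS-intro (AGREE-use₂ h2 h1 (CONTAINS-use h4 (leTrans h1 h6) h0)))))))))

    -- A later stage lists more, so a set containing all of that contains what the earlier stage
    -- lists; μ and w need not change.
    DERIVES-mono : ∀ {y'} → Γ ⊩ Derives e j x y μ w → Γ ⊩ Le y y' → Γ ⊩ Derives e j x y' μ w
    DERIVES-mono d l = DERIVES-intro (leTrans (DERIVES-μ d) l) (leTrans (DERIVES-w d) l) (DERIVES-full d) (DERIVES-x d)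
      (cut d (cut (up l) (FORCED-intro (FORCED-use (DERIVES-forced h4) h2 h1
        (CONTAINS-intro (CONTAINS-use h2 h1 (LIST-mono h0 h5)))))))

    DERIVES-zero : ∀ {j'} → Γ ⊩ Derives e `0 x y μ w → Γ ⊩ Derives e j' x y μ w
    DERIVES-zero d = DERIVES-intro (DERIVES-μ d) (DERIVES-w d) (DERIVES-full d) (DERIVES-x d)
      (cut d (FORCED-intro (FORCED-use (DERIVES-forced h3) h2 h1
        (CONTAINS-intro (CONTAINS-use h2 h1 (LIST-zero h0))))))

  module _ {n : ℕ} {Γ : Cxt n} {e j : Term n} where

    P-mono : ∀ {x y y'} → Γ ⊩ Der e j x y → Γ ⊩ Le y y' → Γ ⊩ Der e j x y'
    P-mono p l = cut l (P-use (up p) (P-intro (DERIVES-mono h0 h1)))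

    P-zero : ∀ {x y} → Γ ⊩ Der e `0 x y → Γ ⊩ Der e j x y
    P-zero p = P-use p (P-intro (DERIVES-zero {j = `0} h0))

  module _ {n : ℕ} {Γ : Cxt n} {e j a b c y μ' w' : Term n} where

    DERIVES-mp : Γ ⊩ Imp a b c → Γ ⊩ Le a c → Γ ⊩ Le b c → Γ ⊩ Le c μ' → Γ ⊩ Le b μ' →
      Γ ⊩ Le (`S μ') y → Γ ⊩ Le w' y → Γ ⊩ Full μ' w' →
      Contains (wkT e) (wkT j) (wkT y) (wkT μ') v0 ∷ Closed v0 (wkT μ') ∷ wkΓ Γ ⊩ Mem (wkT c) v0 →
      Contains (wkT e) (wkT j) (wkT y) (wkT μ') v0 ∷ Closed v0 (wkT μ') ∷ wkΓ Γ ⊩ Mem (wkT a) v0 →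
      Γ ⊩ Der e j b y
    DERIVES-mp i a≤ b≤ c≤ b≤μ q r f p₁ p₂ = P-intro (DERIVES-intro q r f b≤μ (cut i (cut (up a≤) (cut (up (up b≤)) (cut (up (up (up c≤)))
      (FORCED-intro (CLOSED-use h1 h6 h3 h5 h4
        (apply p₁) (apply p₂))))))))
      where
      apply : ∀ {x a b c d k l m} → l ∷ m ∷ wkΓ Γ ⊩ x → l ∷ m ∷ k ∷ a ∷ b ∷ c ∷ d ∷ wkΓ Γ ⊩ x
      apply p = app (weaken (weaken (weaken (weaken (weaken (weaken (weaken (lam (lam (und p)))))))))) (und h1) · h0

  -- The larger of the two intervals serves for the conclusion, with its own w; `DERIVES-member`
  -- adapts the other premise. The bounds on a and b are hypotheses because `CLOSED` quantifies
  -- below c; for numerals they are simply true.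
  P-mp : ∀ {n} {Γ : Cxt n} {e j a b c y} → Γ ⊩ Imp a b c → Γ ⊩ Le a c → Γ ⊩ Le b c →
         Γ ⊩ Der e j c y → Γ ⊩ Der e j a y → Γ ⊩ Der e j b y
  P-mp i a≤ b≤ p q = cut i (cut (up a≤) (cut (up (up b≤)) (cut (up (up (up q))) (P-use (up (up (up (up p)))) (P-use h1
    (le-cases v3 v1
      (DERIVES-mp h6 h5 h4 (leTrans (DERIVES-x h2) h0) (leTrans h4 (leTrans (DERIVES-x h2) h0)) (DERIVES-μ h1) (DERIVES-w h1) (DERIVES-full h1)
        (DERIVES-member h4 h2 h1 h0) (DERIVES-member h3 leRefl h1 h0))
      (DERIVES-mp h6 h5 h4 (DERIVES-x h2) (leTrans h4 (DERIVES-x h2)) (DERIVES-μ h2) (DERIVES-w h2) (DERIVES-full h2)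
        (DERIVES-member h4 leRefl h1 h0) (DERIVES-member h3 (leTrans le-S h2) h1 h0))))))))

  -- arguments e, y: up to stage y no world is refuted (world i has index S i in P, and 0 is the code of ⊥')
  QUIET : Fm 2
  QUIET = allB v1 (allB v0 (neg (call P (v2 ∷ `S v0 ∷ `0 ∷ v1 ∷ []))))

  Quiet : ∀ {n} (a b : Term n) → CF n
  Quiet a b = QUIET ⟨ a ∷ b ∷ [] ⟩

  -- arguments e, i, y: i is the least world refuted at stage y
  TRIGGER : Fm 3
  TRIGGER = and (le v1 v2) (and (call P (v0 ∷ `S v1 ∷ `0 ∷ v2 ∷ []))
                (allB v1 (or (eq v0 v2) (neg (call P (v1 ∷ `S v0 ∷ `0 ∷ v3 ∷ []))))))

  Trigger : ∀ {n} (a b c : Term n) → CF n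
  Trigger a b c = TRIGGER ⟨ a ∷ b ∷ c ∷ [] ⟩

  -- arguments y, e, i
  FIRST : Fm 3
  FIRST = and (call QUIET (v1 ∷ v0 ∷ [])) (call TRIGGER (v1 ∷ v2 ∷ `S v0 ∷ []))

  First : ∀ {n} (a b c : Term n) → CF n
  First a b c = FIRST ⟨ a ∷ b ∷ c ∷ [] ⟩

  -- A world is pr n (pr v c): the elements ≤ n of v are its true variables, those of c its successors.
  FIELDS : Fm 4
  FIELDS = exB v0 (and (call PAIR (v2 ∷ v0 ∷ v1 ∷ [])) (call PAIR (v3 ∷ v4 ∷ v0 ∷ [])))

  ACC : Fm 2
  ACC = exB v0 (exB v1 (exB v2 (and (call FIELDS (v3 ∷ v2 ∷ v1 ∷ v0 ∷ [])) (and (le v4 v2) (call MEM (v4 ∷ v0 ∷ []))))))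

  Acc : ∀ {n} (a b : Term n) → CF n
  Acc a b = ACC ⟨ a ∷ b ∷ [] ⟩

  VAL : Fm 2
  VAL = exB v1 (exB v2 (exB v3 (and (call FIELDS (v4 ∷ v2 ∷ v1 ∷ v0 ∷ [])) (and (le v3 v2) (call MEM (v3 ∷ v1 ∷ []))))))

  -- arguments e, i, x, y
  BOX : Fm 4
  BOX = allB v1 (call ACC (v2 ∷ v0 ∷ []) ⊃ call P (v1 ∷ `S v0 ∷ v3 ∷ v4 ∷ []))

  Box : ∀ {n} (a b c d : Term n) → CF n
  Box a b c d = BOX ⟨ a ∷ b ∷ c ∷ d ∷ [] ⟩

  -- arguments y, e, x
  PRB : Fm 3
  PRB = and (call QUIET (v1 ∷ v0 ∷ []))
    (or (call P (v1 ∷ `0 ∷ v2 ∷ v0 ∷ [])) (exB (`S v0) (and (call TRIGGER (v2 ∷ v0 ∷ `S v1 ∷ [])) (call BOX (v2 ∷ v0 ∷ v3 ∷ v1 ∷ [])))))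

  Prb : ∀ {n} (a b c : Term n) → CF n
  Prb a b c = PRB ⟨ a ∷ b ∷ c ∷ [] ⟩

  -- Uniqueness of the first trigger, and provable distribution

  module _ {n : ℕ} {Γ : Cxt n} {e : Term n} where

    QUIET-use : ∀ {y y' j} → Γ ⊩ Quiet e y → Γ ⊩ Le y' y → Γ ⊩ Le j y' → Γ ⊩ Der e (`S j) `0 y' → Γ ⊩ Bot
    QUIET-use q l k p = negE (allBE (allBE q l) k) (callI p)

    TRIGGER-le : ∀ {i y} → Γ ⊩ Trigger e i y → Γ ⊩ Le i y
    TRIGGER-le t = leE (∧E₁ t)

    TRIGGER-P : ∀ {i y} → Γ ⊩ Trigger e i y → Γ ⊩ Der e (`S i) `0 y
    TRIGGER-P t = callE (∧E₁ (∧E₂ t))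

    TRIGGER-least : ∀ {i i' y} → Γ ⊩ Trigger e i y → Γ ⊩ Le i' i → Γ ⊩ Der e (`S i') `0 y → Γ ⊩ Eq i' i
    TRIGGER-least t l p = ∨E (allBE (∧E₂ (∧E₂ t)) l) (eqE h0) (efq (negE h0 (callI (up p))))

  module _ {n : ℕ} {Γ : Cxt n} {e : Term n} where

    QUIET-before : ∀ {y y' i} → Γ ⊩ Quiet e y → Γ ⊩ Trigger e i (`S y') → Γ ⊩ Le y y'
    QUIET-before {y} {y'} q t = le-cases y y' h0 (efq (QUIET-use (up q) h0 (TRIGGER-le (up t)) (TRIGGER-P (up t))))

    TRIGGER-unique : ∀ {i i' y} → Γ ⊩ Trigger e i y → Γ ⊩ Trigger e i' y → Γ ⊩ Eq i i'
    TRIGGER-unique {i} {i'} t t' = le-cases i i' (TRIGGER-least (up t') h0 (TRIGGER-P (up t)))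
      (sym⊩ (TRIGGER-least (up t) (leTrans le-S h0) (TRIGGER-P (up t'))))

  module _ {n : ℕ} {Γ : Cxt n} {e : Term n} where

    FIRST-unique : ∀ {y y' i i'} → Γ ⊩ Quiet e y → Γ ⊩ Trigger e i (`S y) →
                   Γ ⊩ Quiet e y' → Γ ⊩ Trigger e i' (`S y') → Γ ⊩ Eq y y'
    FIRST-unique q t q' t' = leAntisym (QUIET-before q t') (QUIET-before q' t)

    TRIGGER-y : ∀ {y y' i} → Γ ⊩ Eq y y' → Γ ⊩ Trigger e i (`S y) → Γ ⊩ Trigger e i (`S y')
    TRIGGER-y {i = i} p t = callE (Leib {σ = e ∷ i ∷ []} (call TRIGGER (v1 ∷ v2 ∷ `S v0 ∷ [])) p (callI t))

    FIRST-world : ∀ {y y' i i'} → Γ ⊩ Quiet e y → Γ ⊩ Trigger e i (`S y) →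
                  Γ ⊩ Quiet e y' → Γ ⊩ Trigger e i' (`S y') → Γ ⊩ Eq i i'
    FIRST-world q t q' t' = TRIGGER-unique (TRIGGER-y (FIRST-unique q t q' t') t) t'

    BOX-use : ∀ {i x y j} → Γ ⊩ Box e i x y → Γ ⊩ Le j i → Γ ⊩ Acc i j → Γ ⊩ Der e (`S j) x y
    BOX-use b l a = callE (⊃E (allBE b l) (callI a))

    BOX-i : ∀ {i i' x y} → Γ ⊩ Eq i i' → Γ ⊩ Box e i x y → Γ ⊩ Box e i' x y
    BOX-i {x = x} {y} p t = callE (Leib {σ = e ∷ x ∷ y ∷ []} (call BOX (v1 ∷ v0 ∷ v2 ∷ v3 ∷ [])) p (callI t))

    BOX-y : ∀ {i x y y'} → Γ ⊩ Eq y y' → Γ ⊩ Box e i x y → Γ ⊩ Box e i x y'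
    BOX-y {i} {x} p t = callE (Leib {σ = e ∷ i ∷ x ∷ []} (call BOX (v1 ∷ v2 ∷ v3 ∷ v0 ∷ [])) p (callI t))

    BOX-zero : ∀ {i x y} → Γ ⊩ Der e `0 x y → Γ ⊩ Box e i x y
    BOX-zero p = cut p (allBI (⊃I (callI (P-zero h2))))

    BOX-mp : ∀ {i y a b c} → Γ ⊩ Imp a b c → Γ ⊩ Le a c → Γ ⊩ Le b c →
             Γ ⊩ Box e i c y → Γ ⊩ Box e i a y → Γ ⊩ Box e i b y
    BOX-mp m a≤ b≤ p q = cut m (cut (up a≤) (cut (up (up b≤)) (cut (up (up (up p))) (cut (up (up (up (up q))))
      (allBI (⊃I (callI (P-mp h6 h5 h4 (callE (⊃E (allBE h3 h1) (callI (callE h0)))) (callE (⊃E (allBE h2 h1) (callI (callE h0))))))))))))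

    PRB-intro₁ : ∀ {x y} → Γ ⊩ Quiet e y → Γ ⊩ Der e `0 x y → Γ ⊩ Prb y e x
    PRB-intro₁ q p = ∧I (callI q) (∨I₁ (callI p))

    PRB-intro₂ : ∀ {x y i} → Γ ⊩ Quiet e y → Γ ⊩ Trigger e i (`S y) → Γ ⊩ Box e i x y → Γ ⊩ Prb y e x
    PRB-intro₂ {i = i} q t b = ∧I (callI q) (∨I₂ (exBI i (TRIGGER-le t) (∧I (callI t) (callI b))))

    PRB-quiet : ∀ {x y} → Γ ⊩ Prb y e x → Γ ⊩ Quiet e y
    PRB-quiet p = callE (∧E₁ p)

    PRB-cases : ∀ {x y c} → Γ ⊩ Prb y e x → Der e `0 x y ∷ Γ ⊩ c →
      Box (wkT e) v0 (wkT x) (wkT y) ∷ Trigger (wkT e) v0 (`S (wkT y)) ∷ wkΓ Γ ⊩ wkC c → Γ ⊩ c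
    PRB-cases p d f = ∨E (∧E₂ p) (weaken (lam (und d)) · callE h0)
      (exBE h0 (app (weaken (weaken (weaken (lam (lam (und f)))))) (und (callE (∧E₁ h0))) · callE (∧E₂ h0)))

  Prov : ∀ {n} → Term n → Term n → CF n
  Prov e x = exC PRB (e ∷ x ∷ [])

  -- Two derivations from T meet at the later of their stages, which is quiet. If a trigger is
  -- involved, a quiet stage of the other premise is no later than the stage before it, so a
  -- derivation from T counts at each successor by `BOX-zero`. Two boxes refer to the same trigger.
  Prov-mp : ∀ {n} {Γ : Cxt n} {e a b c} → Γ ⊩ Imp a b c → Γ ⊩ Le a c → Γ ⊩ Le b c →
            Γ ⊩ Prov e c → Γ ⊩ Prov e a → Γ ⊩ Prov e b
  Prov-mp m a≤ b≤ p q = cut m (cut (up a≤) (cut (up (up b≤)) (cut (up (up (up q))) (exE (up (up (up (up p)))) (exE h1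
    (PRB-cases h1
      (PRB-cases h1
        (le-cases v1 v0
          (exI v0 (PRB-intro₁ (PRB-quiet h3) (P-mp h8 h7 h6 (P-mono h2 h0) h1)))
          (exI v1 (PRB-intro₁ (PRB-quiet h4) (P-mp h8 h7 h6 h2 (P-mono h1 (leTrans le-S h0))))))
        (exI v1 (PRB-intro₂ (PRB-quiet h3) h1 (BOX-mp h8 h7 h6 (BOX-zero (P-mono h2 (QUIET-before (PRB-quiet h4) h1))) h0))))
      (PRB-cases h2
        (exI v2 (PRB-intro₂ (PRB-quiet h4) h2 (BOX-mp h8 h7 h6 h1 (BOX-zero (P-mono h0 (QUIET-before (PRB-quiet h3) h2))))))
        (exI v3 (PRB-intro₂ (PRB-quiet h5) h3 (BOX-mp h9 h8 h7 h2
          (BOX-i (FIRST-world (PRB-quiet h4) h1 (PRB-quiet h5) h3) (BOX-y (FIRST-unique (PRB-quiet h4) h1 (PRB-quiet h5) h3) h0)))))))))))) 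

-- Provability up to codes, finite closures and sets in the metatheory

opaque
  ⟦_⟧? : ∀ {m} (φ : Fm m) ρ → Dec (⟦ φ ⟧ ρ)
  ⟦ φ ⟧? ρ with decided φ ρ
  ... | holds p _ = yes p
  ... | fails p _ = no p

module Levels (S : Theory) where

  raise : ∀ {m n} → m ≤ n → Formula m → Formula n
  raise p = fsub (λ i → var (inject≤ i p))

  cd-raise : ∀ {m n} (p : m ≤ n) φ → cd (raise p φ) ≡ cd φ
  cd-raise p = cd-fsub λ i → inject≤ i p , refl , toℕ-inject≤ i p

  lower : ∀ {n} k (φ : Formula n) → S ⊢ fsub (λ i → var (i ↑ˡ k)) φ → S ⊢ φ
  lower {n} k φ d = subst (S ⊢_) (trans (fsub-fsub σ _ φ) (fsub-id (λ i → cong [ var , const `0 ]′ (splitAt-↑ˡ n i k)) φ)) (⊢-sub d σ)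
    where
    σ : Fin (n + k) → Term n
    σ i = [ var , const `0 ]′ (splitAt n i)

  -- A code does not determine the number of free variables of the context. Both formulas are moved
  -- to the common context n + m, where `cd-inj` identifies them; substituting 0 for the surplus
  -- variables leads back.
  ⊢-code : ∀ {m n} (φ : Formula m) (ψ : Formula n) → cd φ ≡ cd ψ → S ⊢ φ → S ⊢ ψ
  ⊢-code {m} {n} φ ψ p d = lower m ψ (subst (S ⊢_)
    (cd-inj _ _ (trans (cd-raise (m≤n+m m n) φ) (trans p (sym (cd-fsub (λ i → i ↑ˡ m , refl , toℕ-↑ˡ i m) ψ)))))
    (⊢-sub d (λ i → var (inject≤ i (m≤n+m m n)))))

  Prv : ℕ → Set
  Prv x = ∃ λ n → Σ (Formula n) λ φ → cd φ ≡ x × (S ⊢ φ)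

  Prv-mp : ∀ {a b} → Prv (cdImp a b) → Prv a → Prv b
  Prv-mp (m , φ , p , d) (n , ψ , q , d') with pr-inj p
  Prv-mp (m , (ψ' ⇒ ξ) , p , d) (n , ψ , q , d') | refl , r =
    m , ξ , proj₂ (pr-inj r) , mp d (⊢-code ψ ψ' (trans q (sym (proj₁ (pr-inj r)))) d')

module Closure (Good : ℕ → Set) (good-mp : ∀ {a b} → Good (cdImp a b) → Good a → Good b) where

  Detaches : List ℕ → ℕ → Set
  Detaches L b = Any (λ c → Any (λ a → c ≡ cdImp a b) L) L

  detaches? : ∀ L b → Dec (Detaches L b)
  detaches? L b = any? (λ c → any? (λ a → c ℕₚ.≟ cdImp a b) L) L

  detaches : ∀ {L a b} → cdImp a b ∈ L → a ∈ L → Detaches L b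
  detaches {L} {a} {b} m m' = Any.map (λ { refl → Any.map (λ { refl → refl }) m' }) m

  detaches-good : ∀ {L b} → (∀ {x} → x ∈ L → Good x) → Detaches L b → Good b
  detaches-good {L} {b} g d with find d
  ... | c , m , d' with find d'
  ... | a , m' , refl = good-mp (g m) (g m')

  sift : ∀ L R → (∀ {b} → b ∈ R → ¬ Detaches L b) ⊎
    (∃₂ λ b R' → b ∈ R × Detaches L b × suc (length R') ≡ length R × (∀ {x} → x ∈ R → x ≡ b ⊎ x ∈ R') × (∀ {x} → x ∈ R' → x ∈ R))
  sift L [] = inj₁ λ ()
  sift L (b ∷ R) with detaches? L b | sift L R
  ... | yes d | _ = inj₂ (b , R , here refl , d , refl , (λ { (here p) → inj₁ p ; (there m) → inj₂ m }) , there)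
  ... | no d | inj₁ h = inj₁ λ { (here refl) → d ; (there m) → h m }
  ... | no d | inj₂ (c , R' , m , e , p , f , g) = inj₂ (c , b ∷ R' , there m , e , cong suc p ,
    (λ { (here q) → inj₂ (here q) ; (there m) → [ inj₁ , inj₂ ∘ there ]′ (f m) }) , (λ { (here q) → here q ; (there m) → there (g m) }))

  -- `Good` will be provability, which is not decidable, so the good numbers below a bound cannot be
  -- collected into a code. Closing a finite list of good numbers under detachment is a finite
  -- search, with k bounding the remaining candidates, and gives a closed list of good numbers.
  closure : ∀ k L R → length R ≤ k → (∀ {x} → x ∈ L → Good x) →
    ∃ λ L' → (∀ {x} → x ∈ L → x ∈ L') × (∀ {x} → x ∈ L' → Good x) × (∀ {x} → x ∈ L' → x ∈ L ⊎ x ∈ R) ×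
      (∀ {a b} → cdImp a b ∈ L' → a ∈ L' → b ∈ L ⊎ b ∈ R → b ∈ L')
  closure k L R R≤ g with sift L R
  ... | inj₁ h = L , id , g , inj₁ , λ m m' → [ id , (λ r → ⊥-elim (h r (detaches m m'))) ]′
  closure zero L R R≤ g | inj₂ (b , R' , m , d , p , _) with trans p (ℕₚ.n≤0⇒n≡0 R≤)
  ... | ()
  closure (suc k) L R R≤ g | inj₂ (b , R' , m , d , p , f , f') with closure k (b ∷ L) R' (s≤s⁻¹ (≤-trans (≤-reflexive p) R≤))
                                                                     (λ { (here refl) → detaches-good g d ; (there m) → g m })
  ... | L' , sub , g' , src , cl = L' , sub ∘ there , g' ,
    (λ m' → [ (λ { (here refl) → inj₂ m ; (there l) → inj₁ l }) , inj₂ ∘ f' ]′ (src m')) ,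
    λ q q' → cl q q' ∘ [ inj₁ ∘ there , (λ r → [ (λ { refl → inj₁ (here refl) }) , inj₂ ]′ (f r)) ]′

sublists : List ℕ → List (List ℕ)
sublists [] = [] ∷ []
sublists (x ∷ l) = mapL (x ∷_) (sublists l) ++ᴸ sublists l

filter-sublist : ∀ {Q : ℕ → Set} (q : ∀ x → Dec (Q x)) l → filter q l ∈ sublists l
filter-sublist q [] = here refl
filter-sublist q (x ∷ l) with does (q x)
... | true = ∈-++⁺ˡ (∈-map⁺ (x ∷_) (filter-sublist q l))
... | false = ∈-++⁺ʳ (mapL (x ∷_) (sublists l)) (filter-sublist q l)

module _ (μ : ℕ) where

  width : ℕ
  width = maximum (mapL (λ L → listCode L μ) (sublists (upTo (suc μ))))

  subset : ∀ {Q : ℕ → Set} (q : ∀ x → Dec (Q x)) → ∃ λ s → s ≤ width × (∀ i → i ≤ μ → (i ∈ᶜ s → Q i) × (Q i → i ∈ᶜ s))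
  subset {Q} q = listCode L μ , maximum-≥ (∈-map⁺ (λ L → listCode L μ) (filter-sublist q (upTo (suc μ)))) ,
    λ i i≤ → (λ m → proj₂ (∈-filter⁻ q {xs = upTo (suc μ)} (listCode-∌ L μ i i≤ m))) ,
             (λ h → listCode-∋ L μ i i≤ (∈-filter⁺ q (∈-upTo⁺ (s≤s i≤)) h))
    where L = filter q (upTo (suc μ))

  FULL-width : ⟦ FULL ⟧ (μ ∷ width ∷ [])
  FULL-width = (let s , s≤ , h = subset {λ _ → ⊥} (λ _ → no id) in s , s≤ , λ i i≤ → proj₁ (h i i≤)) ,
    λ s _ k _ → let s' , s'≤ , h = subset (λ i → ⟦ MEM ⟧? (i ∷ s ∷ []) ⊎-dec (i ℕₚ.≟ k)) in s' , s'≤ , λ i i≤ → h i i≤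

-- Nothing but `FULL` is known of w here, which may differ from `width μ`; the code is reached by
-- repeated adjunction.
FULL-list : ∀ {μ w} → ⟦ FULL ⟧ (μ ∷ w ∷ []) → ∀ L → (∀ {x} → x ∈ L → x ≤ μ) →
            ∃ λ s → s ≤ w × (∀ i → i ≤ μ → (i ∈ᶜ s → i ∈ L) × (i ∈ L → i ∈ᶜ s))
FULL-list ((s , s≤ , h) , _) [] b = s , s≤ , λ i i≤ → (λ m → ⊥-elim (h i i≤ m)) , λ ()
FULL-list full@(_ , adj) (k ∷ L) b with FULL-list full L (b ∘ there)
... | s , s≤ , h with adj s s≤ k (b (here refl))
... | s' , s'≤ , h' = s' , s'≤ , λ i i≤ →
  (λ m → [ there ∘ proj₁ (h i i≤) , here ]′ (proj₁ (h' i i≤) m)) ,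
  (λ { (here p) → proj₂ (h' i i≤) (inj₂ p) ; (there m) → proj₂ (h' i i≤) (inj₁ (proj₂ (h i i≤) m)) })

IMP-elim : ∀ a b c → ⟦ IMP ⟧ (a ∷ b ∷ c ∷ []) → c ≡ cdImp a b
IMP-elim a b c (d , _ , p , q) = trans (PAIR-elim 2 d c q) (cong (pr 2) (PAIR-elim a b d p))

IMP-intro : ∀ a b → ⟦ IMP ⟧ (a ∷ b ∷ cdImp a b ∷ [])
IMP-intro a b = pr a b , pr-≥ᵣ 2 (pr a b) , PAIR-intro a b refl , PAIR-intro 2 (pr a b) refl

-- n bounds all variables and successors, so both set codes are reliable on [0, n]. It also makes
-- every successor at most the code of the world, so that `BOX` may bound successors by i.
code : Tree → ℕ
codes : List Tree → List ℕ
code (node vs ts) = pr n (pr (listCode vs n) (listCode (codes ts) n))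
  where n = maximum (vs ++ᴸ codes ts)
codes [] = []
codes (t ∷ ts) = code t ∷ codes ts

codes-∈ : ∀ {t ts} → t ∈ ts → code t ∈ codes ts
codes-∈ (here refl) = here refl
codes-∈ (there m) = there (codes-∈ m)

codes-∈⁻ : ∀ {k} ts → k ∈ codes ts → ∃ λ t → t ∈ ts × code t ≡ k
codes-∈⁻ (t ∷ ts) (here refl) = t , here refl , refl
codes-∈⁻ (t ∷ ts) (there m) = let u , p , q = codes-∈⁻ ts m in u , there p , q

-- The sentences Λᵢ and the arithmetic of the construction

module Completeness (T : Theory) (χ : PR 1)
  (spec : ∀ m → (evalPR χ (m ∷ []) ≡ 0) ⟺ (Σ (Formula 0) λ φ → T φ × ⌜ φ ⌝ ≡ m))
  (consistent : Consistent T) (extends : ExtendsPA T) where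

  open Program T χ spec
  open Stages LISTED

  PA⇒T : ∀ {n} {φ : Formula n} → PA ⊢ φ → T ⊢ φ
  PA⇒T = ⊢-mono extends

  opaque
    -- Free in Θ are e and i, and it speaks of the sentences coded by `Λcode e j`. With its own code
    -- for e these are the Λⱼ themselves, which closes the diagonal without a general fixed point
    -- lemma.
    Θ : Formula 2
    Θ = ∃' ⌊ FIRST ⌋

    Θ≡ : Θ ≡ ∃' ⌊ FIRST ⌋
    Θ≡ = refl

    e₀ : ℕ
    e₀ = cd Θ

    e₀≡ : cd Θ ≡ e₀
    e₀≡ = refl

  Λ : ℕ → Formula 0
  Λ i = ∀' (∀' (var fz ≐ num e₀ ⇒ var (fs fz) ≐ num i ⇒ Θ))

  private
    cong₃ : ∀ {X Y Z W : Set} (f : X → Y → Z → W) {a b c a' b' c'} → a ≡ a' → b ≡ b' → c ≡ c' → f a b c ≡ f a' b' c'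
    cong₃ f refl refl refl = refl

  cd-Λ : ∀ i → cd (Λ i) ≡ Λcode e₀ i
  cd-Λ i = cong₃ (λ a b c → pr 3 (pr 3 (cdImp (pr 1 (pr (pr 0 0) a)) (cdImp (pr 1 (pr (pr 0 1) b)) c))))
    (cdₜ-num {2} {0} e₀) (cdₜ-num {2} {0} i) e₀≡

  Derived : ℕ → ℕ → ℕ → Set
  Derived j x y = ⟦ P ⟧ (e₀ ∷ j ∷ x ∷ y ∷ [])

  Theta : ∀ {n} → ℕ → CF n
  Theta i = exC FIRST (num e₀ ∷ num i ∷ [])

  Λ⇒Θ : ∀ {Γ : Cxt 0} i → Γ ⊩' Λ i → Γ ⊩ Theta i
  Λ⇒Θ {Γ} i d = der (app (app instance₂ (thm axRefl)) (thm axRefl))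
    where
    σ = lookup (num {0} e₀ ∷ num i ∷ [])
    kernel : Formula 2
    kernel = var fz ≐ num e₀ ⇒ var (fs fz) ≐ num i ⇒ Θ
    instance₁ : Γ ⊩' fsub (lookup (num i ∷ [])) (∀' kernel)
    instance₁ = ∀E' (∀' kernel) (conv (sym (fsub-id (λ ()) (Λ i))) d) (num i)
    Θ-eq : fsub σ Θ ≡ ⌊ Theta i ⌋ᶜ
    Θ-eq = cong (fsub σ) Θ≡
    instance₂ : Γ ⊩' (num e₀ ≐ num e₀ ⇒ num i ≐ num i ⇒ ⌊ Theta i ⌋ᶜ)
    instance₂ = subst (Γ ⊩'_) (trans (cong₂ (λ a b → num e₀ ≐ a ⇒ num i ≐ b ⇒ fsub σ Θ) (tsub-num σ e₀) (tsub-num σ i))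
      (cong (λ φ → num e₀ ≐ num e₀ ⇒ num i ≐ num i ⇒ φ) Θ-eq)) (∀E' kernel instance₁ (num e₀))

  -- The two equations in front of Θ put its variables into `EnvEq`, so the true bounded instance is
  -- verified without substituting into Θ.
  Λ-provable : ∀ i y → ⟦ FIRST ⟧ (y ∷ e₀ ∷ i ∷ []) → PA ⊢ Λ i
  Λ-provable i y p = gen (gen (get {Γ = []} (lamr (lamr (conv (trans (fsub-id (λ { fz → refl ; (fs fz) → refl }) (∃' ⌊ FIRST ⌋)) (sym Θ≡)) (und
    (exI {σ = v0 ∷ v1 ∷ []} {FIRST} (num y) (verify FIRST p (refl⊩ ∷ der (hypr here₁) ∷ der (hypr here₀) ∷ [])))))))))

  -- Truth of stagewise derivability

  Th : ℕ → Theory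
  Th zero = T
  Th (suc i) ψ = T ψ ⊎ ψ ≡ Λ i

  T⇒Th : ∀ j {n} {φ : Formula n} → T ⊢ φ → Th j ⊢ φ
  T⇒Th zero d = d
  T⇒Th (suc i) d = ⊢-mono (λ {φ} t → subst (Th (suc i) ⊢_) (fsub-id (λ ()) φ) (ax (inj₁ t))) d

  Prv : ℕ → ℕ → Set
  Prv j = Levels.Prv (Th j)

  LIST-sound : ∀ j x y → ⟦ LIST ⟧ (e₀ ∷ j ∷ x ∷ y ∷ []) → Prv j x
  LIST-sound j x y (y' , _ , inj₁ p) = let n , φ , q , d = LISTED-sound e₀ 0 x y' p in n , φ , q , T⇒Th j d
  LIST-sound zero x y (y' , _ , inj₂ p) = LISTED-sound e₀ 0 x y' p
  LIST-sound (suc i) x y (y' , _ , inj₂ p) with LISTED-sound e₀ (suc i) x y' p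
  ... | refl = 0 , close↑ (Λ i) , trans (cd-fsub (λ ()) (Λ i)) (cd-Λ i) , ax (inj₂ refl)

  module _ (j x y μ w : ℕ) (x≤μ : x ≤ μ) (full : ⟦ FULL ⟧ (μ ∷ w ∷ []))
    (forced : ∀ s → s ≤ w → ⟦ CLOSED ⟧ (s ∷ μ ∷ []) → ⟦ CONTAINS ⟧ (e₀ ∷ j ∷ y ∷ μ ∷ s ∷ []) → x ∈ᶜ s) where

    private
      listed? : ∀ z → Dec (⟦ LIST ⟧ (e₀ ∷ j ∷ z ∷ y ∷ []))
      listed? z = ⟦ LIST ⟧? (e₀ ∷ j ∷ z ∷ y ∷ [])

      L₀ : List ℕ
      L₀ = filter listed? (upTo (suc μ))

    -- `FORCED` speaks of all closed sets, so one set of theorems of `Th j` suffices: the closure of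
    -- what is listed up to y, coded below w by `FULL-list`.
    forced-sound : Prv j x
    forced-sound = conclude (Closure.closure (Prv j) (Levels.Prv-mp (Th j)) (length (upTo (suc μ))) L₀ (upTo (suc μ)) ≤-refl
                     (λ m → LIST-sound j _ y (proj₂ (∈-filter⁻ listed? {xs = upTo (suc μ)} m))))
      where
      conclude : (∃ λ L → (∀ {z} → z ∈ L₀ → z ∈ L) × (∀ {z} → z ∈ L → Prv j z) × (∀ {z} → z ∈ L → z ∈ L₀ ⊎ z ∈ upTo (suc μ)) ×
        (∀ {a b} → cdImp a b ∈ L → a ∈ L → b ∈ L₀ ⊎ b ∈ upTo (suc μ) → b ∈ L)) → Prv j x
      conclude (L , sub , good , src , cl) = finish (FULL-list full L λ m →
          s≤s⁻¹ (∈-upTo⁻ ([ (λ k → proj₁ (∈-filter⁻ listed? {xs = upTo (suc μ)} k)) , id ]′ (src m))))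
        where
        finish : (∃ λ s → s ≤ w × (∀ i → i ≤ μ → (i ∈ᶜ s → i ∈ L) × (i ∈ L → i ∈ᶜ s))) → Prv j x
        finish (s , s≤ , h) = good (proj₁ (h x x≤μ) (forced s s≤
          (λ c c≤ a a≤ b b≤ i mc ma → proj₂ (h b (≤-trans b≤ c≤))
            (cl (subst (_∈ L) (IMP-elim a b c i) (proj₁ (h c c≤) mc)) (proj₁ (h a (≤-trans a≤ c≤)) ma) (inj₂ (∈-upTo⁺ (s≤s (≤-trans b≤ c≤))))))
          (λ z z≤ l → proj₂ (h z z≤) (sub (∈-filter⁺ listed? (∈-upTo⁺ (s≤s z≤)) l)))))

  opaque
    unfolding P

    P-sound : ∀ j x y → Derived j x y → Prv j x
    P-sound j x y (μ , _ , w , _ , _ , _ , full , x≤μ , forced) = forced-sound j x y μ w x≤μ full forced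

    -- The strict bound on μ in `DERIVES` serves this: stage 0 derives nothing, and the induction in
    -- `quiet` can start.
    P-stage₀ : ∀ j x → ¬ Derived j x 0
    P-stage₀ j x (μ , _ , w , _ , () , _)

    -- Any stage will do that lies above b, above the interval and above `width μ`, below which the
    -- required subset codes are found.
    P-true : ∀ j x μ b → x ≤ μ → (∀ y s → b ≤ y → ⟦ CLOSED ⟧ (s ∷ μ ∷ []) → ⟦ CONTAINS ⟧ (e₀ ∷ j ∷ y ∷ μ ∷ s ∷ []) → x ∈ᶜ s) →
             ∃ λ y → b ≤ y × Derived j x y
    P-true j x μ b x≤ h = y , b≤ , μ , ≤-trans (ℕₚ.n≤1+n μ) μ≤ , w , w≤ , μ≤ , w≤ , FULL-width μ , x≤ , λ s _ → h y s b≤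
      where
      w y : ℕ
      w = width μ
      y = b ⊔ (suc μ ⊔ w)
      b≤ : b ≤ y
      b≤ = m≤m⊔n b _
      μ≤ : suc μ ≤ y
      μ≤ = ≤-trans (m≤m⊔n (suc μ) w) (m≤n⊔m b _)
      w≤ : w ≤ y
      w≤ = ≤-trans (m≤n⊔m (suc μ) w) (m≤n⊔m b _)

  P-complete : ∀ {n} {φ : Formula n} → T ⊢ φ → ∃ λ y → Derived 0 (cd φ) y
  P-complete {n} {φ} d with LISTED-complete e₀ 0 (cd φ) (n , φ , refl , d)
  ... | b , l = let y , _ , p = P-true 0 (cd φ) (cd φ) b ≤-refl (λ y s b≤ _ c → c (cd φ) ≤-refl (b , b≤ , inj₁ l)) in y , p

  -- A single detachment: the implication is listed as a theorem of T, Λᵢ under its own index. The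
  -- stage can be pushed beyond any k, because stages inspect only worlds below themselves.
  P-complete-Λ : ∀ i {φ : Formula 0} → T ⊢ Λ i ⇒ φ → ∀ k → ∃ λ y → k ≤ y × Derived (suc i) (cd φ) y
  P-complete-Λ i {φ} d k with LISTED-complete e₀ 0 (cd (Λ i ⇒ φ)) (0 , (Λ i ⇒ φ) , refl , d) | LISTED-complete e₀ (suc i) (cd (Λ i)) (cd-Λ i)
  ... | b , l | b' , l' = let y , l≤ , p = P-true (suc i) (cd φ) μ (k ⊔ (b ⊔ b')) φ≤ member in y , ≤-trans (m≤m⊔n k _) l≤ , p
    where
    μ = cdImp (cd (Λ i)) (cd φ)
    φ≤ : cd φ ≤ μ
    φ≤ = ≤-trans (pr-≥ᵣ _ _) (pr-≥ᵣ _ _)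
    Λ≤ : cd (Λ i) ≤ μ
    Λ≤ = ≤-trans (pr-≥ₗ _ _) (pr-≥ᵣ _ _)
    member : ∀ y s → k ⊔ (b ⊔ b') ≤ y → ⟦ CLOSED ⟧ (s ∷ μ ∷ []) → ⟦ CONTAINS ⟧ (e₀ ∷ suc i ∷ y ∷ μ ∷ s ∷ []) → cd φ ∈ᶜ s
    member y s b≤ cl c = cl μ ≤-refl (cd (Λ i)) Λ≤ (cd φ) φ≤ (IMP-intro _ _)
      (c μ ≤-refl (b , ≤-trans (≤-trans (m≤m⊔n b b') (m≤n⊔m k _)) b≤ , inj₁ l))
      (c (cd (Λ i)) Λ≤ (b' , ≤-trans (≤-trans (m≤n⊔m b b') (m≤n⊔m k _)) b≤ , inj₂ l'))

  cd-⊥ : cd (⊥' {0}) ≡ 0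
  cd-⊥ = cd≡⌜⌝ (⊥' {0})

  refuted⇒inconsistent : ∀ i y → T ⊢ Λ i → ¬ Derived (suc i) 0 y
  refuted⇒inconsistent i y t p with P-sound (suc i) 0 y p
  ... | n , φ , q , d = consistent (⊢-mono (λ { (inj₁ a) → subst (T ⊢_) (fsub-id (λ ()) _) (ax a) ; (inj₂ refl) → t })
          (Levels.⊢-code (Th (suc i)) φ ⊥' (trans q (sym cd-⊥)) d))

  -- No stage is a trigger: the first one would make some Λ i both true, hence provable, and refutable.

  least-trigger : ∀ y j → j ≤ y → Derived (suc j) 0 y → ∃ λ i → ⟦ TRIGGER ⟧ (e₀ ∷ i ∷ y ∷ [])
  least-trigger y j j≤ p = go j 0 (ℕₚ.+-identityʳ j) (λ _ ())
    where
    go : ∀ k i → k + i ≡ j → (∀ i' → i' < i → ¬ Derived (suc i') 0 y) → ∃ λ i → ⟦ TRIGGER ⟧ (e₀ ∷ i ∷ y ∷ [])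
    stop : ∀ i → i ≤ y → (∀ i' → i' < i → ¬ Derived (suc i') 0 y) → Derived (suc i) 0 y → ∃ λ i → ⟦ TRIGGER ⟧ (e₀ ∷ i ∷ y ∷ [])
    stop i i≤ h q = i , i≤ , q , λ i' i'≤ → [ (λ lt → inj₂ (h i' lt)) , inj₁ ]′ (ℕₚ.m≤n⇒m<n∨m≡n i'≤)
    go zero i refl h = stop i j≤ h p
    go (suc k) i e h with ⟦ P ⟧? (e₀ ∷ suc i ∷ 0 ∷ y ∷ [])
    ... | yes q = stop i (≤-trans (≤-trans (m≤n+m i (suc k)) (≤-reflexive e)) j≤) h q
    ... | no q = go k (suc i) (trans (ℕₚ.+-suc k i) e) λ i' lt → [ h i' , (λ { refl → q }) ]′ (ℕₚ.m≤n⇒m<n∨m≡n (s≤s⁻¹ lt))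

  quiet : ∀ y → ⟦ QUIET ⟧ (e₀ ∷ y ∷ [])
  quiet zero .0 z≤n j _ p = P-stage₀ _ _ p
  quiet (suc y) y' y'≤ j j≤ p with ℕₚ.m≤n⇒m<n∨m≡n y'≤
  ... | inj₁ lt = quiet y y' (s≤s⁻¹ lt) j j≤ p
  ... | inj₂ refl = let i , t = least-trigger (suc y) j j≤ p in
    refuted⇒inconsistent i (suc y) (PA⇒T (Λ-provable i y (quiet y , t))) (proj₁ (proj₂ t))

  -- The provability predicate

  Prov₀ : ∀ {n} → ℕ → CF n
  Prov₀ x = exC PRB (num e₀ ∷ num x ∷ [])

  opaque
    Pr : Formula 1
    Pr = fsub (lookup (num e₀ ∷ v0 ∷ [])) (∃' ⌊ PRB ⌋)

    Pr-Σ₁ : Σ₁ Pr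
    Pr-Σ₁ = s-∃ (s-Δ₀ (Δ₀-sub {φ = ⌊ PRB ⌋} (lift (lookup (num e₀ ∷ v0 ∷ []))) (Δ₀-⌊⌋ PRB)))

    Pr-num : ∀ x → Pr [ num x ] ≡ ⌊ Prov₀ {0} x ⌋ᶜ
    Pr-num x = trans ([]-instS Pr (num x)) (trans (fsub-fsub _ _ (∃' ⌊ PRB ⌋))
      (fsub-cong {τ = lookup (num e₀ ∷ num x ∷ [])} (λ { fz → tsub-num _ e₀ ; (fs fz) → refl }) (∃' ⌊ PRB ⌋)))

  Pr-correct : ProvabilityPredicate T Pr
  Pr-correct φ = to , from
    where
    to : T ⊢ φ → PA ⊢ Pr [ num ⌜ φ ⌝ ]
    to d = let y , p = P-complete d in subst (PA ⊢_) (sym (Pr-num ⌜ φ ⌝))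
      (get (und (Σ₁-complete PRB (e₀ ∷ ⌜ φ ⌝ ∷ []) {y} (quiet y , inj₁ (subst (λ x → Derived 0 x y) (cd≡⌜⌝ φ) p)) {0} {[]})))
    from : PA ⊢ Pr [ num ⌜ φ ⌝ ] → T ⊢ φ
    from d with Σ₁-witness PRB (e₀ ∷ ⌜ φ ⌝ ∷ []) (subst (PA ⊢_) (Pr-num ⌜ φ ⌝) d)
    ... | y , _ , inj₁ p = let n , ψ , q , d' = P-sound 0 ⌜ φ ⌝ y p in Levels.⊢-code T ψ φ (trans q (sym (cd≡⌜⌝ φ))) d'
    -- The second way of satisfying `PRB` requires a trigger at the standard stage `suc y`, and
    -- there is none.
    ... | y , _ , inj₂ (i , _ , (i≤ , p , _) , _) = ⊥-elim (quiet (suc y) (suc y) ≤-refl i i≤ p)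

  ⌜⇒⌝ : ∀ (φ ψ : Formula 0) → ⌜ φ ⇒ ψ ⌝ ≡ cdImp ⌜ φ ⌝ ⌜ ψ ⌝
  ⌜⇒⌝ φ ψ = trans (sym (cd≡⌜⌝ (φ ⇒ ψ))) (cong₂ cdImp (cd≡⌜⌝ φ) (cd≡⌜⌝ ψ))

  module _ (φ ψ : Formula 0) where
    ⌜⇒⌝-IMP : ⟦ IMP ⟧ (⌜ φ ⌝ ∷ ⌜ ψ ⌝ ∷ ⌜ φ ⇒ ψ ⌝ ∷ [])
    ⌜⇒⌝-IMP = subst (λ c → ⟦ IMP ⟧ (⌜ φ ⌝ ∷ ⌜ ψ ⌝ ∷ c ∷ [])) (sym (⌜⇒⌝ φ ψ)) (IMP-intro _ _)
    ⌜⇒⌝-≥ₗ : ⌜ φ ⌝ ≤ ⌜ φ ⇒ ψ ⌝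
    ⌜⇒⌝-≥ₗ = ≤-trans (≤-trans (pr-≥ₗ _ _) (pr-≥ᵣ _ _)) (≤-reflexive (sym (⌜⇒⌝ φ ψ)))
    ⌜⇒⌝-≥ᵣ : ⌜ ψ ⌝ ≤ ⌜ φ ⇒ ψ ⌝
    ⌜⇒⌝-≥ᵣ = ≤-trans (≤-trans (pr-≥ᵣ _ _) (pr-≥ᵣ _ _)) (≤-reflexive (sym (⌜⇒⌝ φ ψ)))

  Pr-K : ∀ φ ψ → PA ⊢ Pr [ num ⌜ φ ⇒ ψ ⌝ ] ⇒ Pr [ num ⌜ φ ⌝ ] ⇒ Pr [ num ⌜ ψ ⌝ ]
  Pr-K φ ψ = get {Γ = []} (lam {c = raw (Pr [ num ⌜ φ ⇒ ψ ⌝ ])} (lam {c = raw (Pr [ num ⌜ φ ⌝ ])} (conv (sym (Pr-num ⌜ ψ ⌝)) (und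
    (Prov-mp (verify IMP (⌜⇒⌝-IMP φ ψ) (nums-eq (⌜ φ ⌝ ∷ ⌜ ψ ⌝ ∷ ⌜ φ ⇒ ψ ⌝ ∷ []))) (num-≤ (⌜⇒⌝-≥ₗ φ ψ)) (num-≤ (⌜⇒⌝-≥ᵣ φ ψ))
      (der (conv (Pr-num ⌜ φ ⇒ ψ ⌝) (hypr here₁))) (der (conv (Pr-num ⌜ φ ⌝) (hypr here₀))))))))

  K-sound : ∀ A f → K⊢ A → PA ⊢ interp Pr f A
  K-sound A f (taut t) = Kalmar.tautology Pr f A t
  K-sound _ f (axK {A} {B}) = Pr-K (interp Pr f A) (interp Pr f B)
  K-sound A f (mp d e) = mp (K-sound _ f d) (K-sound _ f e)
  K-sound _ f (nec {A} d) = proj₁ (Pr-correct (interp Pr f A)) (PA⇒T (K-sound A f d))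

  -- Worlds inside PA: valuations, successors and boxes at the first trigger

  FIELDS-elim : ∀ {i n v c} → ⟦ FIELDS ⟧ (i ∷ n ∷ v ∷ c ∷ []) → i ≡ pr n (pr v c)
  FIELDS-elim {i} {n} {v} {c} (q , _ , p , p') = trans (PAIR-elim n q i p) (cong (pr n) (PAIR-elim v c q p'))

  FIELDS-intro : ∀ n v c → ⟦ FIELDS ⟧ (pr n (pr v c) ∷ n ∷ v ∷ c ∷ [])
  FIELDS-intro n v c = pr v c , pr-≥ᵣ n _ , PAIR-intro n (pr v c) refl , PAIR-intro v c refl

  module _ (vs : List ℕ) (ts : List Tree) where
    private
      n = maximum (vs ++ᴸ codes ts)
      v = listCode vs n
      c = listCode (codes ts) n
      n≤ = pr-≥ₗ n (pr v c)
      v≤ = ≤-trans (pr-≥ₗ v c) (pr-≥ᵣ n (pr v c))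
      c≤ = ≤-trans (pr-≥ᵣ v c) (pr-≥ᵣ n (pr v c))

    VAL-intro : ∀ {p} → p ∈ vs → ⟦ VAL ⟧ (p ∷ code (node vs ts) ∷ [])
    VAL-intro {p} m = n , n≤ , v , v≤ , c , c≤ , FIELDS-intro n v c , p≤ , listCode-∋ vs n p p≤ m
      where p≤ = maximum-≥ (∈-++⁺ˡ m)

    VAL-elim : ∀ {p} → ⟦ VAL ⟧ (p ∷ code (node vs ts) ∷ []) → p ∈ vs
    VAL-elim {p} (n' , _ , v' , _ , c' , _ , fl , p≤ , m) with pr-inj (FIELDS-elim {n = n'} {v'} {c'} fl)
    ... | refl , q with pr-inj q
    ... | refl , refl = listCode-∌ vs n p p≤ m

    ACC-intro : ∀ {j} → j ∈ codes ts → ⟦ ACC ⟧ (code (node vs ts) ∷ j ∷ [])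
    ACC-intro {j} m = n , n≤ , v , v≤ , c , c≤ , FIELDS-intro n v c , j≤ , listCode-∋ (codes ts) n j j≤ m
      where j≤ = maximum-≥ (∈-++⁺ʳ vs m)

    ACC-elim : ∀ {j} → ⟦ ACC ⟧ (code (node vs ts) ∷ j ∷ []) → j ∈ codes ts
    ACC-elim {j} (n' , _ , v' , _ , c' , _ , fl , j≤ , m) with pr-inj (FIELDS-elim {n = n'} {v'} {c'} fl)
    ... | refl , q with pr-inj q
    ... | refl , refl = listCode-∌ (codes ts) n j j≤ m

    code-≥ : ∀ {j} → j ∈ codes ts → j ≤ code (node vs ts)
    code-≥ m = ≤-trans (maximum-≥ (∈-++⁺ʳ vs m)) n≤

  -- arguments y, e, p
  VARIABLE : Fm 3
  VARIABLE = exB (`S v0) (and (call FIRST (v1 ∷ v2 ∷ v0 ∷ [])) (call VAL (v3 ∷ v0 ∷ [])))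

  module _ {n : ℕ} {Γ : Cxt n} {y e i : Term n} where

    FIRST-quiet : Γ ⊩ First y e i → Γ ⊩ Quiet e y
    FIRST-quiet d = callE (∧E₁ d)

    FIRST-trigger : Γ ⊩ First y e i → Γ ⊩ Trigger e i (`S y)
    FIRST-trigger d = callE (∧E₂ d)

    -- the first trigger is nonstandard
    late : Γ ⊩ Eq e (num e₀) → Γ ⊩ First y e i → ∀ k → Γ ⊩ Le (num k) y
    late q d k = le-cases (num k) y h0
      (efq (QUIET-use (verify QUIET (quiet k) (up q ∷ refl⊩ ∷ [])) h0 (TRIGGER-le (up (FIRST-trigger d))) (TRIGGER-P (up (FIRST-trigger d)))))

    derived : ∀ {j x k jt xt} → Derived j x k → Γ ⊩ Eq e (num e₀) → Γ ⊩ Eq jt (num j) → Γ ⊩ Eq xt (num x) →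
              Γ ⊩ First y e i → Γ ⊩ Der e jt xt y
    derived {k = k} p q r s d = P-mono (verify P p (q ∷ r ∷ s ∷ refl⊩ ∷ [])) (late q d k)

  wk-num : ∀ {n} {Γ : Cxt (suc n)} {k} → Γ ⊩ Eq (wkT (num k)) (num k)
  wk-num {Γ = Γ} {k} = subst (λ t → Γ ⊩ Eq (wkT (num k)) t) (wkT-num k) refl⊩

  module _ {n : ℕ} {Γ : Cxt n} {y e i : Term n} where

    variable-true : ∀ {p W pt} → ⟦ VAL ⟧ (p ∷ W ∷ []) → EnvEq Γ (pt ∷ i ∷ []) (p ∷ W ∷ []) → Γ ⊩ First y e i →
                    Γ ⊩ exC VARIABLE (e ∷ pt ∷ [])
    variable-true h es d = exI y (exBI i (TRIGGER-le (FIRST-trigger d)) (∧I (callI d) (callI (verify VAL h es))))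

    variable-false : ∀ {p W pt} → ¬ ⟦ VAL ⟧ (p ∷ W ∷ []) → EnvEq Γ (pt ∷ i ∷ []) (p ∷ W ∷ []) → Γ ⊩ First y e i →
                     Γ ⊩ exC VARIABLE (e ∷ pt ∷ []) → Γ ⊩ Bot
    variable-false h es d x = cut d (exE (up x) (exBE h0 (negE (refute VAL h (env-head es' ∷
        trans⊩ (FIRST-world (FIRST-quiet (callE (∧E₁ h0))) (FIRST-trigger (callE (∧E₁ h0))) (FIRST-quiet h3) (FIRST-trigger h3))
               (env-head (env-tail es')) ∷ [])) (callE (∧E₂ h0)))))
      where es' = up-env (up-env (upW-env (up-env (upW-env (up-env es)))))

    module _ {vs : List ℕ} {ts : List Tree} {x : ℕ} {xt : Term n} (es : EnvEq Γ (e ∷ i ∷ xt ∷ []) (e₀ ∷ code (node vs ts) ∷ x ∷ []))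
      (d : Γ ⊩ First y e i) where

      box-true : (∀ {t} → t ∈ ts → ∃ λ k → Derived (suc (code t)) x k) → Γ ⊩ exC PRB (e ∷ xt ∷ [])
      box-true h = exI y (PRB-intro₂ (FIRST-quiet d) (FIRST-trigger d) (cut d (allBI (⊃I (callI
          -- The trigger is a known numeral, so a successor below it is one of finitely many
          -- numerals, and `ACC` is decided at each.
          (le-num-cases (code (node vs ts)) (leTrans h1 (le-eq (env-head (env-tail es')))) λ k _ → lam (und (successor k))))))))
        where
        es' = up-env (up-env (upW-env (up-env es)))
        successor : ∀ k → Eq v0 (num k) ∷ call ACC (v2 ∷ v0 ∷ []) ⟨ v0 ∷ wkT e ∷ wkT i ∷ wkT xt ∷ wkT y ∷ [] ⟩ ∷ Le v0 (wkT i) ∷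
                          First (wkT y) (wkT e) (wkT i) ∷ wkΓ Γ ⊩ Der (wkT e) (`S v0) (wkT xt) (wkT y)
        successor k with ⟦ ACC ⟧? (code (node vs ts) ∷ k ∷ [])
        ... | no a = efq (negE (refute ACC a (env-head (env-tail (up-env es')) ∷ h0 ∷ [])) (callE h1))
        ... | yes a with codes-∈⁻ ts (ACC-elim vs ts a)
        ...   | t , m , refl = let k' , p = h m in
                  derived p (env-head (up-env es')) (congS h0) (env-head (env-tail (env-tail (up-env es')))) h3

      -- Here c codes ¬x, derived from the sentence of t at a standard stage, hence before the
      -- trigger. Were x provable, it would be derived there from the same sentence, outright from T
      -- or through the box of the unique trigger, and modus ponens would refute t in the quiet
      -- period.
      box-false : ∀ {t c k} → t ∈ ts → ⟦ IMP ⟧ (x ∷ 0 ∷ c ∷ []) → x ≤ c → Derived (suc (code t)) c k → Γ ⊩ exC PRB (e ∷ xt ∷ []) → Γ ⊩ Bot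
      box-false {t} {c} m im x≤c p q = cut d (exE (up q) (cut prov (absurd es₁ h2 h0)))
        where
        j = code t
        es₁ = up-env (up-env (upW-env (up-env es)))
        es₂ = up-env (upW-env (up-env es))
        prov : Prb v0 (wkT e) (wkT xt) ∷ First (wkT y) (wkT e) (wkT i) ∷ wkΓ Γ ⊩ Der (wkT e) (`S (num j)) (wkT xt) (wkT y)
        prov = PRB-cases h0
          (P-zero (P-mono h0 (QUIET-before (PRB-quiet h1) (FIRST-trigger h2))))
          (BOX-use (BOX-i (FIRST-world (PRB-quiet h2) h1 (FIRST-quiet h3) (FIRST-trigger h3))
                   (BOX-y (FIRST-unique (PRB-quiet h2) h1 (FIRST-quiet h3) (FIRST-trigger h3)) h0))
            (leTrans (leTrans (le-eq wk-num) (num-≤ (code-≥ vs ts (codes-∈ m)))) (le-eq (sym⊩ (env-head (env-tail es₃)))))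
            (verify ACC (ACC-intro vs ts (codes-∈ m)) (env-head (env-tail es₃) ∷ wk-num ∷ [])))
          where es₃ = up-env (up-env (upW-env es₂))
        absurd : ∀ {n} {Δ : Cxt n} {y e i xt} → EnvEq Δ (e ∷ i ∷ xt ∷ []) (e₀ ∷ code (node vs ts) ∷ x ∷ []) → Δ ⊩ First y e i →
                 Δ ⊩ Der e (`S (num j)) xt y → Δ ⊩ Bot
        absurd {y = y} {xt = xt} (e≡ ∷ i≡ ∷ x≡ ∷ []) d p' = QUIET-use (FIRST-quiet d) leRefl (late e≡ d j)
          (P-mp {c = num c} (verify IMP im (x≡ ∷ refl⊩ ∷ refl⊩ ∷ [])) (leTrans (le-eq x≡) (num-≤ x≤c)) le-0
            (derived p e≡ refl⊩ refl⊩ d) p')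

  -- Each Λᵢ decides all modal formulas as its tree does

  opaque
    variables : ℕ → Formula 0
    variables p = ⌊ exC {0} VARIABLE (num e₀ ∷ num p ∷ []) ⌋ᶜ

    variables≡ : ∀ p → variables p ≡ ⌊ exC {0} VARIABLE (num e₀ ∷ num p ∷ []) ⌋ᶜ
    variables≡ p = refl

  open Kalmar Pr variables

  evalB-force : ∀ t A → evalB (force t) A ≡ force t A
  evalB-force t (`p i) = refl
  evalB-force t `⊥ = refl
  evalB-force t (`¬ A) = cong not (evalB-force t A)
  evalB-force t (A `∧ B) = cong₂ _∧_ (evalB-force t A) (evalB-force t B)
  evalB-force t (A `∨ B) = cong₂ _∨_ (evalB-force t A) (evalB-force t B)
  evalB-force t (A `→ B) = cong₂ (λ a b → not a ∨ b) (evalB-force t A) (evalB-force t B)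
  evalB-force t (□ A) = refl

  all-true⁻ : ∀ {X : Set} (f : X → Bool) l → all f l ≡ true → ∀ {x} → x ∈ l → f x ≡ true
  all-true⁻ f (x ∷ l) p m with f x in eq
  all-true⁻ f (x ∷ l) p (here refl) | true = eq
  all-true⁻ f (x ∷ l) p (there m) | true = all-true⁻ f l p m

  all-false⁻ : ∀ {X : Set} (f : X → Bool) l → all f l ≡ false → ∃ λ x → x ∈ l × f x ≡ false
  all-false⁻ f (x ∷ l) p with f x in eq
  ... | false = x , here refl , eq
  ... | true = let y , m , q = all-false⁻ f l p in y , there m , q

  under-Λ : ∀ k {φ} → Theta k ∷ [] ⊩' φ → T ⊢ Λ k ⇒ φ
  under-Λ k d = PA⇒T (get {Γ = []} (lamr (app (weaken (lam d)) (und (Λ⇒Θ k (hypr here₀))))))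

  world-value : ∀ t A {b} → force t A ≡ b → Theta (code t) ∷ [] ⊩' signed b (I A)
  world-atoms : ∀ t A → Decides (Theta (code t) ∷ []) (force t) (atoms A)
  -- The recursion with `box` is on the modal formula: the atom □A at one tree calls for A at its
  -- children.
  world : ∀ t A → Theta (code t) ∷ [] ⊩' signed (force t A) (I A)
  box : ∀ t A → Theta (code t) ∷ [] ⊩' signed (all (λ u → force u A) (children t)) (I (□ A))

  world t A = subst (λ b → Theta (code t) ∷ [] ⊩' signed b (I A)) (evalB-force t A) (kalmar (force t) A (world-atoms t A))

  world-value t A refl = world t A

  world-atoms (node vs ts) (`p i) (here refl) with i ∈? vs
  ... | yes m = conv (sym (variables≡ i)) (und (exE h0 (variable-true (VAL-intro vs ts m) (up-env (upW-env (nums-eq (i ∷ code (node vs ts) ∷ [])))) h0)))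
  ... | no m = lamr (und (exE h1 (variable-false (λ h → m (VAL-elim vs ts h)) (up-env (upW-env (nums-eq (i ∷ code (node vs ts) ∷ [])))) h0
                 (up (upW (der (conv (variables≡ i) (hypr here₀))))))))
  world-atoms t (`¬ A) m = world-atoms t A m
  world-atoms t (A `∧ B) m = [ world-atoms t A , world-atoms t B ]′ (∈-++⁻ (atoms A) m)
  world-atoms t (A `∨ B) m = [ world-atoms t A , world-atoms t B ]′ (∈-++⁻ (atoms A) m)
  world-atoms t (A `→ B) m = [ world-atoms t A , world-atoms t B ]′ (∈-++⁻ (atoms A) m)
  world-atoms t (□ A) (here refl) = box t A

  box (node vs ts) A with all (λ u → force u A) ts in eq
  ... | true = conv (sym (Pr-num ⌜ I A ⌝)) (und (exE h0 (box-true {vs = vs} {ts} (up-env (upW-env (nums-eq (e₀ ∷ code (node vs ts) ∷ ⌜ I A ⌝ ∷ [])))) h0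
      -- The recursive value of A is a theorem of T under Λ for t, so it is derived at some standard
      -- stage, and `late` puts the trigger beyond that.
      λ {t} m → let y , _ , p = P-complete-Λ (code t) (under-Λ (code t) (world-value t A (all-true⁻ _ ts eq m))) 0
        in y , subst (λ x → Derived (suc (code t)) x y) (cd≡⌜⌝ (I A)) p)))
  ... | false with all-false⁻ _ ts eq
  ...   | t , m , q = let y , _ , p = P-complete-Λ (code t) (under-Λ (code t) (world-value t A q)) 0 in
      lamr (und (exE h1 (box-false {vs = vs} {ts} (up-env (upW-env (nums-eq (e₀ ∷ code (node vs ts) ∷ ⌜ I A ⌝ ∷ [])))) h0 m
        (⌜⇒⌝-IMP (I A) ⊥') (⌜⇒⌝-≥ₗ (I A) ⊥') (subst (λ x → Derived (suc (code t)) x y) (cd≡⌜⌝ (¬' (I A))) p)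
        (up (upW (der (conv (Pr-num ⌜ I A ⌝) (hypr here₀))))))))

  K-arithmetically-complete : ∀ A → T ⊢ I A → K⊢ A
  K-arithmetically-complete A d with K-complete A
  ... | inj₁ k = k
  -- The stage is required to reach `code t` because `QUIET` inspects a world only from the stage of
  -- its own number on.
  ... | inj₂ (t , q) = ⊥-elim (refuted (P-complete-Λ (code t) contradiction (code t)))
    where
    contradiction : T ⊢ Λ (code t) ⇒ ⊥'
    contradiction = mp (mp axS (under-Λ (code t) (world-value t A q))) (mp axK d)
    refuted : ¬ ∃ λ y → code t ≤ y × Derived (suc (code t)) (cd (⊥' {0})) y
    refuted (y , k≤ , p) = quiet y y ≤-refl (code t) k≤ (subst (λ x → Derived (suc (code t)) x y) cd-⊥ p)

theoremA1 : (T : Theory) → PRAxiomatized T → Consistent T → ExtendsPA T →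
    Σ (Formula 1) λ Pr →
    Σ₁ Pr × ProvabilityPredicate T Pr ×
    (∀ (A : MF) (f : ℕ → Formula 0) → K⊢ A → PA ⊢ interp Pr f A) ×
    (Σ (ℕ → Formula 0) λ f → ∀ (A : MF) → K⊢ A ⟺ (T ⊢ interp Pr f A))
theoremA1 T (χ , spec) consistent extends =
  Pr , Pr-Σ₁ , Pr-correct , K-sound , variables , λ A → (λ d → PA⇒T (K-sound A variables d)) , K-arithmetically-complete A
  where open Completeness T χ spec consistent extends
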